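{- Every theorem of $\mathbf{IRS}$ is a theorem of $\mathcal{I}\mathcal{POR}^\lambda$ (under the translation of $\mathcal{RL}$-formulas replacing $\mathtt{0},\mathtt{1},\frown,\times$ by $\mathsf{0},\mathsf{1},\circ,\mathsf{Times}$).
   Context: $\mathcal{RL}$: terms $t::=x\mid\epsilon\mid\mathtt{0}\mid\mathtt{1}\mid t\frown t\mid t\times t$; formulas built from $\mathtt{Flip}(t)$, $t=s$, $t\subseteq s$ with $\neg,\wedge,\vee,\to,\exists,\forall$. $\mathtt{1}^t:=\mathtt{1}\times t$; $(\exists x\preceq t)F:=\exists x(\mathtt{1}^x\subseteq\mathtt{1}^t\wedge F)$; subword quantifiers $(\exists x\subseteq^*t)F:=\exists x\exists w(w\subseteq t\wedge wx\subseteq t\wedge F)$, $(\forall x\subseteq^*t)F:=\forall x(\exists w(w\subseteq t\wedge wx\subseteq t)\to F)$. $\Sigma^b_0$: smallest class containing atomic formulas, closed under Boolean connectives and subword quantifiers; $\Sigma^b_1$: $(\exists x_1\preceq t_1)\cdots(\exists x_n\preceq t_n)F$ with $F\in\Sigma^b_0$. $\mathbf{IRS}$: first-order theory with equality in $\mathcal{RL}$ over intuitionistic predicate logic, with axioms ($\mathtt{b}\in\{\mathtt{0},\mathtt{1}\}$): $x\epsilon=x$; $x(y\mathtt{b})=(xy)\mathtt{b}$; $x\times\epsilon=\epsilon$; $x\times y\mathtt{b}=(x\times y)x$; $x\subseteq\epsilon\leftrightarrow x=\epsilon$; $x\subseteq y\mathtt{b}\leftrightarrow x\subseteq y\vee x=y\mathtt{b}$;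 $x\mathtt{b}=y\mathtt{b}\to x=y$; $x\mathtt{0}\neq y\mathtt{1}$; $x\mathtt{b}\neq\epsilon$; and induction on notation $B(\epsilon)\wedge\forall x(B(x)\to B(x\mathtt{0})\wedge B(x\mathtt{1}))\to\forall xB(x)$ for $\Sigma^b_1$-formulas $B$. $\mathcal{POR}^\lambda$: simply typed $\lambda$-calculus with base type $s$ and constants $\mathsf{0},\mathsf{1},\epsilon:s$; $\circ$ (concatenation, written $xy$); $\mathsf{Tail}:s\Rightarrow s$; $\mathsf{Trunc}:s\Rightarrow s\Rightarrow s$; $\mathsf{Cond}:s\Rightarrow s\Rightarrow s\Rightarrow s\Rightarrow s$; $\mathsf{Flipcoin}:s\Rightarrow s$; $\mathsf{Rec}:s\Rightarrow(s\Rightarrow s\Rightarrow s)\Rightarrow(s\Rightarrow s\Rightarrow s)\Rightarrow(s\Rightarrow s)\Rightarrow s\Rightarrow s$, with equational axioms ($\mathsf{b}\in\{\mathsf{0},\mathsf{1}\}$): $\epsilon x=x\epsilon=x$; $x(y\mathsf{b})=(xy)\mathsf{b}$; $\mathsf{Tail}(\epsilon)=\epsilon$, $\mathsf{Tail}(x\mathsf{b})=x$; $\mathsf{Trunc}(x,\epsilon)=\mathsf{Trunc}(\epsilon,x)=\epsilon$, $\mathsf{Trunc}(x\mathsf{b},y\mathsf{0})=\mathsf{Trunc}(x\mathsf{b},y\mathsf{1})=\mathsf{Trunc}(x,y)\mathsf{b}$; $\mathsf{Cond}(\epsilon,y,z,w)=y$, $\mathsf{Cond}(x\mathsf{0},y,z,w)=z$,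 $\mathsf{Cond}(x\mathsf{1},y,z,w)=w$; $\mathsf{Bool}(\mathsf{Flipcoin}(x))=\mathsf{1}$; $\mathsf{Rec}(x,h_0,h_1,k,\epsilon)=x$, $\mathsf{Rec}(x,h_0,h_1,k,y\mathsf{b})=\mathsf{Trunc}(h_b\,y\,(\mathsf{Rec}(x,h_0,h_1,k,y)),k\,y)$; $\beta$- and $\eta$-axioms in contexts. Here $\mathsf{B}(x):=\mathsf{Cond}(x,\epsilon,\mathsf{0},\mathsf{1})$, $\mathsf{BNeg}(x):=\mathsf{Cond}(x,\epsilon,\mathsf{1},\mathsf{0})$, $\mathsf{BOr}(x,y):=\mathsf{Cond}(\mathsf{B}(x),\mathsf{B}(y),\mathsf{B}(y),\mathsf{1})$, $\mathsf{BAnd}(x,y):=\mathsf{Cond}(\mathsf{B}(x),\epsilon,\mathsf{0},\mathsf{B}(y))$, $\mathsf{Eps}(x):=\mathsf{Cond}(x,\mathsf{1},\mathsf{0},\mathsf{0})$, $\mathsf{Bool}(x):=\mathsf{BAnd}(\mathsf{Eps}(\mathsf{Tail}(x)),\mathsf{BNeg}(\mathsf{Eps}(x)))$; $\mathsf{Conc},\mathsf{Eq},\mathsf{Times},\mathsf{Sub}$ are the $\mathsf{Rec}$-defined terms with $\mathsf{Conc}(x,\epsilon)=x$, $\mathsf{Conc}(x,y\mathsf{b})=\mathsf{Conc}(x,y)\mathsf{b}$; $\mathsf{Eq}(\epsilon,\epsilon)=\mathsf{1}$, $\mathsf{Eq}(\epsilon,y\mathsf{b})=\mathsf{Eq}(x\mathsf{b},\epsilon)=\mathsf{Eq}(x\mathsf{0},y\mathsf{1})=\mathsf{Eq}(x\mathsf{1},y\mathsf{0})=\mathsf{0}$,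 $\mathsf{Eq}(x\mathsf{b},y\mathsf{b})=\mathsf{Eq}(x,y)$; $\mathsf{Times}(x,\epsilon)=\epsilon$, $\mathsf{Times}(x,y\mathsf{b})=\mathsf{Conc}(\mathsf{Times}(x,y),x)$; $\mathsf{Sub}(x,\epsilon)=\mathsf{Eps}(x)$, $\mathsf{Sub}(x,y\mathsf{b})=\mathsf{BOr}(\mathsf{Sub}(x,y),\mathsf{Eq}(x,y\mathsf{b}))$. $\mathcal{I}\mathcal{POR}^\lambda$: first-order intuitionistic theory with equality over $\mathcal{POR}^\lambda$-terms, formulas built from $t=u$, $t\subseteq u$, $\mathtt{Flip}(t)$ with $\wedge,\vee,\to,\forall,\exists$ ($\bot:=\mathsf{0}=\mathsf{1}$, $\neg F:=F\to\bot$); axioms: those of $\mathcal{POR}^\lambda$; $x\subseteq y\leftrightarrow\mathsf{Sub}(x,y)=\mathsf{1}$; $x=\epsilon\vee x=\mathsf{Tail}(x)\mathsf{0}\vee x=\mathsf{Tail}(x)\mathsf{1}$; $\mathsf{0}=\mathsf{1}\to x=\epsilon$; $\mathsf{Cond}(x,y,z,w)=w'\leftrightarrow(x=\epsilon\wedge w'=y)\vee(x=\mathsf{Tail}(x)\mathsf{0}\wedge w'=z)\vee(x=\mathsf{Tail}(x)\mathsf{1}\wedge w'=w)$; $\mathtt{Flip}(x)\leftrightarrow\mathsf{Flipcoin}(x)=\mathsf{1}$; NP-induction $(F(\epsilon)\wedge\forall x(F(x)\to F(x\mathsf{0}))\wedge\forall x(F(x)\to F(x\mathsf{1})))\to\forall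 yF(y)$ for $F$ of the form $(\exists z\preceq t)u=v$ with $t$ containing only first-order open variables. -}

module Defs where

open import Data.Nat using (ℕ; zero; suc)
open import Data.Fin using (Fin; zero; suc)
open import Data.List using (List; []; _∷_; map)
open import Data.List.Membership.Propositional using (_∈_)

data Bit : Set where
  b0 b1 : Bit

module RL where

  infixl 8 _⌢_
  infixl 7 _⊗_
  infix  5 _≐_ _⊑_ _≠_
  infixr 4 _∧'_
  infixr 3 _∨'_
  infixr 2 _⇒_
  infix  1 _⇔_

  data Tm (n : ℕ) : Set where
    var   : Fin n → Tm n
    ε     : Tm n
    𝟘 𝟙   : Tm n
    _⌢_   : Tm n → Tm n → Tm n
    _⊗_   : Tm n → Tm n → Tm n

  data Fm (n : ℕ) : Set where
    Flip  : Tm n → Fm n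
    _≐_   : Tm n → Tm n → Fm n
    _⊑_   : Tm n → Tm n → Fm n
    ¬'    : Fm n → Fm n
    _∧'_  : Fm n → Fm n → Fm n
    _∨'_  : Fm n → Fm n → Fm n
    _⇒_   : Fm n → Fm n → Fm n
    ∃'    : Fm (suc n) → Fm n
    ∀'    : Fm (suc n) → Fm n

  bit : ∀ {n} → Bit → Tm n
  bit b0 = 𝟘
  bit b1 = 𝟙

  _⇔_ : ∀ {n} → Fm n → Fm n → Fm n
  A ⇔ B = (A ⇒ B) ∧' (B ⇒ A)

  _≠_ : ∀ {n} → Tm n → Tm n → Fm n
  t ≠ u = ¬' (t ≐ u)

  extR : ∀ {n m} → (Fin n → Fin m) → Fin (suc n) → Fin (suc m)
  extR ρ zero    = zero
  extR ρ (suc i) = suc (ρ i)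

  renT : ∀ {n m} → (Fin n → Fin m) → Tm n → Tm m
  renT ρ (var i) = var (ρ i)
  renT ρ ε       = ε
  renT ρ 𝟘       = 𝟘
  renT ρ 𝟙       = 𝟙
  renT ρ (t ⌢ u) = renT ρ t ⌢ renT ρ u
  renT ρ (t ⊗ u) = renT ρ t ⊗ renT ρ u

  renF : ∀ {n m} → (Fin n → Fin m) → Fm n → Fm m
  renF ρ (Flip t)  = Flip (renT ρ t)
  renF ρ (t ≐ u)   = renT ρ t ≐ renT ρ u
  renF ρ (t ⊑ u)   = renT ρ t ⊑ renT ρ u
  renF ρ (¬' A)    = ¬' (renF ρ A)
  renF ρ (A ∧' B)  = renF ρ A ∧' renF ρ B
  renF ρ (A ∨' B)  = renF ρ A ∨' renF ρ B
  renF ρ (A ⇒ B)   = renF ρ A ⇒ renF ρ B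
  renF ρ (∃' A)    = ∃' (renF (extR ρ) A)
  renF ρ (∀' A)    = ∀' (renF (extR ρ) A)

  wkT : ∀ {n} → Tm n → Tm (suc n)
  wkT = renT suc

  wkF : ∀ {n} → Fm n → Fm (suc n)
  wkF = renF suc

  extS : ∀ {n m} → (Fin n → Tm m) → Fin (suc n) → Tm (suc m)
  extS σ zero    = var zero
  extS σ (suc i) = wkT (σ i)

  subT : ∀ {n m} → (Fin n → Tm m) → Tm n → Tm m
  subT σ (var i) = σ i
  subT σ ε       = ε
  subT σ 𝟘       = 𝟘
  subT σ 𝟙       = 𝟙
  subT σ (t ⌢ u) = subT σ t ⌢ subT σ u
  subT σ (t ⊗ u) = subT σ t ⊗ subT σ u

  subF : ∀ {n m} → (Fin n → Tm m) → Fm n → Fm m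
  subF σ (Flip t)  = Flip (subT σ t)
  subF σ (t ≐ u)   = subT σ t ≐ subT σ u
  subF σ (t ⊑ u)   = subT σ t ⊑ subT σ u
  subF σ (¬' A)    = ¬' (subF σ A)
  subF σ (A ∧' B)  = subF σ A ∧' subF σ B
  subF σ (A ∨' B)  = subF σ A ∨' subF σ B
  subF σ (A ⇒ B)   = subF σ A ⇒ subF σ B
  subF σ (∃' A)    = ∃' (subF (extS σ) A)
  subF σ (∀' A)    = ∀' (subF (extS σ) A)

  σ₀ : ∀ {n} → Tm n → Fin (suc n) → Tm n
  σ₀ t zero    = t
  σ₀ t (suc i) = var i

  _[_]₀ : ∀ {n} → Fm (suc n) → Tm n → Fm n
  A [ t ]₀ = subF (σ₀ t) A

  σb : ∀ {n} → Bit → Fin (suc n) → Tm (suc n)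
  σb b zero    = var zero ⌢ bit b
  σb b (suc i) = var (suc i)

  one^ : ∀ {n} → Tm n → Tm n
  one^ t = 𝟙 ⊗ t

  ∃⪯ : ∀ {n} → Tm n → Fm (suc n) → Fm n
  ∃⪯ t F = ∃' ((one^ (var zero) ⊑ one^ (wkT t)) ∧' F)

  wk1F : ∀ {n} → Fm (suc n) → Fm (suc (suc n))
  wk1F = renF suc

  ∃⊆* : ∀ {n} → Tm n → Fm (suc n) → Fm n
  ∃⊆* t F = ∃' (∃' ((var zero ⊑ wkT (wkT t))
                    ∧' ((var zero ⌢ var (suc zero)) ⊑ wkT (wkT t))
                    ∧' wk1F F))

  ∀⊆* : ∀ {n} → Tm n → Fm (suc n) → Fm n
  ∀⊆* t F = ∀' (∃' ((var zero ⊑ wkT (wkT t))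
                    ∧' ((var zero ⌢ var (suc zero)) ⊑ wkT (wkT t)))
                ⇒ F)

  data Σb0 : ∀ {n} → Fm n → Set where
    flip : ∀ {n} (t : Tm n) → Σb0 (Flip t)
    eq   : ∀ {n} (t u : Tm n) → Σb0 (t ≐ u)
    sub  : ∀ {n} (t u : Tm n) → Σb0 (t ⊑ u)
    neg  : ∀ {n} {A : Fm n} → Σb0 A → Σb0 (¬' A)
    and  : ∀ {n} {A B : Fm n} → Σb0 A → Σb0 B → Σb0 (A ∧' B)
    or   : ∀ {n} {A B : Fm n} → Σb0 A → Σb0 B → Σb0 (A ∨' B)
    imp  : ∀ {n} {A B : Fm n} → Σb0 A → Σb0 B → Σb0 (A ⇒ B)
    ex⊆  : ∀ {n} (t : Tm n) {F : Fm (suc n)} → Σb0 F → Σb0 (∃⊆* t F)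
    all⊆ : ∀ {n} (t : Tm n) {F : Fm (suc n)} → Σb0 F → Σb0 (∀⊆* t F)

  data Σb1 : ∀ {n} → Fm n → Set where
    base : ∀ {n} {F : Fm n} → Σb0 F → Σb1 F
    ex⪯  : ∀ {n} (t : Tm n) {F : Fm (suc n)} → Σb1 F → Σb1 (∃⪯ t F)

  data IRSAx : ∀ {n} → Fm n → Set where
    concε  : ∀ {n} (x : Tm n) → IRSAx (x ⌢ ε ≐ x)
    concB  : ∀ {n} (x y : Tm n) (b : Bit) →
             IRSAx (x ⌢ (y ⌢ bit b) ≐ (x ⌢ y) ⌢ bit b)
    timesε : ∀ {n} (x : Tm n) → IRSAx (x ⊗ ε ≐ ε)
    timesB : ∀ {n} (x y : Tm n) (b : Bit) →
             IRSAx (x ⊗ (y ⌢ bit b) ≐ (x ⊗ y) ⌢ x)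
    subε   : ∀ {n} (x : Tm n) → IRSAx ((x ⊑ ε) ⇔ (x ≐ ε))
    subB   : ∀ {n} (x y : Tm n) (b : Bit) →
             IRSAx ((x ⊑ y ⌢ bit b) ⇔ ((x ⊑ y) ∨' (x ≐ y ⌢ bit b)))
    inj    : ∀ {n} (x y : Tm n) (b : Bit) →
             IRSAx ((x ⌢ bit b ≐ y ⌢ bit b) ⇒ (x ≐ y))
    dist01 : ∀ {n} (x y : Tm n) → IRSAx (x ⌢ 𝟘 ≠ y ⌢ 𝟙)
    nonε   : ∀ {n} (x : Tm n) (b : Bit) → IRSAx (x ⌢ bit b ≠ ε)
    ind    : ∀ {n} (B : Fm (suc n)) → Σb1 B →
             IRSAx (((B [ ε ]₀) ∧' ∀' (B ⇒ (subF (σb b0) B ∧' subF (σb b1) B)))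
                    ⇒ ∀' B)

  infix 1 _⊢_
  data _⊢_ : ∀ {n} → List (Fm n) → Fm n → Set where
    ax   : ∀ {n} {Γ : List (Fm n)} {A} → IRSAx A → Γ ⊢ A
    hyp  : ∀ {n} {Γ : List (Fm n)} {A} → A ∈ Γ → Γ ⊢ A
    ∧I   : ∀ {n} {Γ : List (Fm n)} {A B} → Γ ⊢ A → Γ ⊢ B → Γ ⊢ A ∧' B
    ∧E₁  : ∀ {n} {Γ : List (Fm n)} {A B} → Γ ⊢ A ∧' B → Γ ⊢ A
    ∧E₂  : ∀ {n} {Γ : List (Fm n)} {A B} → Γ ⊢ A ∧' B → Γ ⊢ B
    ∨I₁  : ∀ {n} {Γ : List (Fm n)} {A B} → Γ ⊢ A → Γ ⊢ A ∨' B
    ∨I₂  : ∀ {n} {Γ : List (Fm n)} {A B} → Γ ⊢ B → Γ ⊢ A ∨' B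
    ∨E   : ∀ {n} {Γ : List (Fm n)} {A B C} →
           Γ ⊢ A ∨' B → A ∷ Γ ⊢ C → B ∷ Γ ⊢ C → Γ ⊢ C
    ⇒I   : ∀ {n} {Γ : List (Fm n)} {A B} → A ∷ Γ ⊢ B → Γ ⊢ A ⇒ B
    ⇒E   : ∀ {n} {Γ : List (Fm n)} {A B} → Γ ⊢ A ⇒ B → Γ ⊢ A → Γ ⊢ B
    ¬I   : ∀ {n} {Γ : List (Fm n)} {A B} →
           A ∷ Γ ⊢ B → A ∷ Γ ⊢ ¬' B → Γ ⊢ ¬' A
    ¬E   : ∀ {n} {Γ : List (Fm n)} {A B} → Γ ⊢ A → Γ ⊢ ¬' A → Γ ⊢ B
    ∀I   : ∀ {n} {Γ : List (Fm n)} {A} → map wkF Γ ⊢ A → Γ ⊢ ∀' A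
    ∀E   : ∀ {n} {Γ : List (Fm n)} {A} → Γ ⊢ ∀' A → (t : Tm n) → Γ ⊢ A [ t ]₀
    ∃I   : ∀ {n} {Γ : List (Fm n)} {A} (t : Tm n) → Γ ⊢ A [ t ]₀ → Γ ⊢ ∃' A
    ∃E   : ∀ {n} {Γ : List (Fm n)} {A C} →
           Γ ⊢ ∃' A → A ∷ map wkF Γ ⊢ wkF C → Γ ⊢ C
    refl= : ∀ {n} {Γ : List (Fm n)} (t : Tm n) → Γ ⊢ t ≐ t
    subst= : ∀ {n} {Γ : List (Fm n)} (A : Fm (suc n)) {t u : Tm n} →
             Γ ⊢ t ≐ u → Γ ⊢ A [ t ]₀ → Γ ⊢ A [ u ]₀

module POR where

  infixr 7 _⇒_
  data Ty : Set where
    ι   : Ty                 -- the base type s (strings)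
    _⇒_ : Ty → Ty → Ty

  Ctx : Set
  Ctx = List Ty

  infix 4 _∋_
  data _∋_ : Ctx → Ty → Set where
    here  : ∀ {Γ A} → (A ∷ Γ) ∋ A
    there : ∀ {Γ A B} → Γ ∋ A → (B ∷ Γ) ∋ A

  infixl 9 _·_
  data Tm (Γ : Ctx) : Ty → Set where
    var       : ∀ {A} → Γ ∋ A → Tm Γ A
    lam       : ∀ {A B} → Tm (A ∷ Γ) B → Tm Γ (A ⇒ B)
    _·_       : ∀ {A B} → Tm Γ (A ⇒ B) → Tm Γ A → Tm Γ B
    `0 `1 `ε  : Tm Γ ι
    `∘        : Tm Γ (ι ⇒ ι ⇒ ι)
    `Tail     : Tm Γ (ι ⇒ ι)
    `Trunc    : Tm Γ (ι ⇒ ι ⇒ ι)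
    `Cond     : Tm Γ (ι ⇒ ι ⇒ ι ⇒ ι ⇒ ι)
    `Flipcoin : Tm Γ (ι ⇒ ι)
    `Rec      : Tm Γ (ι ⇒ (ι ⇒ ι ⇒ ι) ⇒ (ι ⇒ ι ⇒ ι) ⇒ (ι ⇒ ι) ⇒ ι ⇒ ι)

  Ren : Ctx → Ctx → Set
  Ren Γ Δ = ∀ {A} → Γ ∋ A → Δ ∋ A

  Sub : Ctx → Ctx → Set
  Sub Γ Δ = ∀ {A} → Γ ∋ A → Tm Δ A

  extR : ∀ {Γ Δ B} → Ren Γ Δ → Ren (B ∷ Γ) (B ∷ Δ)
  extR ρ here      = here
  extR ρ (there x) = there (ρ x)

  ren : ∀ {Γ Δ A} → Ren Γ Δ → Tm Γ A → Tm Δ A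
  ren ρ (var x)   = var (ρ x)
  ren ρ (lam t)   = lam (ren (extR ρ) t)
  ren ρ (t · u)   = ren ρ t · ren ρ u
  ren ρ `0        = `0
  ren ρ `1        = `1
  ren ρ `ε        = `ε
  ren ρ `∘        = `∘
  ren ρ `Tail     = `Tail
  ren ρ `Trunc    = `Trunc
  ren ρ `Cond     = `Cond
  ren ρ `Flipcoin = `Flipcoin
  ren ρ `Rec      = `Rec

  extS : ∀ {Γ Δ B} → Sub Γ Δ → Sub (B ∷ Γ) (B ∷ Δ)
  extS σ here      = var here
  extS σ (there x) = ren there (σ x)

  sub : ∀ {Γ Δ A} → Sub Γ Δ → Tm Γ A → Tm Δ A
  sub σ (var x)   = σ x
  sub σ (lam t)   = lam (sub (extS σ) t)
  sub σ (t · u)   = sub σ t · sub σ u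
  sub σ `0        = `0
  sub σ `1        = `1
  sub σ `ε        = `ε
  sub σ `∘        = `∘
  sub σ `Tail     = `Tail
  sub σ `Trunc    = `Trunc
  sub σ `Cond     = `Cond
  sub σ `Flipcoin = `Flipcoin
  sub σ `Rec      = `Rec

  σ₀ : ∀ {Γ B} → Tm Γ B → Sub (B ∷ Γ) Γ
  σ₀ u here      = u
  σ₀ u (there x) = var x

  wk₀ : ∀ {Γ A} → Tm [] A → Tm Γ A
  wk₀ = ren (λ ())

  infixl 8 _∘_
  _∘_ : ∀ {Γ} → Tm Γ ι → Tm Γ ι → Tm Γ ι
  x ∘ y = `∘ · x · y

  bit : ∀ {Γ} → Bit → Tm Γ ι
  bit b0 = `0
  bit b1 = `1

  Tail : ∀ {Γ} → Tm Γ ι → Tm Γ ι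
  Tail x = `Tail · x

  Trunc : ∀ {Γ} → Tm Γ ι → Tm Γ ι → Tm Γ ι
  Trunc x y = `Trunc · x · y

  Cond : ∀ {Γ} → Tm Γ ι → Tm Γ ι → Tm Γ ι → Tm Γ ι → Tm Γ ι
  Cond x y z w = `Cond · x · y · z · w

  Flipcoin : ∀ {Γ} → Tm Γ ι → Tm Γ ι
  Flipcoin x = `Flipcoin · x

  Rec : ∀ {Γ} → Tm Γ ι → Tm Γ (ι ⇒ ι ⇒ ι) → Tm Γ (ι ⇒ ι ⇒ ι) →
        Tm Γ (ι ⇒ ι) → Tm Γ ι → Tm Γ ι
  Rec x h₀ h₁ k y = `Rec · x · h₀ · h₁ · k · y

  Bt : ∀ {Γ} → Tm Γ ι → Tm Γ ι
  Bt x = Cond x `ε `0 `1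

  BNeg : ∀ {Γ} → Tm Γ ι → Tm Γ ι
  BNeg x = Cond x `ε `1 `0

  BOr : ∀ {Γ} → Tm Γ ι → Tm Γ ι → Tm Γ ι
  BOr x y = Cond (Bt x) (Bt y) (Bt y) `1

  BAnd : ∀ {Γ} → Tm Γ ι → Tm Γ ι → Tm Γ ι
  BAnd x y = Cond (Bt x) `ε `0 (Bt y)

  Eps : ∀ {Γ} → Tm Γ ι → Tm Γ ι
  Eps x = Cond x `1 `0 `0

  Bool : ∀ {Γ} → Tm Γ ι → Tm Γ ι
  Bool x = BAnd (Eps (Tail x)) (BNeg (Eps x))

  -- The Rec-defined terms Conc, Eq, Times, Sub.  The paper only uses them
  -- through their defining equations; we take them as arbitrary closed
  -- terms and add those equations.
  record Defined : Set where
    field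
      conc eq times subw : Tm [] (ι ⇒ ι ⇒ ι)

  module WithDefs (D : Defined) where
    open Defined D

    Conc : ∀ {Γ} → Tm Γ ι → Tm Γ ι → Tm Γ ι
    Conc x y = wk₀ conc · x · y

    Eq : ∀ {Γ} → Tm Γ ι → Tm Γ ι → Tm Γ ι
    Eq x y = wk₀ eq · x · y

    Times : ∀ {Γ} → Tm Γ ι → Tm Γ ι → Tm Γ ι
    Times x y = wk₀ times · x · y

    Subw : ∀ {Γ} → Tm Γ ι → Tm Γ ι → Tm Γ ι
    Subw x y = wk₀ subw · x · y

    data Axiom {Γ : Ctx} : ∀ {A} → Tm Γ A → Tm Γ A → Set where
      εl      : (x : Tm Γ ι) → Axiom (`ε ∘ x) x
      εr      : (x : Tm Γ ι) → Axiom (x ∘ `ε) x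
      assoc   : (x y : Tm Γ ι) (b : Bit) → Axiom (x ∘ (y ∘ bit b)) ((x ∘ y) ∘ bit b)
      tailε   : Axiom (Tail `ε) `ε
      tailB   : (x : Tm Γ ι) (b : Bit) → Axiom (Tail (x ∘ bit b)) x
      truncε₁ : (x : Tm Γ ι) → Axiom (Trunc x `ε) `ε
      truncε₂ : (x : Tm Γ ι) → Axiom (Trunc `ε x) `ε
      truncB  : (x y : Tm Γ ι) (b c : Bit) →
                Axiom (Trunc (x ∘ bit b) (y ∘ bit c)) (Trunc x y ∘ bit b)
      condε   : (y z w : Tm Γ ι) → Axiom (Cond `ε y z w) y
      cond0   : (x y z w : Tm Γ ι) → Axiom (Cond (x ∘ `0) y z w) z
      cond1   : (x y z w : Tm Γ ι) → Axiom (Cond (x ∘ `1) y z w) w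
      flip    : (x : Tm Γ ι) → Axiom (Bool (Flipcoin x)) `1
      recε    : (x : Tm Γ ι) (h₀ h₁ : Tm Γ (ι ⇒ ι ⇒ ι)) (k : Tm Γ (ι ⇒ ι)) →
                Axiom (Rec x h₀ h₁ k `ε) x
      rec0    : (x : Tm Γ ι) (h₀ h₁ : Tm Γ (ι ⇒ ι ⇒ ι)) (k : Tm Γ (ι ⇒ ι)) (y : Tm Γ ι) →
                Axiom (Rec x h₀ h₁ k (y ∘ `0)) (Trunc (h₀ · y · Rec x h₀ h₁ k y) (k · y))
      rec1    : (x : Tm Γ ι) (h₀ h₁ : Tm Γ (ι ⇒ ι ⇒ ι)) (k : Tm Γ (ι ⇒ ι)) (y : Tm Γ ι) →
                Axiom (Rec x h₀ h₁ k (y ∘ `1)) (Trunc (h₁ · y · Rec x h₀ h₁ k y) (k · y))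
      concε   : (x : Tm Γ ι) → Axiom (Conc x `ε) x
      concB   : (x y : Tm Γ ι) (b : Bit) → Axiom (Conc x (y ∘ bit b)) (Conc x y ∘ bit b)
      eqεε    : Axiom (Eq `ε `ε) `1
      eqεB    : (y : Tm Γ ι) (b : Bit) → Axiom (Eq `ε (y ∘ bit b)) `0
      eqBε    : (x : Tm Γ ι) (b : Bit) → Axiom (Eq (x ∘ bit b) `ε) `0
      eq01    : (x y : Tm Γ ι) → Axiom (Eq (x ∘ `0) (y ∘ `1)) `0
      eq10    : (x y : Tm Γ ι) → Axiom (Eq (x ∘ `1) (y ∘ `0)) `0
      eqBB    : (x y : Tm Γ ι) (b : Bit) → Axiom (Eq (x ∘ bit b) (y ∘ bit b)) (Eq x y)
      timesε  : (x : Tm Γ ι) → Axiom (Times x `ε) `ε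
      timesB  : (x y : Tm Γ ι) (b : Bit) → Axiom (Times x (y ∘ bit b)) (Conc (Times x y) x)
      subε    : (x : Tm Γ ι) → Axiom (Subw x `ε) (Eps x)
      subB    : (x y : Tm Γ ι) (b : Bit) →
                Axiom (Subw x (y ∘ bit b)) (BOr (Subw x y) (Eq x (y ∘ bit b)))
      β       : ∀ {A B} (t : Tm (A ∷ Γ) B) (u : Tm Γ A) → Axiom (lam t · u) (sub (σ₀ u) t)
      η       : ∀ {A B} (t : Tm Γ (A ⇒ B)) → Axiom (lam (ren there t · var here)) t

    infix 1 _⊢_≈_
    data _⊢_≈_ (Γ : Ctx) : ∀ {A} → Tm Γ A → Tm Γ A → Set where
      axiom : ∀ {A} {t u : Tm Γ A} → Axiom t u → Γ ⊢ t ≈ u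
      refl≈ : ∀ {A} (t : Tm Γ A) → Γ ⊢ t ≈ t
      sym≈  : ∀ {A} {t u : Tm Γ A} → Γ ⊢ t ≈ u → Γ ⊢ u ≈ t
      trans≈ : ∀ {A} {t u v : Tm Γ A} → Γ ⊢ t ≈ u → Γ ⊢ u ≈ v → Γ ⊢ t ≈ v
      app≈  : ∀ {A B} {t t' : Tm Γ (A ⇒ B)} {u u' : Tm Γ A} →
              Γ ⊢ t ≈ t' → Γ ⊢ u ≈ u' → Γ ⊢ t · u ≈ t' · u'
      lam≈  : ∀ {A B} {t t' : Tm (A ∷ Γ) B} → (A ∷ Γ) ⊢ t ≈ t' → Γ ⊢ lam t ≈ lam t'

  ιs : ℕ → Ctx
  ιs zero    = []
  ιs (suc n) = ι ∷ ιs n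

  FTm : ℕ → Set
  FTm n = Tm (ιs n) ι

  infix  5 _≐_ _⊑_
  infixr 4 _∧'_
  infixr 3 _∨'_
  infixr 2 _⊃_
  infix  1 _⇔_

  data Fm (n : ℕ) : Set where
    _≐_  : FTm n → FTm n → Fm n
    _⊑_  : FTm n → FTm n → Fm n
    Flip : FTm n → Fm n
    _∧'_ : Fm n → Fm n → Fm n
    _∨'_ : Fm n → Fm n → Fm n
    _⊃_  : Fm n → Fm n → Fm n
    ∀'   : Fm (suc n) → Fm n
    ∃'   : Fm (suc n) → Fm n

  ⊥' : ∀ {n} → Fm n
  ⊥' = `0 ≐ `1

  ¬' : ∀ {n} → Fm n → Fm n
  ¬' A = A ⊃ ⊥'

  _⇔_ : ∀ {n} → Fm n → Fm n → Fm n
  A ⇔ B = (A ⊃ B) ∧' (B ⊃ A)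

  subF : ∀ {n m} → Sub (ιs n) (ιs m) → Fm n → Fm m
  subF σ (t ≐ u)  = sub σ t ≐ sub σ u
  subF σ (t ⊑ u)  = sub σ t ⊑ sub σ u
  subF σ (Flip t) = Flip (sub σ t)
  subF σ (A ∧' B) = subF σ A ∧' subF σ B
  subF σ (A ∨' B) = subF σ A ∨' subF σ B
  subF σ (A ⊃ B)  = subF σ A ⊃ subF σ B
  subF σ (∀' A)   = ∀' (subF (extS σ) A)
  subF σ (∃' A)   = ∃' (subF (extS σ) A)

  wkF : ∀ {n} → Fm n → Fm (suc n)
  wkF = subF (λ x → var (there x))

  wkT : ∀ {n} → FTm n → FTm (suc n)
  wkT = ren there

  _[_]₀ : ∀ {n} → Fm (suc n) → FTm n → Fm n
  A [ t ]₀ = subF (σ₀ t) A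

  σb : ∀ {n} → Bit → Sub (ιs (suc n)) (ιs (suc n))
  σb b here      = var here ∘ bit b
  σb b (there x) = var (there x)

  module Theory (D : Defined) where
    open WithDefs D

    ∃⪯ : ∀ {n} → FTm n → Fm (suc n) → Fm n
    ∃⪯ t F = ∃' ((Times `1 (var here) ⊑ Times `1 (wkT t)) ∧' F)

    data IPORAx : ∀ {n} → Fm n → Set where
      por    : ∀ {n} {t u : FTm n} → ιs n ⊢ t ≈ u → IPORAx (t ≐ u)
      subDef : ∀ {n} (x y : FTm n) → IPORAx ((x ⊑ y) ⇔ (Subw x y ≐ `1))
      cases  : ∀ {n} (x : FTm n) →
               IPORAx ((x ≐ `ε) ∨' (x ≐ Tail x ∘ `0) ∨' (x ≐ Tail x ∘ `1))
      exfalso : ∀ {n} (x : FTm n) → IPORAx ((`0 ≐ `1) ⊃ (x ≐ `ε))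
      condDef : ∀ {n} (x y z w w' : FTm n) →
               IPORAx ((Cond x y z w ≐ w') ⇔
                        (((x ≐ `ε) ∧' (w' ≐ y))
                         ∨' ((x ≐ Tail x ∘ `0) ∧' (w' ≐ z))
                         ∨' ((x ≐ Tail x ∘ `1) ∧' (w' ≐ w))))
      flipDef : ∀ {n} (x : FTm n) → IPORAx (Flip x ⇔ (Flipcoin x ≐ `1))
      npInd  : ∀ {n} (t : FTm (suc n)) (u v : FTm (suc (suc n))) →
               let F = ∃⪯ t (u ≐ v) in
               IPORAx (((F [ `ε ]₀)
                        ∧' ∀' (F ⊃ subF (σb b0) F)
                        ∧' ∀' (F ⊃ subF (σb b1) F))
                       ⊃ ∀' F)

    -- intuitionistic (minimal, ⊥ := 0=1) natural deduction with equality
    infix 1 _⊢_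
    data _⊢_ : ∀ {n} → List (Fm n) → Fm n → Set where
      ax   : ∀ {n} {Γ : List (Fm n)} {A} → IPORAx A → Γ ⊢ A
      hyp  : ∀ {n} {Γ : List (Fm n)} {A} → A ∈ Γ → Γ ⊢ A
      ∧I   : ∀ {n} {Γ : List (Fm n)} {A B} → Γ ⊢ A → Γ ⊢ B → Γ ⊢ A ∧' B
      ∧E₁  : ∀ {n} {Γ : List (Fm n)} {A B} → Γ ⊢ A ∧' B → Γ ⊢ A
      ∧E₂  : ∀ {n} {Γ : List (Fm n)} {A B} → Γ ⊢ A ∧' B → Γ ⊢ B
      ∨I₁  : ∀ {n} {Γ : List (Fm n)} {A B} → Γ ⊢ A → Γ ⊢ A ∨' B
      ∨I₂  : ∀ {n} {Γ : List (Fm n)} {A B} → Γ ⊢ B → Γ ⊢ A ∨' B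
      ∨E   : ∀ {n} {Γ : List (Fm n)} {A B C} →
             Γ ⊢ A ∨' B → A ∷ Γ ⊢ C → B ∷ Γ ⊢ C → Γ ⊢ C
      ⊃I   : ∀ {n} {Γ : List (Fm n)} {A B} → A ∷ Γ ⊢ B → Γ ⊢ A ⊃ B
      ⊃E   : ∀ {n} {Γ : List (Fm n)} {A B} → Γ ⊢ A ⊃ B → Γ ⊢ A → Γ ⊢ B
      ∀I   : ∀ {n} {Γ : List (Fm n)} {A} → map wkF Γ ⊢ A → Γ ⊢ ∀' A
      ∀E   : ∀ {n} {Γ : List (Fm n)} {A} → Γ ⊢ ∀' A → (t : FTm n) → Γ ⊢ A [ t ]₀
      ∃I   : ∀ {n} {Γ : List (Fm n)} {A} (t : FTm n) → Γ ⊢ A [ t ]₀ → Γ ⊢ ∃' A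
      ∃E   : ∀ {n} {Γ : List (Fm n)} {A C} →
             Γ ⊢ ∃' A → A ∷ map wkF Γ ⊢ wkF C → Γ ⊢ C
      refl= : ∀ {n} {Γ : List (Fm n)} (t : FTm n) → Γ ⊢ t ≐ t
      subst= : ∀ {n} {Γ : List (Fm n)} (A : Fm (suc n)) {t u : FTm n} →
               Γ ⊢ t ≐ u → Γ ⊢ A [ t ]₀ → Γ ⊢ A [ u ]₀

module Translation (D : POR.Defined) where
  open POR using (ιs; FTm; _∋_; here; there; var; `0; `1; `ε; _∘_)
  open POR.WithDefs D using (Times)

  finVar : ∀ {n} → Fin n → ιs n ∋ POR.ι
  finVar zero    = here
  finVar (suc i) = there (finVar i)

  trT : ∀ {n} → RL.Tm n → FTm n
  trT (RL.var i)   = var (finVar i)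
  trT RL.ε         = `ε
  trT RL.𝟘         = `0
  trT RL.𝟙         = `1
  trT (t RL.⌢ u)   = trT t ∘ trT u
  trT (t RL.⊗ u)   = Times (trT t) (trT u)

  trF : ∀ {n} → RL.Fm n → POR.Fm n
  trF (RL.Flip t)  = POR.Flip (trT t)
  trF (t RL.≐ u)   = trT t POR.≐ trT u
  trF (t RL.⊑ u)   = trT t POR.⊑ trT u
  trF (RL.¬' A)    = POR.¬' (trF A)
  trF (A RL.∧' B)  = trF A POR.∧' trF B
  trF (A RL.∨' B)  = trF A POR.∨' trF B
  trF (A RL.⇒ B)   = trF A POR.⊃ trF B
  trF (RL.∃' A)    = POR.∃' (trF A)
  trF (RL.∀' A)    = POR.∀' (trF A)

{-# OPTIONS --safe #-}
module Submission where

-- Apart from induction, the axioms of IRS reduce to the correctness of Eq and Sub, and the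
-- induction axiom to the fact that every Σb1-formula is equivalent in IPOR to a formula
-- (∃z ⪯ t) u = 1, to which NP-induction applies.
--
-- Eq and Sub descend in two arguments at once, whereas NP-induction runs along one string.
-- The two are reconciled by Drop x w, which removes |w| bits from x; its recursion is
-- truncated, but the invariant 1^x = 1^s 1^(Drop x w) keeps the truncation idle.
--
-- Bounded search over initial subwords gives each Σb0-formula a characteristic term.
-- Quantifiers (∃x ⪯ t)(∃z ⪯ s) are contracted into one over y = x z, the splitting point of y
-- being found by search; the bound t s(t) is justified because RL-terms are monotone in length.

open import Defs
open import Data.Nat using (ℕ; zero; suc)
open import Data.Fin using (Fin; zero; suc)
open import Data.List using (List; []; _∷_)
import Data.List as List
open import Data.List.Membership.Propositional.Properties using (∈-map⁺)
open import Data.List.Relation.Unary.Any using (here; there)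
open import Data.List.Relation.Binary.Subset.Propositional using (_⊆_)
open import Data.List.Relation.Binary.Subset.Propositional.Properties
  using (∷⁺ʳ; xs⊆x∷xs) renaming (map⁺ to ⊆-map⁺)
open import Data.Product using (Σ-syntax; _,_)
open import Data.Vec using (Vec; []; _∷_; lookup; map)
open import Data.Vec.Properties using (lookup-map)
open import Relation.Binary.PropositionalEquality
  using (_≡_; refl; sym; trans; cong; cong₂; subst)

open POR
  using (ι; Ctx; _∋_; here; there; var; lam; _·_; `0; `1; `ε; `∘; `Tail; `Trunc;
         `Cond; `Flipcoin; `Rec; Ren; Sub; ren; sub; extR; extS; σ₀; wk₀; _∘_; bit;
         Tail; Trunc; Cond; Flipcoin; Rec; Bt; BOr; Eps; ιs; FTm; Fm; _≐_; _⊑_; Flip;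
         _∧'_; _∨'_; _⊃_; ∀'; ∃'; _⇔_; subF; wkF; _[_]₀; σb)

-- Substitution in λ-terms

-- The matrix of NP-induction is one equation, whereas the facts to be proved are implications,
-- disjunctions and existential claims. Decidable conditions are therefore carried by strings with
-- value `0` or `1`: that a string is such a bit is itself an equation, it gives case distinction
-- without excluded middle, and it lets a hypothesis of an induction be coded as a branch of `Cond`.
-- For the same reason negation, implication and the universal subword quantifier can be absorbed
-- into characteristic terms intuitionistically. `Eq` and `Sub` are known only through their
-- recursion equations, so that `Eq x y = 1` expresses equality has to be proved by induction. `Rec`
-- truncates every value, hence each new function needs either a length invariant or values of a
-- single bit. A subword quantifier speaks of two words, w and w x. The prefix w x of t is found by
-- one search and the cut inside it by a second one, over unary lengths; the same cut takes merged
-- witnesses of Σb1-formulas apart.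

wkT : ∀ {Δ A B} → POR.Tm Δ A → POR.Tm (B ∷ Δ) A
wkT = ren there

-- Substitutions are functions, so they are compared pointwise; the hypothesis replaces
-- extensionality and is re-established under each binder.
ren≡sub : ∀ {Δ Δ'} (ρ : Ren Δ Δ') (σ : Sub Δ Δ') → (∀ {A} (x : Δ ∋ A) → var (ρ x) ≡ σ x) →
          ∀ {A} (t : POR.Tm Δ A) → ren ρ t ≡ sub σ t
ren≡sub ρ σ h (var x)   = h x
ren≡sub ρ σ h (lam t)   =
  cong lam (ren≡sub (extR ρ) (extS σ) (λ { here → refl ; (there x) → cong wkT (h x) }) t)
ren≡sub ρ σ h (t · u)   = cong₂ _·_ (ren≡sub ρ σ h t) (ren≡sub ρ σ h u)
ren≡sub ρ σ h `0        = refl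
ren≡sub ρ σ h `1        = refl
ren≡sub ρ σ h `ε        = refl
ren≡sub ρ σ h `∘        = refl
ren≡sub ρ σ h `Tail     = refl
ren≡sub ρ σ h `Trunc    = refl
ren≡sub ρ σ h `Cond     = refl
ren≡sub ρ σ h `Flipcoin = refl
ren≡sub ρ σ h `Rec      = refl

sub-ren : ∀ {Δ₁ Δ₂ Δ₃} (σ : Sub Δ₂ Δ₃) (ρ : Ren Δ₁ Δ₂) (τ : Sub Δ₁ Δ₃) →
          (∀ {A} (x : Δ₁ ∋ A) → σ (ρ x) ≡ τ x) →
          ∀ {A} (t : POR.Tm Δ₁ A) → sub σ (ren ρ t) ≡ sub τ t
sub-ren σ ρ τ h (var x)   = h x
sub-ren σ ρ τ h (lam t)   = cong lam
  (sub-ren (extS σ) (extR ρ) (extS τ) (λ { here → refl ; (there x) → cong wkT (h x) }) t)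
sub-ren σ ρ τ h (t · u)   = cong₂ _·_ (sub-ren σ ρ τ h t) (sub-ren σ ρ τ h u)
sub-ren σ ρ τ h `0        = refl
sub-ren σ ρ τ h `1        = refl
sub-ren σ ρ τ h `ε        = refl
sub-ren σ ρ τ h `∘        = refl
sub-ren σ ρ τ h `Tail     = refl
sub-ren σ ρ τ h `Trunc    = refl
sub-ren σ ρ τ h `Cond     = refl
sub-ren σ ρ τ h `Flipcoin = refl
sub-ren σ ρ τ h `Rec      = refl

ren-ren : ∀ {Δ₁ Δ₂ Δ₃} (ρ : Ren Δ₂ Δ₃) (ρ' : Ren Δ₁ Δ₂) {A} (t : POR.Tm Δ₁ A) →
          ren ρ (ren ρ' t) ≡ ren (λ x → ρ (ρ' x)) t
ren-ren ρ ρ' t = trans (ren≡sub ρ (λ x → var (ρ x)) (λ _ → refl) (ren ρ' t))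
                (trans (sub-ren (λ x → var (ρ x)) ρ' (λ x → var (ρ (ρ' x))) (λ _ → refl) t)
                (sym (ren≡sub (λ x → ρ (ρ' x)) (λ x → var (ρ (ρ' x))) (λ _ → refl) t)))

ren-sub : ∀ {Δ₁ Δ₂ Δ₃} (ρ : Ren Δ₂ Δ₃) (σ : Sub Δ₁ Δ₂) (τ : Sub Δ₁ Δ₃) →
          (∀ {A} (x : Δ₁ ∋ A) → ren ρ (σ x) ≡ τ x) →
          ∀ {A} (t : POR.Tm Δ₁ A) → ren ρ (sub σ t) ≡ sub τ t
ren-sub ρ σ τ h (var x)   = h x
ren-sub ρ σ τ h (lam t)   = cong lam (ren-sub (extR ρ) (extS σ) (extS τ)
  (λ { here → refl
     ; (there x) → trans (ren-ren (extR ρ) there (σ x))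
                  (trans (sym (ren-ren there ρ (σ x))) (cong wkT (h x))) }) t)
ren-sub ρ σ τ h (t · u)   = cong₂ _·_ (ren-sub ρ σ τ h t) (ren-sub ρ σ τ h u)
ren-sub ρ σ τ h `0        = refl
ren-sub ρ σ τ h `1        = refl
ren-sub ρ σ τ h `ε        = refl
ren-sub ρ σ τ h `∘        = refl
ren-sub ρ σ τ h `Tail     = refl
ren-sub ρ σ τ h `Trunc    = refl
ren-sub ρ σ τ h `Cond     = refl
ren-sub ρ σ τ h `Flipcoin = refl
ren-sub ρ σ τ h `Rec      = refl

sub-id : ∀ {Δ} (σ : Sub Δ Δ) → (∀ {A} (x : Δ ∋ A) → σ x ≡ var x) →
         ∀ {A} (t : POR.Tm Δ A) → sub σ t ≡ t
sub-id σ h (var x)   = h x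
sub-id σ h (lam t)   = cong lam
  (sub-id (extS σ) (λ { here → refl ; (there x) → cong wkT (h x) }) t)
sub-id σ h (t · u)   = cong₂ _·_ (sub-id σ h t) (sub-id σ h u)
sub-id σ h `0        = refl
sub-id σ h `1        = refl
sub-id σ h `ε        = refl
sub-id σ h `∘        = refl
sub-id σ h `Tail     = refl
sub-id σ h `Trunc    = refl
sub-id σ h `Cond     = refl
sub-id σ h `Flipcoin = refl
sub-id σ h `Rec      = refl

sub-ext-wk : ∀ {Δ Δ'} (σ : Sub Δ Δ') {A B} (t : POR.Tm Δ A) →
             sub (extS {B = B} σ) (wkT t) ≡ wkT (sub σ t)
sub-ext-wk σ t = trans (sub-ren (extS σ) there (λ x → wkT (σ x)) (λ _ → refl) t)
                       (sym (ren-sub there σ (λ x → wkT (σ x)) (λ _ → refl) t))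

sub-σ₀-wk : ∀ {Δ B} (u : POR.Tm Δ B) {A} (t : POR.Tm Δ A) → sub (σ₀ u) (wkT t) ≡ t
sub-σ₀-wk u t = trans (sub-ren (σ₀ u) there var (λ _ → refl) t) (sub-id var (λ _ → refl) t)

sub-wk₀ : ∀ {Δ Δ'} (σ : Sub Δ Δ') {A} (c : POR.Tm [] A) → sub σ (wk₀ c) ≡ wk₀ c
sub-wk₀ σ c = trans (sub-ren σ (λ ()) (λ ()) (λ ()) c) (sym (ren≡sub (λ ()) (λ ()) (λ ()) c))

sub-bit : ∀ {Δ Δ'} (σ : Sub Δ Δ') (b : Bit) → sub σ (bit b) ≡ bit b
sub-bit σ b0 = refl
sub-bit σ b1 = refl

-- Environments of string terms

Env : Ctx → ℕ → Set
Env Δ k = Vec (POR.Tm Δ ι) k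

ext : ∀ {Δ k} → Env Δ k → Env (ι ∷ Δ) (suc k)
ext ρ = var here ∷ map wkT ρ

sub-map-wk : ∀ {Δ Δ' k} (σ : Sub Δ Δ') (ρ : Env Δ k) →
             map (sub (extS {B = ι} σ)) (map wkT ρ) ≡ map wkT (map (sub σ) ρ)
sub-map-wk σ []      = refl
sub-map-wk σ (t ∷ ρ) = cong₂ _∷_ (sub-ext-wk σ t) (sub-map-wk σ ρ)

σ₀-map-wk : ∀ {Δ k} (u : POR.Tm Δ ι) (ρ : Env Δ k) → map (sub (σ₀ u)) (map wkT ρ) ≡ ρ
σ₀-map-wk u []      = refl
σ₀-map-wk u (t ∷ ρ) = cong₂ _∷_ (sub-σ₀-wk u t) (σ₀-map-wk u ρ)

map-wk≡sub : ∀ {Δ k} (ρ : Env Δ k) →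
             map (sub (λ x → var (there {B = ι} x))) ρ ≡ map wkT ρ
map-wk≡sub []      = refl
map-wk≡sub (t ∷ ρ) =
  cong₂ _∷_ (sym (ren≡sub there (λ x → var (there x)) (λ _ → refl) t)) (map-wk≡sub ρ)

σb-map-wk : ∀ {n k} (b : Bit) (ρ : Env (ιs n) k) → map (sub (σb b)) (map wkT ρ) ≡ map wkT ρ
σb-map-wk b []      = refl
σb-map-wk b (t ∷ ρ) = cong₂ _∷_
  (trans (sub-ren (σb b) there (λ x → var (there x)) (λ _ → refl) t)
         (sym (ren≡sub there (λ x → var (there x)) (λ _ → refl) t)))
  (σb-map-wk b ρ)

module _ (𝔇 : POR.Defined) where
  open POR.Defined 𝔇
  open POR.WithDefs 𝔇 hiding (_⊢_≈_)
  open POR.WithDefs 𝔇 using () renaming (_⊢_≈_ to _⊩_≈_)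
  open POR.Theory 𝔇

  -- String functions and codes for the terms in induction formulas

  one : ∀ {Δ} → POR.Tm Δ ι → POR.Tm Δ ι
  one = Times `1

  -- Meant for bits; the `ε`-branches are fillers. Unlike `BAnd` and `BOr` they do not normalise
  -- their arguments by `Bt`; on bits `or` agrees with `BOr`, by `BOr≐or`.
  and or : ∀ {Δ} → POR.Tm Δ ι → POR.Tm Δ ι → POR.Tm Δ ι
  and c d = Cond c `0 `0 d
  or c d = Cond c d d `1

  -- x with its last |w| bits removed.
  Drop : ∀ {Δ} → POR.Tm Δ ι → POR.Tm Δ ι → POR.Tm Δ ι
  Drop x w = Rec x h h (lam (one (wkT x))) w
    where h = lam (lam (Tail (var here)))

  -- A string of length min(|x|,|w|), the number of bits that Drop x w removes.
  Surp : ∀ {Δ} → POR.Tm Δ ι → POR.Tm Δ ι → POR.Tm Δ ι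
  Surp x w = Rec `ε h h (lam (one (wkT x))) w
    where h = lam (lam (Cond (Drop (wkT (wkT x)) (var (there here)))
                             (var here) (var here ∘ `1) (var here ∘ `1)))

  -- Evaluation commutes with POR.sub (⟦⟧-sub), so these terms serve as induction formulas
  -- with arbitrary parameters, at which the induction lemmas are used without any weakening
  -- of derivations.  A tail ↑ s of an explicit substitution skips the first variable.
  -- srch f t asks whether some prefix p of t satisfies f p = 1.
  mutual
    data E : ℕ → Set where
      var    : ∀ {k} → Fin k → E k
      ε̂ 0̂ 1̂  : ∀ {k} → E k
      _∘̂_    : ∀ {k} → E k → E k → E k
      tail   : ∀ {k} → E k → E k
      trunc  : ∀ {k} → E k → E k → E k
      cond   : ∀ {k} → E k → E k → E k → E k → E k
      flipc  : ∀ {k} → E k → E k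
      fn     : ∀ {k} → POR.Tm [] (ι POR.⇒ ι POR.⇒ ι) → E k → E k → E k
      drop   : ∀ {k} → E k → E k → E k
      surp   : ∀ {k} → E k → E k → E k
      srch   : ∀ {k} → E (suc k) → E k → E k
      _⟪_⟫   : ∀ {k j} → E j → Sb k j → E k

    data Sb : ℕ → ℕ → Set where
      idˢ : ∀ {k} → Sb k k
      ↑_  : ∀ {k j} → Sb k j → Sb (suc k) j
      _∷_ : ∀ {k j} → E k → Sb k j → Sb k (suc j)

  infixl 8 _∘̂_
  infixl 9 _⟪_⟫
  infixr 6 ↑_

  mutual
    ⟦_⟧ : ∀ {Δ k} → E k → Env Δ k → POR.Tm Δ ι
    ⟦ var i ⟧ ρ        = lookup ρ i
    ⟦ ε̂ ⟧ ρ            = `ε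
    ⟦ 0̂ ⟧ ρ            = `0
    ⟦ 1̂ ⟧ ρ            = `1
    ⟦ a ∘̂ b ⟧ ρ        = ⟦ a ⟧ ρ ∘ ⟦ b ⟧ ρ
    ⟦ tail a ⟧ ρ       = Tail (⟦ a ⟧ ρ)
    ⟦ trunc a b ⟧ ρ    = Trunc (⟦ a ⟧ ρ) (⟦ b ⟧ ρ)
    ⟦ cond a b c d ⟧ ρ = Cond (⟦ a ⟧ ρ) (⟦ b ⟧ ρ) (⟦ c ⟧ ρ) (⟦ d ⟧ ρ)
    ⟦ flipc a ⟧ ρ      = Flipcoin (⟦ a ⟧ ρ)
    ⟦ fn f a b ⟧ ρ     = wk₀ f · ⟦ a ⟧ ρ · ⟦ b ⟧ ρ
    ⟦ drop a b ⟧ ρ     = Drop (⟦ a ⟧ ρ) (⟦ b ⟧ ρ)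
    ⟦ surp a b ⟧ ρ     = Surp (⟦ a ⟧ ρ) (⟦ b ⟧ ρ)
    ⟦ srch f t ⟧ ρ     = Srch f ρ (⟦ t ⟧ ρ)
    ⟦ e ⟪ s ⟫ ⟧ ρ      = ⟦ e ⟧ (⟦ s ⟧ˢ ρ)

    ⟦_⟧ˢ : ∀ {Δ k j} → Sb k j → Env Δ k → Env Δ j
    ⟦ idˢ ⟧ˢ ρ         = ρ
    ⟦ ↑ s ⟧ˢ (_ ∷ ρ)   = ⟦ s ⟧ˢ ρ
    ⟦ e ∷ s ⟧ˢ ρ       = ⟦ e ⟧ ρ ∷ ⟦ s ⟧ˢ ρ

    -- The initial value tests `ε` and each step tests `y ∘ bit b`, so that both `ε` and `t` itself
    -- are among the candidates. The bound `lam 1` truncates to one bit, which is harmless for bits.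
    Srch : ∀ {Δ k} → E (suc k) → Env Δ k → POR.Tm Δ ι → POR.Tm Δ ι
    Srch f ρ t = Rec (⟦ f ⟧ (`ε ∷ ρ)) (srchStep f ρ b0) (srchStep f ρ b1) (lam `1) t

    srchStep : ∀ {Δ k} → E (suc k) → Env Δ k → Bit → POR.Tm Δ (ι POR.⇒ ι POR.⇒ ι)
    srchStep f ρ b =
      lam (lam (or (var here) (⟦ f ⟧ (var (there here) ∘ bit b ∷ map wkT (map wkT ρ)))))

  v0 : ∀ {k} → E (suc k)
  v0 = var zero

  v1 : ∀ {k} → E (suc (suc k))
  v1 = var (suc zero)

  v2 : ∀ {k} → E (suc (suc (suc k)))
  v2 = var (suc (suc zero))

  v3 : ∀ {k} → E (suc (suc (suc (suc k))))
  v3 = var (suc (suc (suc zero)))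

  Drop-sub : ∀ {Δ Δ'} (σ : Sub Δ Δ') x w → sub σ (Drop x w) ≡ Drop (sub σ x) (sub σ w)
  Drop-sub σ x w = cong (λ k → Rec (sub σ x) (lam (lam (Tail (var here)))) (lam (lam (Tail (var here))))
                                    (lam k) (sub σ w))
    (cong₂ (λ c y → c · `1 · y) (sub-wk₀ (extS σ) times) (sub-ext-wk σ x))

  Surp-sub : ∀ {Δ Δ'} (σ : Sub Δ Δ') x w → sub σ (Surp x w) ≡ Surp (sub σ x) (sub σ w)
  Surp-sub σ x w = cong₂ (λ h k → Rec `ε (lam (lam h)) (lam (lam h)) (lam k) (sub σ w))
    (cong (λ d → Cond d (var here) (var here ∘ `1) (var here ∘ `1))
      (trans (Drop-sub (extS (extS σ)) (wkT (wkT x)) (var (there here)))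
             (cong (λ y → Drop y (var (there here)))
               (trans (sub-ext-wk (extS σ) (wkT x)) (cong wkT (sub-ext-wk σ x))))))
    (cong₂ (λ c y → c · `1 · y) (sub-wk₀ (extS σ) times) (sub-ext-wk σ x))

  mutual
    ⟦⟧-sub : ∀ {Δ Δ' k} (σ : Sub Δ Δ') (e : E k) (ρ : Env Δ k) →
             sub σ (⟦ e ⟧ ρ) ≡ ⟦ e ⟧ (map (sub σ) ρ)
    ⟦⟧-sub σ (var i) ρ     = sym (lookup-map i (sub σ) ρ)
    ⟦⟧-sub σ ε̂ ρ           = refl
    ⟦⟧-sub σ 0̂ ρ           = refl
    ⟦⟧-sub σ 1̂ ρ           = refl
    ⟦⟧-sub σ (a ∘̂ b) ρ     = cong₂ _∘_ (⟦⟧-sub σ a ρ) (⟦⟧-sub σ b ρ)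
    ⟦⟧-sub σ (tail a) ρ    = cong Tail (⟦⟧-sub σ a ρ)
    ⟦⟧-sub σ (trunc a b) ρ = cong₂ Trunc (⟦⟧-sub σ a ρ) (⟦⟧-sub σ b ρ)
    ⟦⟧-sub σ (cond a b c d) ρ =
      cong₂ _·_ (cong₂ _·_ (cong₂ (λ x y → `Cond · x · y) (⟦⟧-sub σ a ρ) (⟦⟧-sub σ b ρ))
                           (⟦⟧-sub σ c ρ)) (⟦⟧-sub σ d ρ)
    ⟦⟧-sub σ (flipc a) ρ   = cong Flipcoin (⟦⟧-sub σ a ρ)
    ⟦⟧-sub σ (fn f a b) ρ  =
      cong₂ _·_ (cong₂ _·_ (sub-wk₀ σ f) (⟦⟧-sub σ a ρ)) (⟦⟧-sub σ b ρ)
    ⟦⟧-sub σ (drop a b) ρ  =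
      trans (Drop-sub σ (⟦ a ⟧ ρ) (⟦ b ⟧ ρ)) (cong₂ Drop (⟦⟧-sub σ a ρ) (⟦⟧-sub σ b ρ))
    ⟦⟧-sub σ (surp a b) ρ  =
      trans (Surp-sub σ (⟦ a ⟧ ρ) (⟦ b ⟧ ρ)) (cong₂ Surp (⟦⟧-sub σ a ρ) (⟦⟧-sub σ b ρ))
    ⟦⟧-sub σ (srch f t) ρ  =
      cong₂ _·_ (cong (λ r → r · lam `1)
        (cong₂ _·_ (cong₂ (λ x → `Rec · x ·_) (⟦⟧-sub σ f (`ε ∷ ρ)) (srchStep-sub σ f ρ b0))
                   (srchStep-sub σ f ρ b1)))
        (⟦⟧-sub σ t ρ)
    ⟦⟧-sub σ (e ⟪ s ⟫) ρ   = trans (⟦⟧-sub σ e (⟦ s ⟧ˢ ρ)) (cong ⟦ e ⟧ (⟦⟧ˢ-sub σ s ρ))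

    ⟦⟧ˢ-sub : ∀ {Δ Δ' k j} (σ : Sub Δ Δ') (s : Sb k j) (ρ : Env Δ k) →
              map (sub σ) (⟦ s ⟧ˢ ρ) ≡ ⟦ s ⟧ˢ (map (sub σ) ρ)
    ⟦⟧ˢ-sub σ idˢ ρ         = refl
    ⟦⟧ˢ-sub σ (↑ s) (_ ∷ ρ) = ⟦⟧ˢ-sub σ s ρ
    ⟦⟧ˢ-sub σ (e ∷ s) ρ     = cong₂ _∷_ (⟦⟧-sub σ e ρ) (⟦⟧ˢ-sub σ s ρ)

    srchStep-sub : ∀ {Δ Δ' k} (σ : Sub Δ Δ') (f : E (suc k)) (ρ : Env Δ k) b →
                   sub σ (srchStep f ρ b) ≡ srchStep f (map (sub σ) ρ) b
    srchStep-sub σ f ρ b = cong (λ a → lam (lam (or (var here) a)))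
      (trans (⟦⟧-sub (extS (extS σ)) f (var (there here) ∘ bit b ∷ map wkT (map wkT ρ)))
        (cong₂ (λ x ρ' → ⟦ f ⟧ (var (there here) ∘ x ∷ ρ')) (sub-bit (extS (extS σ)) b)
          (trans (sub-map-wk (extS σ) (map wkT ρ)) (cong (map wkT) (sub-map-wk σ ρ)))))

  ⟦⟧-wkF : ∀ {Δ k} (e : E k) (ρ : Env Δ k) →
           ⟦ e ⟧ (map wkT ρ) ≡ sub (λ x → var (there {B = ι} x)) (⟦ e ⟧ ρ)
  ⟦⟧-wkF e ρ = sym (trans (⟦⟧-sub (λ x → var (there x)) e ρ) (cong ⟦ e ⟧ (map-wk≡sub ρ)))

  ⟦⟧-wk : ∀ {Δ k} (e : E k) (ρ : Env Δ k) → wkT {B = ι} (⟦ e ⟧ ρ) ≡ ⟦ e ⟧ (map wkT ρ)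
  ⟦⟧-wk e ρ = trans (ren≡sub there (λ x → var (there x)) (λ _ → refl) (⟦ e ⟧ ρ))
                  (sym (⟦⟧-wkF e ρ))

  ⟦⟧-inst : ∀ {Δ k} (e : E (suc k)) (u : POR.Tm Δ ι) (ρ : Env Δ k) →
            sub (σ₀ u) (⟦ e ⟧ (ext ρ)) ≡ ⟦ e ⟧ (u ∷ ρ)
  ⟦⟧-inst e u ρ = trans (⟦⟧-sub (σ₀ u) e (ext ρ)) (cong (λ ρ' → ⟦ e ⟧ (u ∷ ρ')) (σ₀-map-wk u ρ))

  private variable
    k : ℕ

  -- Weakening and equational reasoning

  weaken : ∀ {n} {Γ Δ : List (Fm n)} {A : Fm n} → Γ ⊆ Δ → Γ ⊢ A → Δ ⊢ A
  weaken s (ax a)         = ax a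
  weaken s (hyp h)        = hyp (s h)
  weaken s (∧I p q)       = ∧I (weaken s p) (weaken s q)
  weaken s (∧E₁ p)        = ∧E₁ (weaken s p)
  weaken s (∧E₂ p)        = ∧E₂ (weaken s p)
  weaken s (∨I₁ p)        = ∨I₁ (weaken s p)
  weaken s (∨I₂ p)        = ∨I₂ (weaken s p)
  weaken s (∨E p q r)     = ∨E (weaken s p) (weaken (∷⁺ʳ _ s) q) (weaken (∷⁺ʳ _ s) r)
  weaken s (⊃I p)         = ⊃I (weaken (∷⁺ʳ _ s) p)
  weaken s (⊃E p q)       = ⊃E (weaken s p) (weaken s q)
  weaken s (∀I p)         = ∀I (weaken (⊆-map⁺ wkF s) p)
  weaken s (∀E p t)       = ∀E (weaken s p) t
  weaken s (∃I t p)       = ∃I t (weaken s p)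
  weaken s (∃E p q)       = ∃E (weaken s p) (weaken (∷⁺ʳ _ (⊆-map⁺ wkF s)) q)
  weaken s (refl= t)      = refl= t
  weaken s (subst= A p q) = subst= A (weaken s p) (weaken s q)

  module _ {n : ℕ} where
    private variable
      Γ : List (Fm n)
      A B C : Fm n
      t t' u u' v x y z : FTm n

    wk : Γ ⊢ A → B ∷ Γ ⊢ A
    wk = weaken (xs⊆x∷xs _ _)

    h₀ : A ∷ Γ ⊢ A
    h₀ = hyp (here refl)

    -- Also the device for using a derived formula under a new variable: `∀I` and `∃E` carry
    -- hypotheses across by `wkF`, so the formula is first made a hypothesis.
    cut : Γ ⊢ A → A ∷ Γ ⊢ B → Γ ⊢ B
    cut p q = ⊃E (⊃I q) p

    axm : Axiom t u → Γ ⊢ t ≐ u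
    axm a = ax (por (axiom a))

    symᵒ : Γ ⊢ t ≐ u → Γ ⊢ u ≐ t
    symᵒ {t = t} {u = u} p = subst (λ x → _ ⊢ u ≐ x) (sub-σ₀-wk u t)
      (subst= (var here ≐ wkT t) p (subst (λ x → _ ⊢ t ≐ x) (sym (sub-σ₀-wk t t)) (refl= t)))

    transᵒ : Γ ⊢ t ≐ u → Γ ⊢ u ≐ v → Γ ⊢ t ≐ v
    transᵒ {t = t} {u = u} {v = v} p q = subst (λ x → _ ⊢ x ≐ v) (sub-σ₀-wk v t)
      (subst= (wkT t ≐ var here) q (subst (λ x → _ ⊢ x ≐ u) (sym (sub-σ₀-wk u t)) p))

    infix  3 _∎
    infixr 2 _≐⟨_⟩_

    _≐⟨_⟩_ : (t : FTm n) → Γ ⊢ t ≐ u → Γ ⊢ u ≐ v → Γ ⊢ t ≐ v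
    _ ≐⟨ p ⟩ q = transᵒ p q

    _∎ : (t : FTm n) → Γ ⊢ t ≐ t
    t ∎ = refl= t

    hole : (c : FTm (suc n)) → sub (σ₀ t) c ≡ t' → sub (σ₀ u) c ≡ u' → Γ ⊢ t ≐ u → Γ ⊢ t' ≐ u'
    hole {t = t} {u = u} c refl refl p =
      subst (λ x → _ ⊢ x ≐ sub (σ₀ u) c) (sub-σ₀-wk u _)
        (subst= (wkT (sub (σ₀ t) c) ≐ c) p
          (subst (λ x → _ ⊢ x ≐ sub (σ₀ t) c) (sym (sub-σ₀-wk t _)) (refl= _)))

    cong₀ : (e : E (suc k)) (ρ : Env (ιs n) k) → Γ ⊢ t ≐ u → Γ ⊢ ⟦ e ⟧ (t ∷ ρ) ≐ ⟦ e ⟧ (u ∷ ρ)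
    cong₀ e ρ = hole (⟦ e ⟧ (ext ρ)) (⟦⟧-inst e _ ρ) (⟦⟧-inst e _ ρ)

    cong₁ : (e : E (suc (suc k))) (s : FTm n) (ρ : Env (ιs n) k) →
            Γ ⊢ t ≐ u → Γ ⊢ ⟦ e ⟧ (s ∷ t ∷ ρ) ≐ ⟦ e ⟧ (s ∷ u ∷ ρ)
    -- Exchanging the two head variables brings the one to be rewritten to the front; the exchange
    -- disappears on evaluation.
    cong₁ e s ρ = cong₀ (e ⟪ v1 ∷ v0 ∷ ↑ ↑ idˢ ⟫) (s ∷ ρ)

    congs : (e : E (suc (suc k))) (ρ : Env (ιs n) k) → Γ ⊢ t ≐ u → Γ ⊢ t' ≐ u' →
            Γ ⊢ ⟦ e ⟧ (t ∷ t' ∷ ρ) ≐ ⟦ e ⟧ (u ∷ u' ∷ ρ)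
    congs e ρ p q = transᵒ (cong₀ e _ p) (cong₁ e _ ρ q)

    ∘-cong : Γ ⊢ t ≐ u → Γ ⊢ t' ≐ u' → Γ ⊢ t ∘ t' ≐ u ∘ u'
    ∘-cong = congs (v0 ∘̂ v1) []

    ∘-congˡ : Γ ⊢ t ≐ u → Γ ⊢ t ∘ v ≐ u ∘ v
    ∘-congˡ p = ∘-cong p (refl= _)

    ∘-congʳ : Γ ⊢ t ≐ u → Γ ⊢ v ∘ t ≐ v ∘ u
    ∘-congʳ p = ∘-cong (refl= _) p

    Trunc-cong : Γ ⊢ t ≐ u → Γ ⊢ t' ≐ u' → Γ ⊢ Trunc t t' ≐ Trunc u u'
    Trunc-cong = congs (trunc v0 v1) []

    Drop-cong : Γ ⊢ t ≐ u → Γ ⊢ t' ≐ u' → Γ ⊢ Drop t t' ≐ Drop u u'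
    Drop-cong = congs (drop v0 v1) []

    Tail-cong : Γ ⊢ t ≐ u → Γ ⊢ Tail t ≐ Tail u
    Tail-cong = cong₀ (tail v0) []

    fn-cong : (f : POR.Tm [] (ι POR.⇒ ι POR.⇒ ι)) → Γ ⊢ t ≐ u → Γ ⊢ t' ≐ u' →
              Γ ⊢ wk₀ f · t · t' ≐ wk₀ f · u · u'
    fn-cong f = congs (fn f v0 v1) []

    one-cong : Γ ⊢ t ≐ u → Γ ⊢ one t ≐ one u
    one-cong = fn-cong times (refl= _)

    Cond-cong : Γ ⊢ t ≐ u → Γ ⊢ Cond t x y z ≐ Cond u x y z
    Cond-cong {x = x} {y = y} {z = z} = cong₀ (cond v0 v1 v2 v3) (x ∷ y ∷ z ∷ [])

  -- Falsity, case distinction and Boolean strings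

  -- The calculus is minimal, with `0 ≐ 1` as falsity. The axiom `exfalso` makes every string equal
  -- to `ε`, hence proves all equations; `subDef` and `flipDef` reduce the other atoms to equations.
  explosion : ∀ {n} {Γ : List (Fm n)} (A : Fm n) → Γ ⊢ `0 ≐ `1 → Γ ⊢ A
  explosion (t ≐ u)  p = transᵒ (⊃E (ax (exfalso t)) p) (symᵒ (⊃E (ax (exfalso u)) p))
  explosion (t ⊑ u)  p = ⊃E (∧E₂ (ax (subDef t u))) (explosion (Subw t u ≐ `1) p)
  explosion (Flip t) p = ⊃E (∧E₂ (ax (flipDef t))) (explosion (Flipcoin t ≐ `1) p)
  explosion (A ∧' B) p = ∧I (explosion A p) (explosion B p)
  explosion (A ∨' B) p = ∨I₁ (explosion A p)
  explosion (A ⊃ B)  p = ⊃I (explosion B (wk p))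
  explosion (∀' A)   p = ⊃E (⊃I (∀I (explosion A h₀))) p
  -- The body is proved for a fresh variable and then instantiated at the arbitrary witness `ε`,
  -- which keeps the recursion structural: `A [ ε ]₀` is not a subformula.
  explosion (∃' A)   p = ∃I `ε (∀E (⊃E (⊃I (∀I (explosion A h₀))) p) `ε)

  -- guard c x = guard c y expresses the implication c = 1 → x = y by an equation, to which
  -- NP-induction applies.
  guard : ∀ {Δ} → POR.Tm Δ ι → POR.Tm Δ ι → POR.Tm Δ ι
  guard c x = Cond c `ε `ε x

  module _ {n : ℕ} where
    private variable
      Γ : List (Fm n)
      A B C : Fm n
      t t' u u' v x y z : FTm n

    absurd : Γ ⊢ `0 ≐ `1 → Γ ⊢ A
    absurd p = explosion _ p

    cond-ε : Γ ⊢ t ≐ `ε → Γ ⊢ Cond t x y z ≐ x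
    cond-ε p = transᵒ (Cond-cong p) (axm (condε _ _ _))

    cond-0 : Γ ⊢ t ≐ u ∘ `0 → Γ ⊢ Cond t x y z ≐ y
    cond-0 p = transᵒ (Cond-cong p) (axm (cond0 _ _ _ _))

    cond-1 : Γ ⊢ t ≐ u ∘ `1 → Γ ⊢ Cond t x y z ≐ z
    cond-1 p = transᵒ (Cond-cong p) (axm (cond1 _ _ _ _))

    bit≐ε∘bit : (b : Bit) → Γ ⊢ bit b ≐ `ε ∘ bit b
    bit≐ε∘bit b = symᵒ (axm (εl _))

    if-0 : Γ ⊢ t ≐ `0 → Γ ⊢ Cond t x y z ≐ y
    if-0 p = cond-0 (transᵒ p (bit≐ε∘bit b0))

    if-1 : Γ ⊢ t ≐ `1 → Γ ⊢ Cond t x y z ≐ z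
    if-1 p = cond-1 (transᵒ p (bit≐ε∘bit b1))

    -- `Cond` with value `0` at `ε` and `1` elsewhere would take both values at once.
    ∘bit≢ε : (b : Bit) → Γ ⊢ t ∘ bit b ≐ `ε → Γ ⊢ `0 ≐ `1
    ∘bit≢ε b0 p = transᵒ (symᵒ (cond-ε {y = `1} {z = `1} p)) (cond-0 (refl= _))
    ∘bit≢ε b1 p = transᵒ (symᵒ (cond-ε {y = `1} {z = `1} p)) (cond-1 (refl= _))

    bit≢ε : (b : Bit) → Γ ⊢ bit b ≐ `ε → Γ ⊢ `0 ≐ `1
    bit≢ε b p = ∘bit≢ε b (transᵒ (symᵒ (bit≐ε∘bit b)) p)

    ∘0≢∘1 : Γ ⊢ t ∘ `0 ≐ u ∘ `1 → Γ ⊢ `0 ≐ `1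
    ∘0≢∘1 p = transᵒ (symᵒ (cond-0 {x = `ε} (refl= _))) (cond-1 p)

    ∘bit-inj : (b : Bit) → Γ ⊢ t ∘ bit b ≐ u ∘ bit b → Γ ⊢ t ≐ u
    ∘bit-inj b p = transᵒ (symᵒ (axm (tailB _ b))) (transᵒ (Tail-cong p) (axm (tailB _ b)))

    byCases : (t : FTm n) → (t ≐ `ε) ∷ Γ ⊢ C → (∀ b → (t ≐ Tail t ∘ bit b) ∷ Γ ⊢ C) → Γ ⊢ C
    byCases t p q = ∨E (ax (cases t)) p
      (∨E h₀ (weaken (∷⁺ʳ _ (xs⊆x∷xs _ _)) (q b0)) (weaken (∷⁺ʳ _ (xs⊆x∷xs _ _)) (q b1)))

    resp₀ : (e f : E (suc k)) (ρ : Env (ιs n) k) → Γ ⊢ t ≐ u →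
            Γ ⊢ ⟦ e ⟧ (u ∷ ρ) ≐ ⟦ f ⟧ (u ∷ ρ) → Γ ⊢ ⟦ e ⟧ (t ∷ ρ) ≐ ⟦ f ⟧ (t ∷ ρ)
    resp₀ e f ρ p q = transᵒ (cong₀ e ρ p) (transᵒ q (symᵒ (cong₀ f ρ p)))

    resp₁ : (e f : E (suc (suc k))) {s : FTm n} (ρ : Env (ιs n) k) → Γ ⊢ t ≐ u →
            Γ ⊢ ⟦ e ⟧ (s ∷ u ∷ ρ) ≐ ⟦ f ⟧ (s ∷ u ∷ ρ) → Γ ⊢ ⟦ e ⟧ (s ∷ t ∷ ρ) ≐ ⟦ f ⟧ (s ∷ t ∷ ρ)
    resp₁ e f {s} ρ p q = transᵒ (cong₁ e s ρ p) (transᵒ q (symᵒ (cong₁ f s ρ p)))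

    resps : (e f : E (suc (suc k))) (ρ : Env (ιs n) k) → Γ ⊢ t ≐ u → Γ ⊢ t' ≐ u' →
            Γ ⊢ ⟦ e ⟧ (u ∷ u' ∷ ρ) ≐ ⟦ f ⟧ (u ∷ u' ∷ ρ) →
            Γ ⊢ ⟦ e ⟧ (t ∷ t' ∷ ρ) ≐ ⟦ f ⟧ (t ∷ t' ∷ ρ)
    resps e f ρ p q r = resp₀ e f _ p (resp₁ e f ρ q r)

    caseᴱ : (e f : E (suc k)) (ρ : Env (ιs n) k) → Γ ⊢ ⟦ e ⟧ (`ε ∷ ρ) ≐ ⟦ f ⟧ (`ε ∷ ρ) →
            (∀ b y → Γ ⊢ ⟦ e ⟧ (y ∘ bit b ∷ ρ) ≐ ⟦ f ⟧ (y ∘ bit b ∷ ρ)) →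
            ∀ t → Γ ⊢ ⟦ e ⟧ (t ∷ ρ) ≐ ⟦ f ⟧ (t ∷ ρ)
    caseᴱ e f ρ p q t =
      byCases t (resp₀ e f ρ h₀ (wk p)) (λ b → resp₀ e f ρ h₀ (wk (q b (Tail t))))

    -- The disjunction "c is `0` or c is `1`" written as an equation, so that it can be proved by
    -- `ind`. The value `1` at `ε` excludes the empty string, for which the equation would read
    -- `1 = ε`.
    Boolean : List (Fm n) → FTm n → Set
    Boolean Γ c = Γ ⊢ Cond c `1 `0 `1 ≐ c

    boolean-0 : Γ ⊢ t ≐ `0 → Boolean Γ t
    boolean-0 p = transᵒ (if-0 p) (symᵒ p)

    boolean-1 : Γ ⊢ t ≐ `1 → Boolean Γ t
    boolean-1 p = transᵒ (if-1 p) (symᵒ p)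

    decide : Boolean Γ t → (t ≐ `0) ∷ Γ ⊢ C → (t ≐ `1) ∷ Γ ⊢ C → Γ ⊢ C
    decide {t = t} {C} bt p q = byCases t
      (absurd (bit≢ε b1 (transᵒ (symᵒ (cond-ε h₀)) (transᵒ (wk bt) h₀))))
      λ { b0 → cut (transᵒ (symᵒ (wk bt)) (cond-0 h₀)) (weaken (∷⁺ʳ _ (xs⊆x∷xs _ _)) p)
        ; b1 → cut (transᵒ (symᵒ (wk bt)) (cond-1 h₀)) (weaken (∷⁺ʳ _ (xs⊆x∷xs _ _)) q) }

    boolean-if : Boolean Γ t → Boolean Γ x → Boolean Γ y → Boolean Γ (Cond t z x y)
    boolean-if bt bx by = decide bt
      (resp₀ (cond v0 1̂ 0̂ 1̂) v0 [] (if-0 h₀) (wk bx))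
      (resp₀ (cond v0 1̂ 0̂ 1̂) v0 [] (if-1 h₀) (wk by))

    boolean-resp : Γ ⊢ t ≐ u → Boolean Γ u → Boolean Γ t
    boolean-resp = resp₀ (cond v0 1̂ 0̂ 1̂) v0 []

    guard-intro : Boolean Γ t → (t ≐ `1) ∷ Γ ⊢ x ≐ y → Γ ⊢ guard t x ≐ guard t y
    guard-intro bt p = decide bt (transᵒ (if-0 h₀) (symᵒ (if-0 h₀)))
                                 (transᵒ (if-1 h₀) (transᵒ p (symᵒ (if-1 h₀))))

    guard-elim : Γ ⊢ guard t x ≐ guard t y → Γ ⊢ t ≐ `1 → Γ ⊢ x ≐ y
    guard-elim p q = transᵒ (symᵒ (if-1 q)) (transᵒ p (if-1 q))

    and-intro : Γ ⊢ t ≐ `1 → Γ ⊢ u ≐ `1 → Γ ⊢ and t u ≐ `1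
    and-intro p q = transᵒ (if-1 p) q

    and-elim₁ : Boolean Γ t → Γ ⊢ and t u ≐ `1 → Γ ⊢ t ≐ `1
    and-elim₁ bt p = decide bt (absurd (transᵒ (symᵒ (if-0 h₀)) (wk p))) h₀

    and-elim₂ : Boolean Γ t → Γ ⊢ and t u ≐ `1 → Γ ⊢ u ≐ `1
    and-elim₂ bt p = transᵒ (symᵒ (if-1 (and-elim₁ bt p))) p

  -- NP-induction

  conv : ∀ {n} {Γ : List (Fm n)} {A B : Fm n} → A ≡ B → Γ ⊢ A → Γ ⊢ B
  conv refl p = p

  NP : ∀ {n} → E k → E (suc k) → E (suc k) → Env (ιs n) k → Fm n
  NP t u v ρ = ∃⪯ (⟦ t ⟧ ρ) (⟦ u ⟧ (ext ρ) ≐ ⟦ v ⟧ (ext ρ))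

  one-sub : ∀ {Δ Δ'} (σ : Sub Δ Δ') x → sub σ (one x) ≡ one (sub σ x)
  one-sub σ x = cong (λ c → c · `1 · sub σ x) (sub-wk₀ σ times)

  ⟦⟧-sub-ext : ∀ {Δ Δ'} (σ : Sub Δ Δ') (e : E (suc k)) (ρ : Env Δ k) →
               sub (extS σ) (⟦ e ⟧ (ext ρ)) ≡ ⟦ e ⟧ (ext (map (sub σ) ρ))
  ⟦⟧-sub-ext σ e ρ = trans (⟦⟧-sub (extS σ) e (ext ρ))
                           (cong (λ ρ' → ⟦ e ⟧ (var here ∷ ρ')) (sub-map-wk σ ρ))

  NP-sub : ∀ {n m} (σ : Sub (ιs n) (ιs m)) (t : E k) (u v : E (suc k)) (ρ : Env (ιs n) k) →
           subF σ (NP t u v ρ) ≡ NP t u v (map (sub σ) ρ)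
  NP-sub σ t u v ρ = cong₂ (λ a b → ∃' (a ∧' b))
    (cong₂ _⊑_ (one-sub (extS σ) (var here))
      (trans (one-sub (extS σ) (wkT (⟦ t ⟧ ρ)))
             (cong one (trans (sub-ext-wk σ (⟦ t ⟧ ρ)) (cong wkT (⟦⟧-sub σ t ρ))))))
    (cong₂ _≐_ (⟦⟧-sub-ext σ u ρ) (⟦⟧-sub-ext σ v ρ))

  NP-wk : ∀ {n} (t : E k) (u v : E (suc k)) (ρ : Env (ιs n) k) →
          wkF (NP t u v ρ) ≡ NP t u v (map wkT ρ)
  NP-wk t u v ρ = trans (NP-sub (λ x → var (there x)) t u v ρ) (cong (NP t u v) (map-wk≡sub ρ))

  NP-inst : ∀ {n} (t : E (suc k)) (u v : E (suc (suc k))) (x : FTm n) (ρ : Env (ιs n) k) →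
            NP t u v (ext ρ) [ x ]₀ ≡ NP t u v (x ∷ ρ)
  NP-inst t u v x ρ = trans (NP-sub (σ₀ x) t u v (ext ρ))
                            (cong (λ ρ' → NP t u v (x ∷ ρ')) (σ₀-map-wk x ρ))

  NP-intro : ∀ {n} {Γ : List (Fm n)} (t : E k) (u v : E (suc k)) (ρ : Env (ιs n) k) z →
             Γ ⊢ one z ⊑ one (⟦ t ⟧ ρ) → Γ ⊢ ⟦ u ⟧ (z ∷ ρ) ≐ ⟦ v ⟧ (z ∷ ρ) → Γ ⊢ NP t u v ρ
  NP-intro t u v ρ z p q = ∃I z (conv (sym (cong₂ _∧'_
    (cong₂ _⊑_ (one-sub (σ₀ z) (var here))
               (trans (one-sub (σ₀ z) (wkT (⟦ t ⟧ ρ))) (cong one (sub-σ₀-wk z (⟦ t ⟧ ρ)))))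
    (cong₂ _≐_ (⟦⟧-inst u z ρ) (⟦⟧-inst v z ρ)))) (∧I p q))

  NP-elim : ∀ {n} {Γ : List (Fm n)} {C : Fm n} (t : E k) (u v : E (suc k)) (ρ : Env (ιs n) k) →
            Γ ⊢ NP t u v ρ →
            ((one (var here) ⊑ one (⟦ t ⟧ (map wkT ρ))) ∧' (⟦ u ⟧ (ext ρ) ≐ ⟦ v ⟧ (ext ρ)))
              ∷ List.map wkF Γ ⊢ wkF C →
            Γ ⊢ C
  NP-elim {Γ = Γ} {C} t u v ρ p q = ∃E p (subst
    (λ x → ((one (var here) ⊑ one x) ∧' (⟦ u ⟧ (ext ρ) ≐ ⟦ v ⟧ (ext ρ))) ∷ List.map wkF Γ ⊢ wkF C)
    (sym (⟦⟧-wk t ρ)) q)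

  npRule : ∀ {n} {Γ : List (Fm n)} (t : E (suc k)) (u v : E (suc (suc k))) (ρ : Env (ιs n) k) →
           Γ ⊢ NP t u v (`ε ∷ ρ) →
           (∀ b → Γ ⊢ ∀' (NP t u v (ext ρ) ⊃ NP t u v (var here ∘ bit b ∷ map wkT ρ))) →
           Γ ⊢ ∀' (NP t u v (ext ρ))
  npRule {Γ = Γ} t u v ρ p q = ⊃E (ax (npInd (⟦ t ⟧ (ext ρ)) (⟦ u ⟧ (ext (ext ρ))) (⟦ v ⟧ (ext (ext ρ)))))
    (∧I (conv (sym (NP-inst t u v `ε ρ)) p) (∧I (step b0) (step b1)))
    where
    step : ∀ b → Γ ⊢ ∀' (NP t u v (ext ρ) ⊃ subF (σb b) (NP t u v (ext ρ)))
    step b = subst (λ A → Γ ⊢ ∀' (NP t u v (ext ρ) ⊃ A))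
      (sym (trans (NP-sub (σb b) t u v (ext ρ))
                  (cong (λ ρ' → NP t u v (var here ∘ bit b ∷ ρ')) (σb-map-wk b ρ)))) (q b)

  wkT-bit : ∀ {Δ} b → wkT {Δ} {B = ι} (bit b) ≡ bit b
  wkT-bit b0 = refl
  wkT-bit b1 = refl

  -- The premises hold in all contexts and environments, since the step is used at a fresh induction
  -- variable and a fresh witness. A side hypothesis can therefore enter only through the induction
  -- formula, as a guard.
  ind∃ : (t : E (suc k)) (u v : E (suc (suc k))) →
         (∀ {n} {Γ : List (Fm n)} ρ → Γ ⊢ NP t u v (`ε ∷ ρ)) →
         (∀ {n} {Γ : List (Fm n)} b x z ρ → Γ ⊢ one z ⊑ one (⟦ t ⟧ (x ∷ ρ)) →
           Γ ⊢ ⟦ u ⟧ (z ∷ x ∷ ρ) ≐ ⟦ v ⟧ (z ∷ x ∷ ρ) → Γ ⊢ NP t u v (x ∘ bit b ∷ ρ)) →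
         ∀ {n} {Γ : List (Fm n)} x ρ → Γ ⊢ NP t u v (x ∷ ρ)
  ind∃ t u v base step {Γ = Γ} x ρ = conv (NP-inst t u v x ρ)
    (∀E (npRule t u v ρ (base ρ) (λ b → ∀I (⊃I (NP-elim t u v (ext ρ) h₀
      (conv
        (trans (cong (λ b' → NP t u v (wkT (var here) ∘ b' ∷ map wkT (map wkT ρ))) (sym (wkT-bit b)))
               (sym (NP-wk t u v (var here ∘ bit b ∷ map wkT ρ))))
        (step b (wkT (var here)) (var here) (map wkT (map wkT ρ)) (∧E₁ h₀) (∧E₂ h₀))))))) x)

  ⊑⇒Subw : ∀ {n} {Γ : List (Fm n)} {x y : FTm n} → Γ ⊢ x ⊑ y → Γ ⊢ Subw x y ≐ `1
  ⊑⇒Subw {x = x} {y} p = ⊃E (∧E₁ (ax (subDef x y))) p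

  Subw⇒⊑ : ∀ {n} {Γ : List (Fm n)} {x y : FTm n} → Γ ⊢ Subw x y ≐ `1 → Γ ⊢ x ⊑ y
  Subw⇒⊑ {x = x} {y} p = ⊃E (∧E₂ (ax (subDef x y))) p

  one-ε⊑one-ε : ∀ {n} {Γ : List (Fm n)} → Γ ⊢ one `ε ⊑ one `ε
  one-ε⊑one-ε = Subw⇒⊑ (transᵒ (fn-cong subw (axm (timesε `1)) (axm (timesε `1)))
                       (transᵒ (axm (subε `ε)) (cond-ε (refl= _))))

  -- NP-induction with a vacuous quantifier: the bound and the witness are `ε`, and `↑ idˢ` makes
  -- both sides ignore the witness.
  ind : (e f : E (suc k)) →
        (∀ {n} {Γ : List (Fm n)} ρ → Γ ⊢ ⟦ e ⟧ (`ε ∷ ρ) ≐ ⟦ f ⟧ (`ε ∷ ρ)) →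
        (∀ {n} {Γ : List (Fm n)} b x ρ → Γ ⊢ ⟦ e ⟧ (x ∷ ρ) ≐ ⟦ f ⟧ (x ∷ ρ) →
          Γ ⊢ ⟦ e ⟧ (x ∘ bit b ∷ ρ) ≐ ⟦ f ⟧ (x ∘ bit b ∷ ρ)) →
        ∀ {n} {Γ : List (Fm n)} x ρ → Γ ⊢ ⟦ e ⟧ (x ∷ ρ) ≐ ⟦ f ⟧ (x ∷ ρ)
  ind e f base step {Γ = Γ} x ρ = NP-elim {C = ⟦ e ⟧ (x ∷ ρ) ≐ ⟦ f ⟧ (x ∷ ρ)} ε̂ e↑ f↑ (x ∷ ρ)
    (ind∃ ε̂ e↑ f↑
      (λ ρ' → NP-intro ε̂ e↑ f↑ (`ε ∷ ρ') `ε one-ε⊑one-ε (base ρ'))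
      (λ b y z ρ' p q → NP-intro ε̂ e↑ f↑ (y ∘ bit b ∷ ρ') `ε one-ε⊑one-ε (step b y ρ' q))
      x ρ)
    (conv (cong₂ _≐_ (⟦⟧-wkF e (x ∷ ρ)) (⟦⟧-wkF f (x ∷ ρ))) (∧E₂ h₀))
    where
    e↑ = e ⟪ ↑ idˢ ⟫
    f↑ = f ⟪ ↑ idˢ ⟫

  private variable
    n : ℕ
    Γ : List (Fm n)

  -- Unary lengths

  -- The equations of `Times` produce `Conc`, while concatenation in RL is translated by `∘`.
  conc≐∘ : (x y : FTm n) → Γ ⊢ Conc x y ≐ x ∘ y
  conc≐∘ x y = ind (fn conc v1 v0) (v1 ∘̂ v0)
    (λ { (x ∷ []) → transᵒ (axm (concε x)) (symᵒ (axm (εr x))) })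
    (λ { b y (x ∷ []) p →
       Conc x (y ∘ bit b)   ≐⟨ axm (concB x y b) ⟩
       Conc x y ∘ bit b     ≐⟨ ∘-congˡ p ⟩
       (x ∘ y) ∘ bit b      ≐⟨ symᵒ (axm (assoc x y b)) ⟩
       x ∘ (y ∘ bit b)      ∎ })
    y (x ∷ [])

  ∘-assoc : (x y z : FTm n) → Γ ⊢ x ∘ (y ∘ z) ≐ (x ∘ y) ∘ z
  ∘-assoc x y z = ind (v1 ∘̂ (v2 ∘̂ v0)) ((v1 ∘̂ v2) ∘̂ v0)
    (λ { (x ∷ y ∷ []) → transᵒ (∘-congʳ (axm (εr y))) (symᵒ (axm (εr (x ∘ y)))) })
    (λ { b z (x ∷ y ∷ []) p →
       x ∘ (y ∘ (z ∘ bit b))   ≐⟨ ∘-congʳ (axm (assoc y z b)) ⟩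
       x ∘ (y ∘ z ∘ bit b)     ≐⟨ axm (assoc x (y ∘ z) b) ⟩
       x ∘ (y ∘ z) ∘ bit b     ≐⟨ ∘-congˡ p ⟩
       x ∘ y ∘ z ∘ bit b       ≐⟨ symᵒ (axm (assoc (x ∘ y) z b)) ⟩
       x ∘ y ∘ (z ∘ bit b)     ∎ })
    z (x ∷ y ∷ [])

  one-ε : Γ ⊢ one `ε ≐ `ε
  one-ε = axm (timesε `1)

  one-∘bit : (x : FTm n) (b : Bit) → Γ ⊢ one (x ∘ bit b) ≐ one x ∘ `1
  one-∘bit x b = transᵒ (axm (timesB `1 x b)) (conc≐∘ (one x) `1)

  oneᴱ : E k → E k
  oneᴱ = fn times 1̂

  one-∘ : (x y : FTm n) → Γ ⊢ one (x ∘ y) ≐ one x ∘ one y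
  one-∘ x y = ind (oneᴱ (v1 ∘̂ v0)) (oneᴱ v1 ∘̂ oneᴱ v0)
    (λ { (x ∷ []) →
       one (x ∘ `ε)      ≐⟨ one-cong (axm (εr x)) ⟩
       one x             ≐⟨ symᵒ (axm (εr (one x))) ⟩
       one x ∘ `ε        ≐⟨ ∘-congʳ (symᵒ one-ε) ⟩
       one x ∘ one `ε    ∎ })
    (λ { b y (x ∷ []) p →
       one (x ∘ (y ∘ bit b))       ≐⟨ one-cong (axm (assoc x y b)) ⟩
       one (x ∘ y ∘ bit b)         ≐⟨ one-∘bit (x ∘ y) b ⟩
       one (x ∘ y) ∘ `1            ≐⟨ ∘-congˡ p ⟩
       one x ∘ one y ∘ `1          ≐⟨ symᵒ (axm (assoc (one x) (one y) b1)) ⟩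
       one x ∘ (one y ∘ `1)        ≐⟨ ∘-congʳ (symᵒ (one-∘bit y b)) ⟩
       one x ∘ one (y ∘ bit b)     ∎ })
    y (x ∷ [])

  1-comm : (x : FTm n) → Γ ⊢ `1 ∘ one x ≐ one x ∘ `1
  1-comm x = ind (1̂ ∘̂ oneᴱ v0) (oneᴱ v0 ∘̂ 1̂)
    (λ { [] →
       `1 ∘ one `ε    ≐⟨ ∘-congʳ one-ε ⟩
       `1 ∘ `ε        ≐⟨ axm (εr `1) ⟩
       `1             ≐⟨ symᵒ (axm (εl `1)) ⟩
       `ε ∘ `1        ≐⟨ ∘-congˡ (symᵒ one-ε) ⟩
       one `ε ∘ `1    ∎ })
    (λ { b x [] p →
       `1 ∘ one (x ∘ bit b)    ≐⟨ ∘-congʳ (one-∘bit x b) ⟩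
       `1 ∘ (one x ∘ `1)       ≐⟨ axm (assoc `1 (one x) b1) ⟩
       `1 ∘ one x ∘ `1         ≐⟨ ∘-congˡ p ⟩
       one x ∘ `1 ∘ `1         ≐⟨ ∘-congˡ (symᵒ (one-∘bit x b)) ⟩
       one (x ∘ bit b) ∘ `1    ∎ })
    x []

  -- The last `1` of the second word is carried across the first by `1-comm`. Addition of lengths is
  -- thus commutative, which concatenation is not.
  one-comm : (x y : FTm n) → Γ ⊢ one x ∘ one y ≐ one y ∘ one x
  one-comm x y = ind (oneᴱ v1 ∘̂ oneᴱ v0) (oneᴱ v0 ∘̂ oneᴱ v1)
    (λ { (x ∷ []) →
       one x ∘ one `ε    ≐⟨ ∘-congʳ one-ε ⟩
       one x ∘ `ε        ≐⟨ axm (εr (one x)) ⟩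
       one x             ≐⟨ symᵒ (axm (εl (one x))) ⟩
       `ε ∘ one x        ≐⟨ ∘-congˡ (symᵒ one-ε) ⟩
       one `ε ∘ one x    ∎ })
    (λ { b y (x ∷ []) p →
       one x ∘ one (y ∘ bit b)    ≐⟨ ∘-congʳ (one-∘bit y b) ⟩
       one x ∘ (one y ∘ `1)       ≐⟨ axm (assoc (one x) (one y) b1) ⟩
       one x ∘ one y ∘ `1         ≐⟨ ∘-congˡ p ⟩
       one y ∘ one x ∘ `1         ≐⟨ symᵒ (axm (assoc (one y) (one x) b1)) ⟩
       one y ∘ (one x ∘ `1)       ≐⟨ ∘-congʳ (symᵒ (1-comm x)) ⟩
       one y ∘ (`1 ∘ one x)       ≐⟨ ∘-assoc (one y) `1 (one x) ⟩
       one y ∘ `1 ∘ one x         ≐⟨ ∘-congˡ (symᵒ (one-∘bit y b)) ⟩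
       one (y ∘ bit b) ∘ one x    ∎ })
    y (x ∷ [])

  -- `Trunc` consumes both arguments from the right, so a bound that ends in `one p` keeps all of
  -- `p`; the surplus `one q` then meets `ε`.
  Trunc-one : (p q : FTm n) → Γ ⊢ Trunc p (one q ∘ one p) ≐ p
  Trunc-one p q = ind (trunc v0 (oneᴱ v1 ∘̂ oneᴱ v0)) v0
    (λ { (q ∷ []) → axm (truncε₂ _) })
    (λ { b p (q ∷ []) h →
       Trunc (p ∘ bit b) (one q ∘ one (p ∘ bit b))    ≐⟨ Trunc-cong (refl= _) (∘-congʳ (one-∘bit p b)) ⟩
       Trunc (p ∘ bit b) (one q ∘ (one p ∘ `1))       ≐⟨ Trunc-cong (refl= _) (axm (assoc (one q) (one p) b1)) ⟩
       Trunc (p ∘ bit b) (one q ∘ one p ∘ `1)         ≐⟨ axm (truncB p (one q ∘ one p) b b1) ⟩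
       Trunc p (one q ∘ one p) ∘ bit b                ≐⟨ ∘-congˡ h ⟩
       p ∘ bit b                                      ∎ })
    p (q ∷ [])

  -- Iterated tails

  β₂ : ∀ {Δ A B C} (t : POR.Tm (B ∷ A ∷ Δ) C) (y : POR.Tm Δ A) (r : POR.Tm Δ B) →
       Δ ⊩ lam (lam t) · y · r ≈ sub (σ₀ r) (sub (extS (σ₀ y)) t)
  β₂ t y r = trans≈ (app≈ (axiom (β (lam t) y)) (refl≈ r)) (axiom (β (sub (extS (σ₀ y)) t) r))

  rec-bit : ∀ {Δ} (x : POR.Tm Δ ι) (h : Bit → POR.Tm Δ (ι POR.⇒ ι POR.⇒ ι)) k b y →
            Δ ⊩ Rec x (h b0) (h b1) k (y ∘ bit b)
              ≈ Trunc (h b · y · Rec x (h b0) (h b1) k y) (k · y)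
  rec-bit x h k b0 y = axiom (rec0 x (h b0) (h b1) k y)
  rec-bit x h k b1 y = axiom (rec1 x (h b0) (h b1) k y)

  β-one : ∀ {Δ} (x w : POR.Tm Δ ι) → Δ ⊩ lam (one (wkT x)) · w ≈ one x
  β-one x w = subst (_ ⊩ lam (one (wkT x)) · w ≈_)
    (trans (one-sub (σ₀ w) (wkT x)) (cong one (sub-σ₀-wk w x))) (axiom (β _ w))

  Drop-ε : (x : FTm n) → Γ ⊢ Drop x `ε ≐ x
  Drop-ε x = axm (recε _ _ _ _)

  Drop-∘bit-Trunc : (x w : FTm n) (b : Bit) →
                    Γ ⊢ Drop x (w ∘ bit b) ≐ Trunc (Tail (Drop x w)) (one x)
  Drop-∘bit-Trunc x w b = ax (por (trans≈ (rec-bit x (λ _ → h) (lam (one (wkT x))) b w)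
    (app≈ (app≈ (refl≈ `Trunc) (β₂ (Tail (var here)) w (Drop x w))) (β-one x w))))
    where h = lam (lam (Tail (var here)))

  Surp-∘bit-Trunc : (x w : FTm n) (b : Bit) →
                    Γ ⊢ Surp x (w ∘ bit b)
                      ≐ Trunc (Cond (Drop x w) (Surp x w) (Surp x w ∘ `1) (Surp x w ∘ `1)) (one x)
  Surp-∘bit-Trunc x w b = ax (por (trans≈ (rec-bit `ε (λ _ → lam (lam h)) (lam (one (wkT x))) b w)
    (app≈ (app≈ (refl≈ `Trunc) (subst (_ ⊩ lam (lam h) · w · r ≈_) h-sub (β₂ h w r))) (β-one x w))))
    where
    r = Surp x w
    h = Cond (Drop (wkT (wkT x)) (var (there here))) (var here) (var here ∘ `1) (var here ∘ `1)
    h-sub : sub (σ₀ r) (sub (extS (σ₀ w)) h) ≡ Cond (Drop x w) r (r ∘ `1) (r ∘ `1)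
    h-sub = cong (λ d → Cond d r (r ∘ `1) (r ∘ `1))
      (trans (cong (sub (σ₀ r))
               (trans (Drop-sub (extS (σ₀ w)) (wkT (wkT x)) (var (there here)))
                      (cong (λ y → Drop y (wkT w))
                        (trans (sub-ext-wk (σ₀ w) (wkT x)) (cong wkT (sub-σ₀-wk w x))))))
      (trans (Drop-sub (σ₀ r) (wkT x) (wkT w))
             (cong₂ Drop (sub-σ₀-wk r x) (sub-σ₀-wk r w))))

  -- The bit that `Tail` takes from `d` is paid for by a `1` added to `s`; if `d` is empty, neither
  -- changes. The total length is preserved.
  one-Tail : (d s : FTm n) → Γ ⊢ one s ∘ one d ≐ one (Cond d s (s ∘ `1) (s ∘ `1)) ∘ one (Tail d)
  one-Tail d s = caseᴱ (oneᴱ v1 ∘̂ oneᴱ v0)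
    (oneᴱ (cond v0 v1 (v1 ∘̂ 1̂) (v1 ∘̂ 1̂)) ∘̂ oneᴱ (tail v0)) (s ∷ [])
    (∘-cong (one-cong (symᵒ (cond-ε (refl= _)))) (one-cong (symᵒ (axm tailε))))
    (λ b y →
      one s ∘ one (y ∘ bit b)    ≐⟨ ∘-congʳ (one-∘bit y b) ⟩
      one s ∘ (one y ∘ `1)       ≐⟨ ∘-congʳ (symᵒ (1-comm y)) ⟩
      one s ∘ (`1 ∘ one y)       ≐⟨ ∘-assoc _ _ _ ⟩
      one s ∘ `1 ∘ one y         ≐⟨ ∘-cong (symᵒ (one-∘bit s b1)) (one-cong (symᵒ (axm (tailB y b)))) ⟩
      one (s ∘ `1) ∘ one (Tail (y ∘ bit b))
        ≐⟨ ∘-congˡ (one-cong (symᵒ (cond-∘bit b y))) ⟩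
      one (Cond (y ∘ bit b) s (s ∘ `1) (s ∘ `1)) ∘ one (Tail (y ∘ bit b)) ∎)
    d
    where
    cond-∘bit : ∀ {s} b y → Γ ⊢ Cond (y ∘ bit b) s (s ∘ `1) (s ∘ `1) ≐ s ∘ `1
    cond-∘bit b0 y = cond-0 (refl= _)
    cond-∘bit b1 y = cond-1 (refl= _)

  Trunc-bound : {o : FTm n} (p q : FTm n) → Γ ⊢ o ≐ one q ∘ one p → Γ ⊢ Trunc p o ≐ p
  Trunc-bound p q h = transᵒ (Trunc-cong (refl= p) h) (Trunc-one p q)

  -- This invariant shows that the truncations in the recursions of Drop and Surp are idle.
  one-Surp-Drop : (x w : FTm n) → Γ ⊢ one x ≐ one (Surp x w) ∘ one (Drop x w)
  one-Surp-Drop x w = ind (oneᴱ v1) (oneᴱ (surp v1 v0) ∘̂ oneᴱ (drop v1 v0))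
    (λ { (x ∷ []) →
       one x             ≐⟨ symᵒ (axm (εl (one x))) ⟩
       `ε ∘ one x        ≐⟨ ∘-cong (symᵒ one-ε) (one-cong (symᵒ (Drop-ε x))) ⟩
       one `ε ∘ one (Drop x `ε)
                         ≐⟨ ∘-congˡ (one-cong (symᵒ (axm (recε _ _ _ _)))) ⟩
       one (Surp x `ε) ∘ one (Drop x `ε) ∎ })
    (λ { b w (x ∷ []) p →
       let s = Surp x w
           d = Drop x w
           s' = Cond d s (s ∘ `1) (s ∘ `1)
           q = transᵒ p (one-Tail d s)
       in
       one x                       ≐⟨ q ⟩
       -- `Trunc-bound` wants the length of the truncated word on the right of the bound, so the sum
       -- is commuted for `s'` and used as it is for `Tail d`.
       one s' ∘ one (Tail d)       ≐⟨ ∘-cong (one-cong (symᵒ (Trunc-bound s' (Tail d)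
                                        (transᵒ q (one-comm s' (Tail d))))))
                                      (one-cong (symᵒ (Trunc-bound (Tail d) s' q))) ⟩
       one (Trunc s' (one x)) ∘ one (Trunc (Tail d) (one x))
                                   ≐⟨ ∘-cong (one-cong (symᵒ (Surp-∘bit-Trunc x w b)))
                                             (one-cong (symᵒ (Drop-∘bit-Trunc x w b))) ⟩
       one (Surp x (w ∘ bit b)) ∘ one (Drop x (w ∘ bit b)) ∎ })
    w (x ∷ [])

  Drop-∘bit : (x w : FTm n) (b : Bit) → Γ ⊢ Drop x (w ∘ bit b) ≐ Tail (Drop x w)
  Drop-∘bit x w b = transᵒ (Drop-∘bit-Trunc x w b)
    (Trunc-bound (Tail (Drop x w)) _
      (transᵒ (one-Surp-Drop x w) (one-Tail (Drop x w) (Surp x w))))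

  Drop-Tail : (x w : FTm n) → Γ ⊢ Drop (Tail x) w ≐ Tail (Drop x w)
  Drop-Tail x w = ind (drop (tail v1) v0) (tail (drop v1 v0))
    (λ { (x ∷ []) → transᵒ (Drop-ε (Tail x)) (Tail-cong (symᵒ (Drop-ε x))) })
    (λ { b w (x ∷ []) p →
       transᵒ (Drop-∘bit (Tail x) w b) (Tail-cong (transᵒ p (symᵒ (Drop-∘bit x w b)))) })
    w (x ∷ [])

  Drop-bits : (x y : FTm n) (a b : Bit) → Γ ⊢ Drop (x ∘ bit a) (y ∘ bit b) ≐ Drop x y
  Drop-bits x y a b = transᵒ (Drop-∘bit _ y b)
    (transᵒ (symᵒ (Drop-Tail _ y)) (Drop-cong (axm (tailB x a)) (refl= y)))

  ε-Drop : (w : FTm n) → Γ ⊢ Drop `ε w ≐ `ε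
  ε-Drop w = ind (drop ε̂ v0) ε̂ (λ { [] → Drop-ε `ε })
    (λ { b w [] p → transᵒ (Drop-∘bit `ε w b) (transᵒ (Tail-cong p) (axm tailε)) }) w []

  Drop-self : (x : FTm n) → Γ ⊢ Drop x x ≐ `ε
  Drop-self x = ind (drop v0 v0) ε̂ (λ { [] → Drop-ε `ε })
    (λ { b x [] p → transᵒ (Drop-bits x x b b) p }) x []

  -- With `Trunc-∘-one` this recovers both halves of `x ∘ y` from the length of the second half;
  -- `split` searches for that length.
  Drop-∘-one : (x y : FTm n) → Γ ⊢ Drop (x ∘ y) (one y) ≐ x
  Drop-∘-one x y = ind (drop (v1 ∘̂ v0) (oneᴱ v0)) v1
    (λ { (x ∷ []) → transᵒ (Drop-cong (axm (εr x)) one-ε) (Drop-ε x) })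
    (λ { b y (x ∷ []) p → transᵒ (Drop-cong (axm (assoc x y b)) (one-∘bit y b))
                            (transᵒ (Drop-bits (x ∘ y) (one y) b b1) p) })
    y (x ∷ [])

  Trunc-∘-one : (x y : FTm n) → Γ ⊢ Trunc (x ∘ y) (one y) ≐ y
  Trunc-∘-one x y = ind (trunc (v1 ∘̂ v0) (oneᴱ v0)) v0
    (λ { (x ∷ []) → transᵒ (Trunc-cong (refl= _) one-ε) (axm (truncε₁ _)) })
    (λ { b y (x ∷ []) p → transᵒ (Trunc-cong (axm (assoc x y b)) (one-∘bit y b))
                            (transᵒ (axm (truncB (x ∘ y) (one y) b b1)) (∘-congˡ p)) })
    y (x ∷ [])

  -- The descending recursion (x, y) ↦ (Tail x, Tail y) is run upwards, along
  -- (Drop x (Drop x v), Drop y (Drop x v)) for growing v.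
  ind₂ : (e f : E (suc (suc k))) →
         (∀ {n} {Γ : List (Fm n)} y ρ → Γ ⊢ ⟦ e ⟧ (`ε ∷ y ∷ ρ) ≐ ⟦ f ⟧ (`ε ∷ y ∷ ρ)) →
         (∀ {n} {Γ : List (Fm n)} x ρ → Γ ⊢ ⟦ e ⟧ (x ∷ `ε ∷ ρ) ≐ ⟦ f ⟧ (x ∷ `ε ∷ ρ)) →
         (∀ {n} {Γ : List (Fm n)} a b x y ρ → Γ ⊢ ⟦ e ⟧ (x ∷ y ∷ ρ) ≐ ⟦ f ⟧ (x ∷ y ∷ ρ) →
           Γ ⊢ ⟦ e ⟧ (x ∘ bit a ∷ y ∘ bit b ∷ ρ) ≐ ⟦ f ⟧ (x ∘ bit a ∷ y ∘ bit b ∷ ρ)) →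
         ∀ {n} {Γ : List (Fm n)} x y ρ → Γ ⊢ ⟦ e ⟧ (x ∷ y ∷ ρ) ≐ ⟦ f ⟧ (x ∷ y ∷ ρ)
  ind₂ {k} e f left right step x y ρ =
    -- The invariant starts at v = ε, where the whole length of x is dropped and `left` applies, and
    -- is read off at v = x, where nothing is dropped any more.
    resps e f ρ (symᵒ (drop-all x)) (symᵒ (drop-all y))
      (ind (e ⟪ s ⟫) (f ⟪ s ⟫)
        (λ { (x ∷ y ∷ ρ) → resp₀ e f _ (transᵒ (Drop-cong (refl= x) (Drop-ε x)) (Drop-self x))
                             (left (Drop y (Drop x `ε)) ρ) })
        (λ { b v (x ∷ y ∷ ρ) p → up b v x y ρ p })
        x (x ∷ y ∷ ρ))
    where
    s : Sb (suc (suc (suc k))) (suc (suc k))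
    s = drop v1 (drop v1 v0) ∷ drop v2 (drop v1 v0) ∷ ↑ ↑ ↑ idˢ

    drop-all : ∀ z → Γ ⊢ Drop z (Drop x x) ≐ z
    drop-all z = transᵒ (Drop-cong (refl= z) (Drop-self x)) (Drop-ε z)

    climb : ∀ {n} {Γ : List (Fm n)} p q ρ → Γ ⊢ ⟦ e ⟧ (Tail p ∷ Tail q ∷ ρ) ≐ ⟦ f ⟧ (Tail p ∷ Tail q ∷ ρ) →
            Γ ⊢ ⟦ e ⟧ (p ∷ q ∷ ρ) ≐ ⟦ f ⟧ (p ∷ q ∷ ρ)
    climb p q ρ h = byCases p (resp₀ e f _ h₀ (left q ρ))
      (λ a → byCases q (resp₁ e f _ h₀ (right p ρ))
        (λ b → resps e f _ (wk h₀) h₀ (step a b (Tail p) (Tail q) ρ (wk (wk h)))))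

    up : ∀ {n} {Γ : List (Fm n)} b v x y ρ →
         Γ ⊢ ⟦ e ⟪ s ⟫ ⟧ (v ∷ x ∷ y ∷ ρ) ≐ ⟦ f ⟪ s ⟫ ⟧ (v ∷ x ∷ y ∷ ρ) →
         Γ ⊢ ⟦ e ⟪ s ⟫ ⟧ (v ∘ bit b ∷ x ∷ y ∷ ρ) ≐ ⟦ f ⟪ s ⟫ ⟧ (v ∘ bit b ∷ x ∷ y ∷ ρ)
    up b v x y ρ p =
      resps e f ρ (Drop-cong (refl= x) (Drop-∘bit x v b)) (Drop-cong (refl= y) (Drop-∘bit x v b))
        -- Either w is exhausted and the pair no longer changes, or passing from w to `Tail w`
        -- returns one bit to each component that was cut short, and `climb` applies.
        (byCases w
          (resps e f ρ (Drop-cong (refl= x) tail≐) (Drop-cong (refl= y) tail≐) (wk p))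
          (λ a → climb (Drop x (Tail w)) (Drop y (Tail w)) ρ
            (resps e f ρ (tail-Drop x a) (tail-Drop y a) (wk p))))
      where
      w = Drop x v
      tail≐ : ∀ {Γ} → (w ≐ `ε) ∷ Γ ⊢ Tail w ≐ w
      tail≐ = transᵒ (Tail-cong h₀) (transᵒ (axm tailε) (symᵒ h₀))
      tail-Drop : ∀ {Γ} z a → (w ≐ Tail w ∘ bit a) ∷ Γ ⊢ Tail (Drop z (Tail w)) ≐ Drop z w
      tail-Drop z a = transᵒ (symᵒ (Drop-∘bit z (Tail w) a)) (Drop-cong (refl= z) (symᵒ h₀))

  -- Equality and the initial-subword relation

  Eq-refl : (x : FTm n) → Γ ⊢ Eq x x ≐ `1
  Eq-refl x = ind (fn eq v0 v0) 1̂ (λ { [] → axm eqεε })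
    (λ { b x [] p → transᵒ (axm (eqBB x x b)) p }) x []

  Eq-boolean : (x y : FTm n) → Boolean Γ (Eq x y)
  Eq-boolean x y = ind₂ (cond (fn eq v0 v1) 1̂ 0̂ 1̂) (fn eq v0 v1)
    (λ { y [] → caseᴱ (cond (fn eq ε̂ v0) 1̂ 0̂ 1̂) (fn eq ε̂ v0) []
                  (boolean-1 (axm eqεε)) (λ b y → boolean-0 (axm (eqεB y b))) y })
    (λ { x [] → caseᴱ (cond (fn eq v0 ε̂) 1̂ 0̂ 1̂) (fn eq v0 ε̂) []
                  (boolean-1 (axm eqεε)) (λ b x → boolean-0 (axm (eqBε x b))) x })
    (λ { b0 b0 x y [] p → boolean-resp (axm (eqBB x y b0)) p
       ; b0 b1 x y [] p → boolean-0 (axm (eq01 x y))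
       ; b1 b0 x y [] p → boolean-0 (axm (eq10 x y))
       ; b1 b1 x y [] p → boolean-resp (axm (eqBB x y b1)) p })
    x y []

  guard-0 : {c x y : FTm n} → Γ ⊢ c ≐ `0 → Γ ⊢ guard c x ≐ guard c y
  guard-0 p = transᵒ (if-0 p) (symᵒ (if-0 p))

  guard-cong : {c x y : FTm n} → Γ ⊢ x ≐ y → Γ ⊢ guard c x ≐ guard c y
  guard-cong {c = c} = cong₁ (cond v0 ε̂ ε̂ v1) c []

  Eq⇒≐-guarded : (x y : FTm n) → Γ ⊢ guard (Eq x y) x ≐ guard (Eq x y) y
  Eq⇒≐-guarded x y = ind₂ (cond (fn eq v0 v1) ε̂ ε̂ v0) (cond (fn eq v0 v1) ε̂ ε̂ v1)
    (λ { y [] → caseᴱ (cond (fn eq ε̂ v0) ε̂ ε̂ ε̂) (cond (fn eq ε̂ v0) ε̂ ε̂ v0) []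
                  (refl= _) (λ b y → guard-0 (axm (eqεB y b))) y })
    (λ { x [] → caseᴱ (cond (fn eq v0 ε̂) ε̂ ε̂ v0) (cond (fn eq v0 ε̂) ε̂ ε̂ ε̂) []
                  (refl= _) (λ b x → guard-0 (axm (eqBε x b))) x })
    (λ { b0 b0 x y [] p → same b0 x y p
       ; b0 b1 x y [] p → guard-0 (axm (eq01 x y))
       ; b1 b0 x y [] p → guard-0 (axm (eq10 x y))
       ; b1 b1 x y [] p → same b1 x y p })
    x y []
    where
    same : ∀ {n} {Γ : List (Fm n)} b x y → Γ ⊢ guard (Eq x y) x ≐ guard (Eq x y) y →
           Γ ⊢ guard (Eq (x ∘ bit b) (y ∘ bit b)) (x ∘ bit b)
             ≐ guard (Eq (x ∘ bit b) (y ∘ bit b)) (y ∘ bit b)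
    same b x y p = guard-intro (Eq-boolean _ _)
      (∘-congˡ (guard-elim (wk p) (transᵒ (symᵒ (axm (eqBB x y b))) h₀)))

  Eq⇒≐ : {x y : FTm n} → Γ ⊢ Eq x y ≐ `1 → Γ ⊢ x ≐ y
  Eq⇒≐ {x = x} {y} = guard-elim (Eq⇒≐-guarded x y)

  ≐⇒Eq : {x y : FTm n} → Γ ⊢ x ≐ y → Γ ⊢ Eq x y ≐ `1
  ≐⇒Eq {x = x} p = transᵒ (fn-cong eq (refl= x) (symᵒ p)) (Eq-refl x)

  boolean-or : {p q : FTm n} → Boolean Γ p → Boolean Γ q → Boolean Γ (or p q)
  boolean-or bp bq = boolean-if bp bq (boolean-1 (refl= `1))

  or-introˡ : {p q : FTm n} → Γ ⊢ p ≐ `1 → Γ ⊢ or p q ≐ `1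
  or-introˡ h = if-1 h

  or-introʳ : {p q : FTm n} → Boolean Γ p → Γ ⊢ q ≐ `1 → Γ ⊢ or p q ≐ `1
  or-introʳ bp h = decide bp (transᵒ (if-0 h₀) (wk h)) (if-1 h₀)

  or-elim : {p q : FTm n} {C : Fm n} → Boolean Γ p → Γ ⊢ or p q ≐ `1 →
            (p ≐ `1) ∷ Γ ⊢ C → (q ≐ `1) ∷ Γ ⊢ C → Γ ⊢ C
  or-elim bp h l r = decide bp
    (cut (transᵒ (symᵒ (if-0 h₀)) (wk h)) (weaken (∷⁺ʳ _ (xs⊆x∷xs _ _)) r)) l

  BOr≐or : {p q : FTm n} → Boolean Γ p → Boolean Γ q → Γ ⊢ BOr p q ≐ or p q
  BOr≐or bp bq = congs (cond v0 v1 v1 1̂) [] (Bt≐ bp) (Bt≐ bq)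
    where
    Bt≐ : ∀ {c} → Boolean Γ c → Γ ⊢ Bt c ≐ c
    Bt≐ bc = decide bc (transᵒ (if-0 h₀) (symᵒ h₀)) (transᵒ (if-1 h₀) (symᵒ h₀))

  Eps⇒≐ε : (x : FTm n) → Γ ⊢ Eps x ≐ `1 → Γ ⊢ x ≐ `ε
  Eps⇒≐ε x h = byCases x h₀
    λ { b0 → absurd (transᵒ (symᵒ (cond-0 h₀)) (wk h))
      ; b1 → absurd (transᵒ (symᵒ (cond-1 h₀)) (wk h)) }

  Subw-ε⇒≐ε : (x : FTm n) → Γ ⊢ Subw x `ε ≐ `1 → Γ ⊢ x ≐ `ε
  Subw-ε⇒≐ε x h = Eps⇒≐ε x (transᵒ (symᵒ (axm (subε x))) h)

  ≐ε⇒Subw-ε : (x : FTm n) → Γ ⊢ x ≐ `ε → Γ ⊢ Subw x `ε ≐ `1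
  ≐ε⇒Subw-ε x h = transᵒ (axm (subε x)) (cond-ε h)

  Subw-boolean : (x y : FTm n) → Boolean Γ (Subw x y)
  Subw-boolean x y = ind (cond (fn subw v1 v0) 1̂ 0̂ 1̂) (fn subw v1 v0)
    (λ { (x ∷ []) → boolean-resp (axm (subε x))
           (caseᴱ (cond (cond v0 1̂ 0̂ 0̂) 1̂ 0̂ 1̂) (cond v0 1̂ 0̂ 0̂) [] (boolean-1 (cond-ε (refl= _)))
             (λ { b0 y → boolean-0 (cond-0 (refl= _)) ; b1 y → boolean-0 (cond-1 (refl= _)) }) x) })
    (λ { b y (x ∷ []) p → boolean-resp
           (transᵒ (axm (subB x y b)) (BOr≐or p (Eq-boolean x (y ∘ bit b))))
           (boolean-or p (Eq-boolean x (y ∘ bit b))) })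
    y (x ∷ [])

  Subw-∘bit : (x y : FTm n) (b : Bit) →
              Γ ⊢ Subw x (y ∘ bit b) ≐ or (Subw x y) (Eq x (y ∘ bit b))
  Subw-∘bit x y b = transᵒ (axm (subB x y b)) (BOr≐or (Subw-boolean x y) (Eq-boolean x (y ∘ bit b)))

  Subw-step : (x y : FTm n) (b : Bit) → Γ ⊢ Subw x y ≐ `1 → Γ ⊢ Subw x (y ∘ bit b) ≐ `1
  Subw-step x y b h = transᵒ (Subw-∘bit x y b) (or-introˡ h)

  ≐⇒Subw-∘bit : (x y : FTm n) (b : Bit) → Γ ⊢ x ≐ y ∘ bit b → Γ ⊢ Subw x (y ∘ bit b) ≐ `1
  ≐⇒Subw-∘bit x y b h = transᵒ (Subw-∘bit x y b) (or-introʳ (Subw-boolean x y) (≐⇒Eq h))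

  Subw-∘bit-elim : (x y : FTm n) (b : Bit) {C : Fm n} → Γ ⊢ Subw x (y ∘ bit b) ≐ `1 →
                   (Subw x y ≐ `1) ∷ Γ ⊢ C → (Eq x (y ∘ bit b) ≐ `1) ∷ Γ ⊢ C → Γ ⊢ C
  Subw-∘bit-elim x y b h = or-elim (Subw-boolean x y) (transᵒ (symᵒ (Subw-∘bit x y b)) h)

  Subw-refl : (x : FTm n) → Γ ⊢ Subw x x ≐ `1
  Subw-refl x = caseᴱ (fn subw v0 v0) 1̂ [] (≐ε⇒Subw-ε `ε (refl= `ε))
    (λ b y → ≐⇒Subw-∘bit _ y b (refl= _)) x

  Subw-prefix : (w x : FTm n) → Γ ⊢ Subw w (w ∘ x) ≐ `1
  Subw-prefix w x = ind (fn subw v1 (v1 ∘̂ v0)) 1̂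
    (λ { (w ∷ []) → transᵒ (fn-cong subw (refl= w) (axm (εr w))) (Subw-refl w) })
    (λ { b x (w ∷ []) p →
       transᵒ (fn-cong subw (refl= w) (axm (assoc w x b))) (Subw-step w (w ∘ x) b p) })
    x (w ∷ [])

  ∘≐ε⇒≐ε : (w x : FTm n) → Γ ⊢ w ∘ x ≐ `ε → Γ ⊢ w ≐ `ε
  ∘≐ε⇒≐ε w x h = byCases x
    (transᵒ (symᵒ (axm (εr w))) (transᵒ (∘-congʳ (symᵒ h₀)) (wk h)))
    (λ b → absurd (∘bit≢ε b (transᵒ (symᵒ (axm (assoc w (Tail x) b)))
                              (transᵒ (∘-congʳ (symᵒ h₀)) (wk h)))))

  -- Induction on `t`: if `w ∘ x` is all of `t`, then `Subw-prefix` applies; otherwise `w ∘ x` is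
  -- already an initial subword of the shorter word.
  Subw-downward : (w x t : FTm n) → Γ ⊢ Subw (w ∘ x) t ≐ `1 → Γ ⊢ Subw w t ≐ `1
  Subw-downward w x t = guard-elim
    (ind (cond (fn subw (v1 ∘̂ v2) v0) ε̂ ε̂ (fn subw v1 v0)) (cond (fn subw (v1 ∘̂ v2) v0) ε̂ ε̂ 1̂)
      (λ { (w ∷ x ∷ []) → guard-intro (Subw-boolean _ _)
             (≐ε⇒Subw-ε w (∘≐ε⇒≐ε w x (Subw-ε⇒≐ε (w ∘ x) h₀))) })
      (λ { b t (w ∷ x ∷ []) p → guard-intro (Subw-boolean _ _)
             (Subw-∘bit-elim (w ∘ x) t b h₀
               (Subw-step w t b (guard-elim (wk (wk p)) h₀))
               (transᵒ (fn-cong subw (refl= w) (symᵒ (Eq⇒≐ h₀))) (Subw-prefix w x))) })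
      t (w ∷ x ∷ []))

  Subw-pred : (x y : FTm n) (b : Bit) → Γ ⊢ Subw (x ∘ bit b) (y ∘ bit b) ≐ `1 → Γ ⊢ Subw x y ≐ `1
  Subw-pred x y b h = Subw-∘bit-elim (x ∘ bit b) y b h (Subw-downward x (bit b) y h₀)
    (transᵒ (fn-cong subw (∘bit-inj b (Eq⇒≐ h₀)) (refl= y)) (Subw-refl y))

  -- On unary words the initial-subword relation is the order of lengths, and `Drop` is subtraction.
  -- The bounds of quantifiers thereby become equations with an explicit difference.
  one-Subw : (p q : FTm n) → Γ ⊢ Subw (one p) (one q) ≐ `1 → Γ ⊢ one q ≐ one p ∘ one (Drop q p)
  one-Subw p q = guard-elim
    (ind₂ (cond c ε̂ ε̂ (oneᴱ v1)) (cond c ε̂ ε̂ (oneᴱ v0 ∘̂ oneᴱ (drop v1 v0)))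
      (λ { q [] → guard-cong
             (one q                    ≐⟨ symᵒ (axm (εl (one q))) ⟩
              `ε ∘ one q               ≐⟨ ∘-cong (symᵒ one-ε) (one-cong (symᵒ (Drop-ε q))) ⟩
              one `ε ∘ one (Drop q `ε) ∎) })
      (λ { p [] → guard-intro (Subw-boolean _ _)
             (one `ε                   ≐⟨ one-cong (symᵒ (ε-Drop p)) ⟩
              one (Drop `ε p)          ≐⟨ symᵒ (axm (εl _)) ⟩
              `ε ∘ one (Drop `ε p)     ≐⟨ ∘-congˡ (symᵒ (Subw-ε⇒≐ε (one p)
                                            (transᵒ (fn-cong subw (refl= _) (symᵒ one-ε)) h₀))) ⟩
              one p ∘ one (Drop `ε p)  ∎) })
      (λ { a b p q [] h → guard-intro (Subw-boolean _ _)
             (one (q ∘ bit b)                 ≐⟨ one-∘bit q b ⟩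
              one q ∘ `1                      ≐⟨ ∘-congˡ (guard-elim (wk h) (Subw-pred (one p) (one q) b1
                                                   (transᵒ (fn-cong subw (symᵒ (one-∘bit p a))
                                                                         (symᵒ (one-∘bit q b))) h₀))) ⟩
              one p ∘ one (Drop q p) ∘ `1     ≐⟨ symᵒ (axm (assoc _ _ b1)) ⟩
              one p ∘ (one (Drop q p) ∘ `1)   ≐⟨ ∘-congʳ (symᵒ (1-comm (Drop q p))) ⟩
              one p ∘ (`1 ∘ one (Drop q p))   ≐⟨ ∘-assoc _ _ _ ⟩
              one p ∘ `1 ∘ one (Drop q p)     ≐⟨ ∘-cong (symᵒ (one-∘bit p a))
                                                        (one-cong (symᵒ (Drop-bits q p b a))) ⟩
              one (p ∘ bit a) ∘ one (Drop (q ∘ bit b) (p ∘ bit a)) ∎) })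
      p q [])
    where
    c : E 2
    c = fn subw (oneᴱ v0) (oneᴱ v1)

  -- Comparison of lengths

  -- The difference is a term given in the metalanguage instead of an object-level existential, so
  -- transitivity and monotonicity merely combine terms, without `∃E`.
  Le : List (Fm n) → FTm n → FTm n → Set
  Le {n} Γ a b = Σ[ w ∈ FTm n ] (Γ ⊢ one b ≐ one a ∘ one w)

  ⊑⇒Le : {a b : FTm n} → Γ ⊢ one a ⊑ one b → Le Γ a b
  ⊑⇒Le {a = a} {b} h = Drop b a , one-Subw a b (⊑⇒Subw h)

  Le⇒⊑ : {a b : FTm n} → Le Γ a b → Γ ⊢ one a ⊑ one b
  Le⇒⊑ {a = a} (w , h) =
    Subw⇒⊑ (transᵒ (fn-cong subw (refl= _) h) (Subw-prefix (one a) (one w)))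

  Le-refl : (a : FTm n) → Le Γ a a
  Le-refl a = `ε , transᵒ (symᵒ (axm (εr _))) (∘-congʳ (symᵒ one-ε))

  Le-trans : {a b c : FTm n} → Le Γ a b → Le Γ b c → Le Γ a c
  Le-trans (w , p) (v , q) = w ∘ v , transᵒ q (transᵒ (∘-congˡ p)
    (transᵒ (symᵒ (∘-assoc _ _ _)) (∘-congʳ (symᵒ (one-∘ w v)))))

  one-interchange : (a w b v : FTm n) →
                    Γ ⊢ (one a ∘ one w) ∘ (one b ∘ one v) ≐ (one a ∘ one b) ∘ (one w ∘ one v)
  one-interchange a w b v =
    one a ∘ one w ∘ (one b ∘ one v)     ≐⟨ symᵒ (∘-assoc _ _ _) ⟩
    one a ∘ (one w ∘ (one b ∘ one v))   ≐⟨ ∘-congʳ (∘-assoc _ _ _) ⟩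
    one a ∘ (one w ∘ one b ∘ one v)     ≐⟨ ∘-congʳ (∘-congˡ (one-comm w b)) ⟩
    one a ∘ (one b ∘ one w ∘ one v)     ≐⟨ ∘-congʳ (symᵒ (∘-assoc _ _ _)) ⟩
    one a ∘ (one b ∘ (one w ∘ one v))   ≐⟨ ∘-assoc _ _ _ ⟩
    one a ∘ one b ∘ (one w ∘ one v)     ∎

  Le-∘ : {a a' b b' : FTm n} → Le Γ a a' → Le Γ b b' → Le Γ (a ∘ b) (a' ∘ b')
  Le-∘ {a = a} {a'} {b} {b'} (w , p) (v , q) = w ∘ v ,
    (one (a' ∘ b')                       ≐⟨ one-∘ a' b' ⟩
     one a' ∘ one b'                     ≐⟨ ∘-cong p q ⟩
     one a ∘ one w ∘ (one b ∘ one v)     ≐⟨ one-interchange a w b v ⟩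
     one a ∘ one b ∘ (one w ∘ one v)     ≐⟨ ∘-cong (symᵒ (one-∘ a b)) (symᵒ (one-∘ w v)) ⟩
     one (a ∘ b) ∘ one (w ∘ v)           ∎)

  one-one : (a : FTm n) → Γ ⊢ one (one a) ≐ one a
  one-one a = ind (oneᴱ (oneᴱ v0)) (oneᴱ v0) (λ { [] → one-cong one-ε })
    (λ { b a [] p → transᵒ (one-cong (one-∘bit a b)) (transᵒ (one-∘bit (one a) b1)
                      (transᵒ (∘-congˡ p) (symᵒ (one-∘bit a b)))) })
    a []

  Times-cong : {x x' y y' : FTm n} → Γ ⊢ x ≐ x' → Γ ⊢ y ≐ y' → Γ ⊢ Times x y ≐ Times x' y'
  Times-cong = fn-cong times

  Times-∘bit : (x y : FTm n) (b : Bit) → Γ ⊢ Times x (y ∘ bit b) ≐ Times x y ∘ x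
  Times-∘bit x y b = transᵒ (axm (timesB x y b)) (conc≐∘ _ x)

  one-Times-∘bit : (x y : FTm n) (b : Bit) → Γ ⊢ one (Times x (y ∘ bit b)) ≐ one (Times x y) ∘ one x
  one-Times-∘bit x y b = transᵒ (one-cong (Times-∘bit x y b)) (one-∘ _ x)

  -- The product consists of copies of its left factor, so making that factor unary preserves only
  -- the length. The right factor just counts the copies, and `Times-one` is an equality of strings.
  one-Times-one : (a y : FTm n) → Γ ⊢ one (Times (one a) y) ≐ one (Times a y)
  one-Times-one a y = ind (oneᴱ (fn times (oneᴱ v1) v0)) (oneᴱ (fn times v1 v0))
    (λ { (a ∷ []) → one-cong (transᵒ (axm (timesε _)) (symᵒ (axm (timesε _)))) })
    (λ { b y (a ∷ []) p → transᵒ (one-Times-∘bit (one a) y b)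
           (transᵒ (∘-cong p (one-one a)) (symᵒ (one-Times-∘bit a y b))) })
    y (a ∷ [])

  one-Times-∘ˡ : (a w y : FTm n) → Γ ⊢ one (Times (a ∘ w) y) ≐ one (Times a y) ∘ one (Times w y)
  one-Times-∘ˡ a w y = ind (oneᴱ (fn times (v1 ∘̂ v2) v0)) (oneᴱ (fn times v1 v0) ∘̂ oneᴱ (fn times v2 v0))
    (λ { (a ∷ w ∷ []) →
       one (Times (a ∘ w) `ε)                  ≐⟨ zero-length (a ∘ w) ⟩
       `ε                                      ≐⟨ symᵒ (axm (εl `ε)) ⟩
       `ε ∘ `ε                                 ≐⟨ ∘-cong (symᵒ (zero-length a)) (symᵒ (zero-length w)) ⟩
       one (Times a `ε) ∘ one (Times w `ε)     ∎ })
    (λ { b y (a ∷ w ∷ []) p →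
       one (Times (a ∘ w) (y ∘ bit b))         ≐⟨ one-Times-∘bit (a ∘ w) y b ⟩
       one (Times (a ∘ w) y) ∘ one (a ∘ w)     ≐⟨ ∘-cong p (one-∘ a w) ⟩
       one (Times a y) ∘ one (Times w y) ∘ (one a ∘ one w)
                                               ≐⟨ one-interchange _ _ _ _ ⟩
       one (Times a y) ∘ one a ∘ (one (Times w y) ∘ one w)
         ≐⟨ ∘-cong (symᵒ (one-Times-∘bit a y b)) (symᵒ (one-Times-∘bit w y b)) ⟩
       one (Times a (y ∘ bit b)) ∘ one (Times w (y ∘ bit b)) ∎ })
    y (a ∷ w ∷ [])
    where
    zero-length : ∀ {n} {Γ : List (Fm n)} x → Γ ⊢ one (Times x `ε) ≐ `ε
    zero-length x = transᵒ (one-cong (axm (timesε x))) one-ε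

  Times-∘ʳ : (a x y : FTm n) → Γ ⊢ Times a (x ∘ y) ≐ Times a x ∘ Times a y
  Times-∘ʳ a x y = ind (fn times v1 (v2 ∘̂ v0)) (fn times v1 v2 ∘̂ fn times v1 v0)
    (λ { (a ∷ x ∷ []) → transᵒ (Times-cong (refl= a) (axm (εr x)))
           (transᵒ (symᵒ (axm (εr _))) (∘-congʳ (symᵒ (axm (timesε a))))) })
    (λ { b y (a ∷ x ∷ []) p →
       Times a (x ∘ (y ∘ bit b))             ≐⟨ Times-cong (refl= a) (axm (assoc x y b)) ⟩
       Times a (x ∘ y ∘ bit b)               ≐⟨ Times-∘bit a (x ∘ y) b ⟩
       Times a (x ∘ y) ∘ a                   ≐⟨ ∘-congˡ p ⟩
       Times a x ∘ Times a y ∘ a             ≐⟨ symᵒ (∘-assoc _ _ _) ⟩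
       Times a x ∘ (Times a y ∘ a)           ≐⟨ ∘-congʳ (symᵒ (Times-∘bit a y b)) ⟩
       Times a x ∘ Times a (y ∘ bit b)       ∎ })
    y (a ∷ x ∷ [])

  Times-one : (a b : FTm n) → Γ ⊢ Times a (one b) ≐ Times a b
  Times-one a b = ind (fn times v1 (oneᴱ v0)) (fn times v1 v0)
    (λ { (a ∷ []) → Times-cong (refl= a) one-ε })
    (λ { c b (a ∷ []) p → transᵒ (Times-cong (refl= a) (one-∘bit b c))
           (transᵒ (Times-∘bit a (one b) b1) (transᵒ (∘-congˡ p) (symᵒ (Times-∘bit a b c)))) })
    b (a ∷ [])

  -- The factors grow one at a time, through `Times a' b`. The hypotheses concern lengths only, so
  -- each factor is made unary before its hypothesis is applied.
  Le-Times : {a a' b b' : FTm n} → Le Γ a a' → Le Γ b b' → Le Γ (Times a b) (Times a' b')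
  Le-Times {a = a} {a'} {b} {b'} (w , p) (v , q) = Le-trans
    (Times w b ,
      (one (Times a' b)                               ≐⟨ symᵒ (one-Times-one a' b) ⟩
       one (Times (one a') b)                         ≐⟨ one-cong (Times-cong p (refl= b)) ⟩
       one (Times (one a ∘ one w) b)                  ≐⟨ one-Times-∘ˡ (one a) (one w) b ⟩
       one (Times (one a) b) ∘ one (Times (one w) b)  ≐⟨ ∘-cong (one-Times-one a b) (one-Times-one w b) ⟩
       one (Times a b) ∘ one (Times w b)              ∎))
    (Times a' v ,
      transᵒ (one-cong
        (Times a' b'                             ≐⟨ symᵒ (Times-one a' b') ⟩
         Times a' (one b')                       ≐⟨ Times-cong (refl= a') q ⟩
         Times a' (one b ∘ one v)                ≐⟨ Times-∘ʳ a' (one b) (one v) ⟩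
         Times a' (one b) ∘ Times a' (one v)     ≐⟨ ∘-cong (Times-one a' b) (Times-one a' v) ⟩
         Times a' b ∘ Times a' v                 ∎))
      (one-∘ _ _))

  -- Search through the initial subwords of a string

  BooleanTerm : E k → Set
  BooleanTerm {k} f = ∀ {n} {Γ : List (Fm n)} (ρ : Env (ιs n) k) → Boolean Γ (⟦ f ⟧ ρ)

  Srch-ε : (f : E (suc k)) (ρ : Env (ιs n) k) → Γ ⊢ Srch f ρ `ε ≐ ⟦ f ⟧ (`ε ∷ ρ)
  Srch-ε f ρ = axm (recε _ _ _ _)

  Srch-∘bit-Trunc : (f : E (suc k)) (ρ : Env (ιs n) k) (y : FTm n) (b : Bit) →
                    Γ ⊢ Srch f ρ (y ∘ bit b) ≐ Trunc (or (Srch f ρ y) (⟦ f ⟧ (y ∘ bit b ∷ ρ))) `1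
  Srch-∘bit-Trunc f ρ y b = ax (por (trans≈ (rec-bit _ (srchStep f ρ) (lam `1) b y)
    (app≈ (app≈ (refl≈ `Trunc) (subst (_ ⊩ srchStep f ρ b · y · r ≈_) body-sub (β₂ _ y r)))
          (axiom (β `1 y)))))
    where
    r = Srch f ρ y
    body-sub : or r (sub (σ₀ r) (sub (extS (σ₀ y)) (⟦ f ⟧ (var (there here) ∘ bit b ∷ map wkT (map wkT ρ)))))
             ≡ or r (⟦ f ⟧ (y ∘ bit b ∷ ρ))
    body-sub = cong (or r)
      (trans (cong (sub (σ₀ r))
               (trans (⟦⟧-sub (extS (σ₀ y)) f _)
                 (cong₂ (λ c ρ' → ⟦ f ⟧ (wkT y ∘ c ∷ ρ')) (sub-bit (extS (σ₀ y)) b)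
                   (trans (sub-map-wk (σ₀ y) (map wkT ρ)) (cong (map wkT) (σ₀-map-wk y ρ))))))
      (trans (⟦⟧-sub (σ₀ r) f _)
        (trans (cong₂ (λ c ρ' → ⟦ f ⟧ (sub (σ₀ r) (wkT y) ∘ c ∷ ρ')) (sub-bit (σ₀ r) b) (σ₀-map-wk r ρ))
               (cong (λ z → ⟦ f ⟧ (z ∘ bit b ∷ ρ)) (sub-σ₀-wk r y)))))

  Trunc-boolean : {c : FTm n} → Boolean Γ c → Γ ⊢ Trunc c `1 ≐ c
  Trunc-boolean {c = c} bc = decide bc (is-bit b0) (is-bit b1)
    where
    is-bit : ∀ b → (c ≐ bit b) ∷ Γ ⊢ Trunc c `1 ≐ c
    is-bit b =
      Trunc c `1                     ≐⟨ Trunc-cong (transᵒ h₀ (bit≐ε∘bit b)) (bit≐ε∘bit b1) ⟩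
      Trunc (`ε ∘ bit b) (`ε ∘ `1)   ≐⟨ axm (truncB `ε `ε b b1) ⟩
      Trunc `ε `ε ∘ bit b            ≐⟨ ∘-congˡ (axm (truncε₁ `ε)) ⟩
      `ε ∘ bit b                     ≐⟨ transᵒ (axm (εl _)) (symᵒ h₀) ⟩
      c                              ∎

  -- Precedes the truncation-free equation `Srch-∘bit`, because truncation by `1` is idle only once
  -- the value is known to be a bit.
  Srch-boolean : (f : E (suc k)) → BooleanTerm f → (ρ : Env (ιs n) k) (y : FTm n) →
                 Boolean Γ (Srch f ρ y)
  Srch-boolean f bf ρ y = ind (cond S 1̂ 0̂ 1̂) S
    (λ ρ → boolean-resp (Srch-ε f ρ) (bf (`ε ∷ ρ)))
    (λ b y ρ p → let q = boolean-or p (bf (y ∘ bit b ∷ ρ)) in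
       boolean-resp (transᵒ (Srch-∘bit-Trunc f ρ y b) (Trunc-boolean q)) q)
    y ρ
    where S = srch (f ⟪ v0 ∷ ↑ ↑ idˢ ⟫) v0

  Srch-∘bit : (f : E (suc k)) → BooleanTerm f → (ρ : Env (ιs n) k) (y : FTm n) (b : Bit) →
              Γ ⊢ Srch f ρ (y ∘ bit b) ≐ or (Srch f ρ y) (⟦ f ⟧ (y ∘ bit b ∷ ρ))
  Srch-∘bit f bf ρ y b = transᵒ (Srch-∘bit-Trunc f ρ y b)
    (Trunc-boolean (boolean-or (Srch-boolean f bf ρ y) (bf (y ∘ bit b ∷ ρ))))

  Srch-intro : (f : E (suc k)) → BooleanTerm f → (ρ : Env (ιs n) k) (p y : FTm n) →
               Γ ⊢ Subw p y ≐ `1 → Γ ⊢ ⟦ f ⟧ (p ∷ ρ) ≐ `1 → Γ ⊢ Srch f ρ y ≐ `1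
  Srch-intro f bf ρ p y h g = guard-elim (guard-elim
    (ind (cond (fn subw v1 v0) ε̂ ε̂ (cond F ε̂ ε̂ S)) (cond (fn subw v1 v0) ε̂ ε̂ (cond F ε̂ ε̂ 1̂))
      (λ { (p ∷ ρ) → guard-intro (Subw-boolean _ _) (guard-intro (bf (p ∷ ρ))
             (transᵒ (Srch-ε f ρ) (transᵒ (cong₀ f ρ (symᵒ (Subw-ε⇒≐ε p (wk h₀)))) h₀))) })
      (λ { b y (p ∷ ρ) q → guard-intro (Subw-boolean _ _) (guard-intro (bf (p ∷ ρ))
             (transᵒ (Srch-∘bit f bf ρ y b) (Subw-∘bit-elim p y b (wk h₀)
               (or-introˡ (guard-elim (guard-elim (wk (wk (wk q))) h₀) (wk h₀)))
               (or-introʳ (Srch-boolean f bf ρ y)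
                 (transᵒ (cong₀ f ρ (symᵒ (Eq⇒≐ h₀))) (wk h₀)))))) })
      y (p ∷ ρ)) h) g
    where
    F = f ⟪ v1 ∷ ↑ ↑ idˢ ⟫
    S = srch (f ⟪ v0 ∷ ↑ ↑ ↑ idˢ ⟫) v0

  -- NP-induction on y with a genuine quantifier: some z no longer than y is, provided that the
  -- search on y succeeds, a prefix of y with f z = 1. The bound only limits the length, so the
  -- prefix relation is part of the matrix.
  Srch-elim : (f : E (suc k)) → BooleanTerm f → (ρ : Env (ιs n) k) (y : FTm n) {C : Fm n} →
              Γ ⊢ Srch f ρ y ≐ `1 →
              ((Subw (var here) (wkT y) ≐ `1) ∧' (⟦ f ⟧ (ext ρ) ≐ `1)) ∷ List.map wkF Γ ⊢ wkF C →
              Γ ⊢ C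
  Srch-elim {k = k} {Γ = Γ} f bf ρ y {C} h q = cut h (NP-elim v0 M M₁ (y ∷ ρ)
    (ind∃ v0 M M₁
      (λ ρ → NP-intro v0 M M₁ (`ε ∷ ρ) `ε one-ε⊑one-ε
        (guard-intro (Srch-boolean f bf ρ `ε)
          (and-intro (Subw-refl `ε) (transᵒ (symᵒ (Srch-ε f ρ)) h₀))))
      (λ b y z ρ bound m → step b y z ρ bound m)
      y ρ)
    (let t = guard-elim (∧E₂ h₀) wk-h in
     cut (∧I (and-elim₁ (Subw-boolean _ _) t) (and-elim₂ (Subw-boolean _ _) t))
         (weaken (∷⁺ʳ _ (λ i → there (there i))) q)))
    where
    S M M₁ : E (suc (suc k))
    S = srch (f ⟪ v0 ∷ ↑ ↑ ↑ idˢ ⟫) v1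
    M = cond S ε̂ ε̂ (cond (fn subw v0 v1) 0̂ 0̂ (f ⟪ v0 ∷ ↑ ↑ idˢ ⟫))
    M₁ = cond S ε̂ ε̂ 1̂

    wk-h : ∀ {A} → A ∷ List.map wkF ((Srch f ρ y ≐ `1) ∷ Γ) ⊢ Srch f (map wkT ρ) (wkT y) ≐ `1
    wk-h = conv (cong (_≐ `1) (sym (⟦⟧-wkF (srch (f ⟪ v0 ∷ ↑ ↑ idˢ ⟫) v0) (y ∷ ρ)))) (hyp (there (here refl)))

    step : ∀ {n} {Γ : List (Fm n)} b y z (ρ : Env (ιs n) k) → Γ ⊢ one z ⊑ one y →
           Γ ⊢ ⟦ M ⟧ (z ∷ y ∷ ρ) ≐ ⟦ M₁ ⟧ (z ∷ y ∷ ρ) → Γ ⊢ NP v0 M M₁ (y ∘ bit b ∷ ρ)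
    -- If the search on `y` fails, a success on `y ∘ bit b` is due to `y ∘ bit b` itself, which
    -- becomes the witness; otherwise the old witness stays.
    step b y z ρ bound m = decide (Srch-boolean f bf ρ y)
      (NP-intro v0 M M₁ (y ∘ bit b ∷ ρ) (y ∘ bit b) (Subw⇒⊑ (Subw-refl _))
        (guard-intro (Srch-boolean f bf ρ (y ∘ bit b))
          (and-intro (Subw-refl _)
            (transᵒ (symᵒ (if-0 (wk h₀))) (transᵒ (symᵒ (Srch-∘bit f bf ρ y b)) h₀)))))
      (NP-intro v0 M M₁ (y ∘ bit b ∷ ρ) z
        (Subw⇒⊑ (transᵒ (fn-cong subw (refl= _) (one-∘bit y b))
                        (Subw-step _ _ b1 (⊑⇒Subw (wk bound)))))
        (guard-intro (Srch-boolean f bf ρ (y ∘ bit b))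
          (let t = guard-elim (wk (wk m)) (wk h₀) in
           and-intro (Subw-step z y b (and-elim₁ (Subw-boolean z y) t))
                     (and-elim₂ (Subw-boolean z y) t))))

  -- Interpretation of RL-formulas

  embed : RL.Tm k → E k
  embed (RL.var i)   = var i
  embed RL.ε         = ε̂
  embed RL.𝟘         = 0̂
  embed RL.𝟙         = 1̂
  embed (t RL.⌢ u)   = embed t ∘̂ embed u
  embed (t RL.⊗ u)   = fn times (embed t) (embed u)

  -- The translation generalised to an environment of terms: substitution in RL and substitution in
  -- POR both become changes of the environment. At `idEnv` it is `trF`, by `fm-id`.
  fm : RL.Fm k → Env (ιs n) k → Fm n
  fm (RL.Flip t) ρ  = Flip (⟦ embed t ⟧ ρ)
  fm (t RL.≐ u) ρ   = ⟦ embed t ⟧ ρ ≐ ⟦ embed u ⟧ ρ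
  fm (t RL.⊑ u) ρ   = ⟦ embed t ⟧ ρ ⊑ ⟦ embed u ⟧ ρ
  fm (RL.¬' A) ρ    = POR.¬' (fm A ρ)
  fm (A RL.∧' B) ρ  = fm A ρ ∧' fm B ρ
  fm (A RL.∨' B) ρ  = fm A ρ ∨' fm B ρ
  fm (A RL.⇒ B) ρ   = fm A ρ ⊃ fm B ρ
  fm (RL.∃' A) ρ    = ∃' (fm A (ext ρ))
  fm (RL.∀' A) ρ    = ∀' (fm A (ext ρ))

  fm-sub : ∀ {n m} (σ : Sub (ιs n) (ιs m)) (A : RL.Fm k) (ρ : Env (ιs n) k) →
           subF σ (fm A ρ) ≡ fm A (map (sub σ) ρ)
  fm-sub σ (RL.Flip t) ρ = cong Flip (⟦⟧-sub σ (embed t) ρ)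
  fm-sub σ (t RL.≐ u) ρ  = cong₂ _≐_ (⟦⟧-sub σ (embed t) ρ) (⟦⟧-sub σ (embed u) ρ)
  fm-sub σ (t RL.⊑ u) ρ  = cong₂ _⊑_ (⟦⟧-sub σ (embed t) ρ) (⟦⟧-sub σ (embed u) ρ)
  fm-sub σ (RL.¬' A) ρ   = cong POR.¬' (fm-sub σ A ρ)
  fm-sub σ (A RL.∧' B) ρ = cong₂ _∧'_ (fm-sub σ A ρ) (fm-sub σ B ρ)
  fm-sub σ (A RL.∨' B) ρ = cong₂ _∨'_ (fm-sub σ A ρ) (fm-sub σ B ρ)
  fm-sub σ (A RL.⇒ B) ρ  = cong₂ _⊃_ (fm-sub σ A ρ) (fm-sub σ B ρ)
  fm-sub σ (RL.∃' A) ρ   = cong ∃' (trans (fm-sub (extS σ) A (ext ρ))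
                             (cong (λ ρ' → fm A (var here ∷ ρ')) (sub-map-wk σ ρ)))
  fm-sub σ (RL.∀' A) ρ   = cong ∀' (trans (fm-sub (extS σ) A (ext ρ))
                             (cong (λ ρ' → fm A (var here ∷ ρ')) (sub-map-wk σ ρ)))

  fm-wk : (A : RL.Fm k) (ρ : Env (ιs n) k) → wkF (fm A ρ) ≡ fm A (map wkT ρ)
  fm-wk A ρ = trans (fm-sub (λ x → var (there x)) A ρ) (cong (fm A) (map-wk≡sub ρ))

  fm-inst : (A : RL.Fm (suc k)) (t : FTm n) (ρ : Env (ιs n) k) →
            fm A (ext ρ) [ t ]₀ ≡ fm A (t ∷ ρ)
  fm-inst A t ρ = trans (fm-sub (σ₀ t) A (ext ρ)) (cong (λ ρ' → fm A (t ∷ ρ')) (σ₀-map-wk t ρ))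

  embed-ren : ∀ {Δ j} (r : Fin k → Fin j) (ρ : Env Δ j) (ρ' : Env Δ k) →
              (∀ i → lookup ρ (r i) ≡ lookup ρ' i) →
              ∀ t → ⟦ embed (RL.renT r t) ⟧ ρ ≡ ⟦ embed t ⟧ ρ'
  embed-ren r ρ ρ' h (RL.var i) = h i
  embed-ren r ρ ρ' h RL.ε       = refl
  embed-ren r ρ ρ' h RL.𝟘       = refl
  embed-ren r ρ ρ' h RL.𝟙       = refl
  embed-ren r ρ ρ' h (t RL.⌢ u) = cong₂ _∘_ (embed-ren r ρ ρ' h t) (embed-ren r ρ ρ' h u)
  embed-ren r ρ ρ' h (t RL.⊗ u) = cong₂ Times (embed-ren r ρ ρ' h t) (embed-ren r ρ ρ' h u)

  lookup-extR : ∀ {Δ j} (r : Fin k → Fin j) (ρ : Env Δ j) (ρ' : Env Δ k) →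
                (∀ i → lookup ρ (r i) ≡ lookup ρ' i) →
                ∀ i → lookup (ext ρ) (RL.extR r i) ≡ lookup (ext ρ') i
  lookup-extR r ρ ρ' h zero    = refl
  lookup-extR r ρ ρ' h (suc i) =
    trans (lookup-map (r i) wkT ρ) (trans (cong wkT (h i)) (sym (lookup-map i wkT ρ')))

  fm-ren : ∀ {j} (r : Fin k → Fin j) (ρ : Env (ιs n) j) (ρ' : Env (ιs n) k) →
           (∀ i → lookup ρ (r i) ≡ lookup ρ' i) →
           ∀ A → fm (RL.renF r A) ρ ≡ fm A ρ'
  fm-ren r ρ ρ' h (RL.Flip t) = cong Flip (embed-ren r ρ ρ' h t)
  fm-ren r ρ ρ' h (t RL.≐ u)  = cong₂ _≐_ (embed-ren r ρ ρ' h t) (embed-ren r ρ ρ' h u)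
  fm-ren r ρ ρ' h (t RL.⊑ u)  = cong₂ _⊑_ (embed-ren r ρ ρ' h t) (embed-ren r ρ ρ' h u)
  fm-ren r ρ ρ' h (RL.¬' A)   = cong POR.¬' (fm-ren r ρ ρ' h A)
  fm-ren r ρ ρ' h (A RL.∧' B) = cong₂ _∧'_ (fm-ren r ρ ρ' h A) (fm-ren r ρ ρ' h B)
  fm-ren r ρ ρ' h (A RL.∨' B) = cong₂ _∨'_ (fm-ren r ρ ρ' h A) (fm-ren r ρ ρ' h B)
  fm-ren r ρ ρ' h (A RL.⇒ B)  = cong₂ _⊃_ (fm-ren r ρ ρ' h A) (fm-ren r ρ ρ' h B)
  fm-ren r ρ ρ' h (RL.∃' A)   =
    cong ∃' (fm-ren (RL.extR r) (ext ρ) (ext ρ') (lookup-extR r ρ ρ' h) A)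
  fm-ren r ρ ρ' h (RL.∀' A)   =
    cong ∀' (fm-ren (RL.extR r) (ext ρ) (ext ρ') (lookup-extR r ρ ρ' h) A)

  embed-wk : ∀ {Δ} (x : POR.Tm Δ ι) (ρ : Env Δ k) t → ⟦ embed (RL.wkT t) ⟧ (x ∷ ρ) ≡ ⟦ embed t ⟧ ρ
  embed-wk x ρ = embed-ren suc (x ∷ ρ) ρ (λ _ → refl)

  fm-RLwk : (x : FTm n) (ρ : Env (ιs n) k) → ∀ A → fm (RL.wkF A) (x ∷ ρ) ≡ fm A ρ
  fm-RLwk x ρ = fm-ren suc (x ∷ ρ) ρ (λ _ → refl)

  embed-sub : ∀ {Δ j} (τ : Fin k → RL.Tm j) (ρ : Env Δ j) (ρ' : Env Δ k) →
              (∀ i → ⟦ embed (τ i) ⟧ ρ ≡ lookup ρ' i) →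
              ∀ t → ⟦ embed (RL.subT τ t) ⟧ ρ ≡ ⟦ embed t ⟧ ρ'
  embed-sub τ ρ ρ' h (RL.var i) = h i
  embed-sub τ ρ ρ' h RL.ε       = refl
  embed-sub τ ρ ρ' h RL.𝟘       = refl
  embed-sub τ ρ ρ' h RL.𝟙       = refl
  embed-sub τ ρ ρ' h (t RL.⌢ u) = cong₂ _∘_ (embed-sub τ ρ ρ' h t) (embed-sub τ ρ ρ' h u)
  embed-sub τ ρ ρ' h (t RL.⊗ u) = cong₂ Times (embed-sub τ ρ ρ' h t) (embed-sub τ ρ ρ' h u)

  lookup-extS : ∀ {Δ j} (τ : Fin k → RL.Tm j) (ρ : Env Δ j) (ρ' : Env Δ k) →
                (∀ i → ⟦ embed (τ i) ⟧ ρ ≡ lookup ρ' i) →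
                ∀ i → ⟦ embed (RL.extS τ i) ⟧ (ext ρ) ≡ lookup (ext ρ') i
  lookup-extS τ ρ ρ' h zero    = refl
  lookup-extS τ ρ ρ' h (suc i) =
    trans (embed-wk (var here) (map wkT ρ) (τ i))
    (trans (sym (⟦⟧-wk (embed (τ i)) ρ)) (trans (cong wkT (h i)) (sym (lookup-map i wkT ρ'))))

  fm-RLsub : ∀ {j} (τ : Fin k → RL.Tm j) (ρ : Env (ιs n) j) (ρ' : Env (ιs n) k) →
             (∀ i → ⟦ embed (τ i) ⟧ ρ ≡ lookup ρ' i) →
             ∀ A → fm (RL.subF τ A) ρ ≡ fm A ρ'
  fm-RLsub τ ρ ρ' h (RL.Flip t) = cong Flip (embed-sub τ ρ ρ' h t)
  fm-RLsub τ ρ ρ' h (t RL.≐ u)  = cong₂ _≐_ (embed-sub τ ρ ρ' h t) (embed-sub τ ρ ρ' h u)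
  fm-RLsub τ ρ ρ' h (t RL.⊑ u)  = cong₂ _⊑_ (embed-sub τ ρ ρ' h t) (embed-sub τ ρ ρ' h u)
  fm-RLsub τ ρ ρ' h (RL.¬' A)   = cong POR.¬' (fm-RLsub τ ρ ρ' h A)
  fm-RLsub τ ρ ρ' h (A RL.∧' B) = cong₂ _∧'_ (fm-RLsub τ ρ ρ' h A) (fm-RLsub τ ρ ρ' h B)
  fm-RLsub τ ρ ρ' h (A RL.∨' B) = cong₂ _∨'_ (fm-RLsub τ ρ ρ' h A) (fm-RLsub τ ρ ρ' h B)
  fm-RLsub τ ρ ρ' h (A RL.⇒ B)  = cong₂ _⊃_ (fm-RLsub τ ρ ρ' h A) (fm-RLsub τ ρ ρ' h B)
  fm-RLsub τ ρ ρ' h (RL.∃' A)   =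
    cong ∃' (fm-RLsub (RL.extS τ) (ext ρ) (ext ρ') (lookup-extS τ ρ ρ' h) A)
  fm-RLsub τ ρ ρ' h (RL.∀' A)   =
    cong ∀' (fm-RLsub (RL.extS τ) (ext ρ) (ext ρ') (lookup-extS τ ρ ρ' h) A)

  lookup-σ₀ : ∀ {Δ} (t : RL.Tm k) (ρ : Env Δ k) i →
              ⟦ embed (RL.σ₀ t i) ⟧ ρ ≡ lookup (⟦ embed t ⟧ ρ ∷ ρ) i
  lookup-σ₀ t ρ zero    = refl
  lookup-σ₀ t ρ (suc i) = refl

  embed-RLinst : ∀ {Δ} (s : RL.Tm (suc k)) (t : RL.Tm k) (ρ : Env Δ k) →
                 ⟦ embed (RL.subT (RL.σ₀ t) s) ⟧ ρ ≡ ⟦ embed s ⟧ (⟦ embed t ⟧ ρ ∷ ρ)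
  embed-RLinst s t ρ = embed-sub (RL.σ₀ t) ρ (⟦ embed t ⟧ ρ ∷ ρ) (lookup-σ₀ t ρ) s

  fm-RLinst : (A : RL.Fm (suc k)) (t : RL.Tm k) (ρ : Env (ιs n) k) →
              fm (A RL.[ t ]₀) ρ ≡ fm A (⟦ embed t ⟧ ρ ∷ ρ)
  fm-RLinst A t ρ = fm-RLsub (RL.σ₀ t) ρ (⟦ embed t ⟧ ρ ∷ ρ) (lookup-σ₀ t ρ) A

  fm-∃I : (A : RL.Fm (suc k)) (ρ : Env (ιs n) k) (t : FTm n) →
          Γ ⊢ fm A (t ∷ ρ) → Γ ⊢ fm (RL.∃' A) ρ
  fm-∃I A ρ t p = ∃I t (conv (sym (fm-inst A t ρ)) p)

  fm-∀E : (A : RL.Fm (suc k)) (ρ : Env (ιs n) k) → Γ ⊢ fm (RL.∀' A) ρ → (t : FTm n) →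
          Γ ⊢ fm A (t ∷ ρ)
  fm-∀E A ρ p t = conv (fm-inst A t ρ) (∀E p t)

  -- Characteristic terms of Σb0-formulas

  negᴱ : E k → E k
  negᴱ c = cond c 1̂ 1̂ 0̂

  andᴱ : E k → E k → E k
  andᴱ c d = cond c 0̂ 0̂ d

  -- split f, at a string y, asks whether f w x = 1 for some decomposition of y into w and x.
  split : E (suc (suc k)) → E (suc k)
  split f = srch (f ⟪ drop v1 v0 ∷ trunc v1 v0 ∷ ↑ ↑ idˢ ⟫) (oneᴱ v0)

  boolean-neg : (f : E k) → BooleanTerm f → BooleanTerm (negᴱ f)
  boolean-neg f bf ρ = boolean-if (bf ρ) (boolean-1 (refl= _)) (boolean-0 (refl= _))

  boolean-split : (f : E (suc (suc k))) → BooleanTerm f → BooleanTerm (split f)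
  boolean-split f bf (y ∷ ρ) =
    Srch-boolean (f ⟪ drop v1 v0 ∷ trunc v1 v0 ∷ ↑ ↑ idˢ ⟫) (λ ρ' → bf _) (y ∷ ρ) (one y)

  split-intro : (f : E (suc (suc k))) → BooleanTerm f → (ρ : Env (ιs n) k) (w x : FTm n) →
                Γ ⊢ ⟦ f ⟧ (w ∷ x ∷ ρ) ≐ `1 → Γ ⊢ ⟦ split f ⟧ (w ∘ x ∷ ρ) ≐ `1
  split-intro f bf ρ w x p =
    Srch-intro (f ⟪ drop v1 v0 ∷ trunc v1 v0 ∷ ↑ ↑ idˢ ⟫) (λ ρ' → bf _) (w ∘ x ∷ ρ)
      -- The cut is the length of the second half; commuting the sum shows it to be a prefix of the
      -- unary length of the whole.
      (one x) (one (w ∘ x))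
      (transᵒ (fn-cong subw (refl= _) (transᵒ (one-∘ w x) (one-comm w x))) (Subw-prefix (one x) (one w)))
      (transᵒ (congs f ρ (Drop-∘-one w x) (Trunc-∘-one w x)) p)

  -- Nothing is claimed about the two parts composing to `y`; whatever must be known of them has to
  -- be tested by `f`. Hence `subwordBody` and `pairMatrix` contain their side conditions.
  split-elim : (f : E (suc (suc k))) → BooleanTerm f → (ρ : Env (ιs n) k) (y : FTm n) {C : Fm n} →
               Γ ⊢ ⟦ split f ⟧ (y ∷ ρ) ≐ `1 →
               (⟦ f ⟧ (Drop (wkT y) (var here) ∷ Trunc (wkT y) (var here) ∷ map wkT ρ) ≐ `1)
                 ∷ List.map wkF Γ ⊢ wkF C →
               Γ ⊢ C
  split-elim f bf ρ y p q =
    Srch-elim (f ⟪ drop v1 v0 ∷ trunc v1 v0 ∷ ↑ ↑ idˢ ⟫) (λ ρ' → bf _) (y ∷ ρ) (one y) p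
      (cut (∧E₂ h₀) (weaken (∷⁺ʳ _ there) q))

  subwordBody : E k → E (suc k) → E (suc (suc k))
  subwordBody t f = andᴱ (fn subw v0 (t ⟪ ↑ ↑ idˢ ⟫))
                   (andᴱ (fn subw (v0 ∘̂ v1) (t ⟪ ↑ ↑ idˢ ⟫)) (f ⟪ v1 ∷ ↑ ↑ idˢ ⟫))

  -- The outer search runs over the prefix w x of `t`, the inner one over the place where w ends.
  existsSubword : E k → E (suc k) → E k
  existsSubword t f = srch (split (subwordBody t f)) t

  boolean-subwordBody : (t : E k) (f : E (suc k)) → BooleanTerm f → BooleanTerm (subwordBody t f)
  boolean-subwordBody t f bf ρ = boolean-if (Subw-boolean _ _) (boolean-0 (refl= _))
    (boolean-if (Subw-boolean _ _) (boolean-0 (refl= _)) (bf _))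

  boolean-existsSubword : (t : E k) (f : E (suc k)) → BooleanTerm f → BooleanTerm (existsSubword t f)
  boolean-existsSubword t f bf ρ = Srch-boolean (split (subwordBody t f))
    (boolean-split (subwordBody t f) (boolean-subwordBody t f bf)) ρ (⟦ t ⟧ ρ)

  existsSubword-intro : (t : E k) (f : E (suc k)) → BooleanTerm f → (ρ : Env (ιs n) k) (w x : FTm n) →
                        Γ ⊢ Subw w (⟦ t ⟧ ρ) ≐ `1 → Γ ⊢ Subw (w ∘ x) (⟦ t ⟧ ρ) ≐ `1 →
                        Γ ⊢ ⟦ f ⟧ (x ∷ ρ) ≐ `1 → Γ ⊢ ⟦ existsSubword t f ⟧ ρ ≐ `1
  existsSubword-intro t f bf ρ w x p q r =
    Srch-intro (split g) (boolean-split g bg) ρ (w ∘ x) (⟦ t ⟧ ρ) q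
      (split-intro g bg ρ w x (and-intro p (and-intro q r)))
    where
    g = subwordBody t f
    bg = boolean-subwordBody t f bf

  -- The continuation lives two variables deeper, one for the prefix and one for the cut; `Γ'`
  -- leaves room for the hypotheses that come with them.
  existsSubword-elim : (t : E k) (f : E (suc k)) → BooleanTerm f → (ρ : Env (ιs n) k) {C : Fm n} →
    Γ ⊢ ⟦ existsSubword t f ⟧ ρ ≐ `1 →
    (∀ {Γ'} → List.map wkF (List.map wkF Γ) ⊆ Γ' → ∀ w x →
      Γ' ⊢ Subw w (⟦ t ⟧ (map wkT (map wkT ρ))) ≐ `1 →
      Γ' ⊢ Subw (w ∘ x) (⟦ t ⟧ (map wkT (map wkT ρ))) ≐ `1 →
      Γ' ⊢ ⟦ f ⟧ (x ∷ map wkT (map wkT ρ)) ≐ `1 → Γ' ⊢ wkF (wkF C)) →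
    Γ ⊢ C
  existsSubword-elim t f bf ρ p q =
    Srch-elim (split g) (boolean-split g bg) ρ (⟦ t ⟧ ρ) p
      (split-elim g bg (map wkT ρ) (var here) (∧E₂ h₀)
        (q (λ i → there (there i)) _ _ (and-elim₁ (Subw-boolean _ _) h₀)
          (and-elim₁ (Subw-boolean _ _) (and-elim₂ (Subw-boolean _ _) h₀))
          (and-elim₂ (Subw-boolean _ _) (and-elim₂ (Subw-boolean _ _) h₀))))
    where
    g = subwordBody t f
    bg = boolean-subwordBody t f bf

  -- The universal quantifier is coded as the failure of a search for a counterexample, which is
  -- intuitionistically faithful because the body has bit values.
  χ : {A : RL.Fm k} → RL.Σb0 A → E k
  χ (RL.flip t)   = fn eq (flipc (embed t)) 1̂
  χ (RL.eq t u)   = fn eq (embed t) (embed u)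
  χ (RL.sub t u)  = fn subw (embed t) (embed u)
  χ (RL.neg a)    = negᴱ (χ a)
  χ (RL.and a b)  = andᴱ (χ a) (χ b)
  χ (RL.or a b)   = cond (χ a) (χ b) (χ b) 1̂
  χ (RL.imp a b)  = cond (χ a) 1̂ 1̂ (χ b)
  χ (RL.ex⊆ t a)  = existsSubword (embed t) (χ a)
  χ (RL.all⊆ t a) = negᴱ (existsSubword (embed t) (negᴱ (χ a)))

  χ-boolean : {A : RL.Fm k} (a : RL.Σb0 A) → BooleanTerm (χ a)
  χ-boolean (RL.flip t) ρ   = Eq-boolean _ _
  χ-boolean (RL.eq t u) ρ   = Eq-boolean _ _
  χ-boolean (RL.sub t u) ρ  = Subw-boolean _ _
  χ-boolean (RL.neg a)      = boolean-neg (χ a) (χ-boolean a)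
  χ-boolean (RL.and a b) ρ  = boolean-if (χ-boolean a ρ) (boolean-0 (refl= _)) (χ-boolean b ρ)
  χ-boolean (RL.or a b) ρ   = boolean-or (χ-boolean a ρ) (χ-boolean b ρ)
  χ-boolean (RL.imp a b) ρ  = boolean-if (χ-boolean a ρ) (boolean-1 (refl= _)) (χ-boolean b ρ)
  χ-boolean (RL.ex⊆ t a)    = boolean-existsSubword (embed t) (χ a) (χ-boolean a)
  χ-boolean (RL.all⊆ t a)   = boolean-neg (existsSubword (embed t) (negᴱ (χ a)))
    (boolean-existsSubword (embed t) (negᴱ (χ a)) (boolean-neg (χ a) (χ-boolean a)))

  neg≢ : {c : FTm n} → Γ ⊢ Cond c `1 `1 `0 ≐ `1 → Γ ⊢ c ≐ `1 → Γ ⊢ `0 ≐ `1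
  neg≢ p q = transᵒ (symᵒ (if-1 q)) p

  eqn-wk : (e f : E k) (ρ : Env (ιs n) k) →
           wkF (⟦ e ⟧ ρ ≐ ⟦ f ⟧ ρ) ≡ (⟦ e ⟧ (map wkT ρ) ≐ ⟦ f ⟧ (map wkT ρ))
  eqn-wk e f ρ = cong₂ _≐_ (sym (⟦⟧-wkF e ρ)) (sym (⟦⟧-wkF f ρ))

  wk² : Env (ιs n) k → Env (ιs (suc (suc n))) k
  wk² ρ = map wkT (map wkT ρ)

  eqn-wk² : (e f : E k) (ρ : Env (ιs n) k) →
            wkF (wkF (⟦ e ⟧ ρ ≐ ⟦ f ⟧ ρ)) ≡ (⟦ e ⟧ (wk² ρ) ≐ ⟦ f ⟧ (wk² ρ))
  eqn-wk² e f ρ = trans (cong wkF (eqn-wk e f ρ)) (eqn-wk e f (map wkT ρ))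

  fm-wk² : (A : RL.Fm k) (ρ : Env (ιs n) k) → wkF (wkF (fm A ρ)) ≡ fm A (wk² ρ)
  fm-wk² A ρ = trans (cong wkF (fm-wk A ρ)) (fm-wk A (map wkT ρ))

  embed-wk² : ∀ {Δ} (x y : POR.Tm Δ ι) (ρ : Env Δ k) t →
              ⟦ embed (RL.wkT (RL.wkT t)) ⟧ (x ∷ y ∷ ρ) ≡ ⟦ embed t ⟧ ρ
  embed-wk² x y ρ t = trans (embed-wk x (y ∷ ρ) (RL.wkT t)) (embed-wk y ρ t)

  wkT² : RL.Tm k → RL.Tm (suc (suc k))
  wkT² t = RL.wkT (RL.wkT t)

  subwordOf : RL.Tm k → RL.Fm (suc (suc k))
  subwordOf t = (RL.var zero RL.⊑ wkT² t)
                RL.∧' ((RL.var zero RL.⌢ RL.var (suc zero)) RL.⊑ wkT² t)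

  subwordOf-intro : (t : RL.Tm k) (ρ : Env (ιs n) k) (w x : FTm n) →
                    Γ ⊢ Subw w (⟦ embed t ⟧ ρ) ≐ `1 → Γ ⊢ Subw (w ∘ x) (⟦ embed t ⟧ ρ) ≐ `1 →
                    Γ ⊢ fm (subwordOf t) (w ∷ x ∷ ρ)
  subwordOf-intro t ρ w x p q = conv
    (cong (λ u → (w ⊑ u) ∧' (w ∘ x ⊑ u)) (sym (embed-wk² w x ρ t))) (∧I (Subw⇒⊑ p) (Subw⇒⊑ q))

  mutual
    -- Mutual with `χ-sound`, since negation and implication put a subformula in negative position.
    -- Deciding the bit `χ a` takes the place of excluded middle.
    χ-complete : {A : RL.Fm k} (a : RL.Σb0 A) (ρ : Env (ιs n) k) → Γ ⊢ fm A ρ → Γ ⊢ ⟦ χ a ⟧ ρ ≐ `1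
    χ-complete (RL.flip t) ρ p  = ≐⇒Eq (⊃E (∧E₁ (ax (flipDef _))) p)
    χ-complete (RL.eq t u) ρ p  = ≐⇒Eq p
    χ-complete (RL.sub t u) ρ p = ⊑⇒Subw p
    χ-complete (RL.neg a) ρ p   = decide (χ-boolean a ρ) (if-0 h₀)
      (absurd (⊃E (wk p) (χ-sound a ρ h₀)))
    χ-complete (RL.and a b) ρ p = and-intro (χ-complete a ρ (∧E₁ p)) (χ-complete b ρ (∧E₂ p))
    χ-complete (RL.or a b) ρ p  = ∨E p (or-introˡ (χ-complete a ρ h₀))
      (or-introʳ (χ-boolean a ρ) (χ-complete b ρ h₀))
    χ-complete (RL.imp a b) ρ p = decide (χ-boolean a ρ) (if-0 h₀)
      (transᵒ (if-1 h₀) (χ-complete b ρ (⊃E (wk p) (χ-sound a ρ h₀))))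
    χ-complete {A = A} (RL.ex⊆ t {F} a) ρ p = ∃E p (conv (sym (eqn-wk c 1̂ ρ))
      (∃E h₀ (conv (sym (eqn-wk c 1̂ (map wkT ρ)))
        (existsSubword-intro (embed t) (χ a) (χ-boolean a) (wk² ρ) w x
          (⊑⇒Subw (conv (cong (w ⊑_) t-wk) (∧E₁ h₀)))
          (⊑⇒Subw (conv (cong (w ∘ x ⊑_) t-wk) (∧E₁ (∧E₂ h₀))))
          (χ-complete a (x ∷ wk² ρ) (conv (fm-RLwk w (x ∷ wk² ρ) F) (∧E₂ (∧E₂ h₀))))))))
      where
      c = χ (RL.ex⊆ t a)
      w = var here
      x = var (there here)
      t-wk : ⟦ embed (wkT² t) ⟧ (w ∷ x ∷ wk² ρ) ≡ ⟦ embed t ⟧ (wk² ρ)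
      t-wk = embed-wk² w x (wk² ρ) t
    χ-complete {Γ = Γ} {A = A} (RL.all⊆ t {F} a) ρ p =
      decide (boolean-existsSubword (embed t) (negᴱ (χ a)) bn ρ) (if-0 h₀)
        (absurd (cut (wk p) (existsSubword-elim (embed t) (negᴱ (χ a)) bn ρ (wk h₀)
          (λ s w x q r v → neg≢ v (χ-complete a (x ∷ wk² ρ)
            (⊃E (fm-∀E (RL.∃' (subwordOf t) RL.⇒ F) (wk² ρ)
                  (conv (fm-wk² A ρ) (hyp (s (here refl)))) x)
                (fm-∃I (subwordOf t) (x ∷ wk² ρ) w (subwordOf-intro t (wk² ρ) w x q r))))))))
      where
      bn = boolean-neg (χ a) (χ-boolean a)

    χ-sound : {A : RL.Fm k} (a : RL.Σb0 A) (ρ : Env (ιs n) k) → Γ ⊢ ⟦ χ a ⟧ ρ ≐ `1 → Γ ⊢ fm A ρ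
    χ-sound (RL.flip t) ρ p  = ⊃E (∧E₂ (ax (flipDef _))) (Eq⇒≐ p)
    χ-sound (RL.eq t u) ρ p  = Eq⇒≐ p
    χ-sound (RL.sub t u) ρ p = Subw⇒⊑ p
    χ-sound (RL.neg a) ρ p   = ⊃I (neg≢ (wk p) (χ-complete a ρ h₀))
    χ-sound (RL.and a b) ρ p = ∧I (χ-sound a ρ (and-elim₁ (χ-boolean a ρ) p))
                                  (χ-sound b ρ (and-elim₂ (χ-boolean a ρ) p))
    χ-sound (RL.or a b) ρ p  = or-elim (χ-boolean a ρ) p (∨I₁ (χ-sound a ρ h₀)) (∨I₂ (χ-sound b ρ h₀))
    χ-sound (RL.imp a b) ρ p = ⊃I (χ-sound b ρ
      (transᵒ (symᵒ (if-1 (χ-complete a ρ h₀))) (wk p)))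
    χ-sound {A = A} (RL.ex⊆ t {F} a) ρ p =
      existsSubword-elim (embed t) (χ a) (χ-boolean a) ρ p
        (λ s w x q r v → conv (sym (fm-wk² A ρ))
          (fm-∃I (RL.∃' body) (wk² ρ) x (fm-∃I body (x ∷ wk² ρ) w
            (let o = subwordOf-intro t (wk² ρ) w x q r in
             ∧I (∧E₁ o) (∧I (∧E₂ o)
               (conv (sym (fm-RLwk w (x ∷ wk² ρ) F)) (χ-sound a (x ∷ wk² ρ) v)))))))
      where
      body = (RL.var zero RL.⊑ wkT² t)
             RL.∧' ((RL.var zero RL.⌢ RL.var (suc zero)) RL.⊑ wkT² t) RL.∧' RL.wk1F F
    χ-sound {Γ = Γ} (RL.all⊆ t {F} a) ρ p = cut p (∀I (⊃I (∃E h₀ (conv (sym (fm-wk F (ext ρ)))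
      -- If the body had value `0` at this x, the search for counterexamples would have found it.
      (decide (χ-boolean a (x ∷ wk² ρ))
        (absurd (neg≢ (conv (eqn-wk² c 1̂ ρ) (hyp (there (there (there (here refl))))))
          (existsSubword-intro (embed t) (negᴱ (χ a)) (boolean-neg (χ a) (χ-boolean a)) (wk² ρ) w x
            (⊑⇒Subw (conv (cong (w ⊑_) t-wk) (∧E₁ (wk h₀))))
            (⊑⇒Subw (conv (cong (w ∘ x ⊑_) t-wk) (∧E₂ (wk h₀))))
            (if-0 h₀))))
        (χ-sound a (x ∷ wk² ρ) h₀))))))
      where
      c = χ (RL.all⊆ t a)
      w = var here
      x = var (there here)
      t-wk : ⟦ embed (wkT² t) ⟧ (w ∷ x ∷ wk² ρ) ≡ ⟦ embed t ⟧ (wk² ρ)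
      t-wk = embed-wk² w x (wk² ρ) t

  -- Σb1-formulas and soundness

  embed-mono : (t : RL.Tm k) {ρ ρ' : Env (ιs n) k} → (∀ i → Le Γ (lookup ρ i) (lookup ρ' i)) →
               Le Γ (⟦ embed t ⟧ ρ) (⟦ embed t ⟧ ρ')
  embed-mono (RL.var i) h = h i
  embed-mono RL.ε h       = Le-refl `ε
  embed-mono RL.𝟘 h       = Le-refl `0
  embed-mono RL.𝟙 h       = Le-refl `1
  embed-mono (t RL.⌢ u) h = Le-∘ (embed-mono t h) (embed-mono u h)
  embed-mono (t RL.⊗ u) h = Le-Times (embed-mono t h) (embed-mono u h)

  -- Kept among the RL-terms, for which `embed-mono` holds; terms with `Cond` need not be monotone.
  -- A Σb0-formula receives a vacuous quantifier, bounded by `ε`.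
  bound : {A : RL.Fm k} → RL.Σb1 A → RL.Tm k
  bound (RL.base a)  = RL.ε
  bound (RL.ex⪯ t d) = t RL.⌢ RL.subT (RL.σ₀ t) (bound d)

  -- Two witnesses x and z are merged into x ∘ z; the splitting point is found by search.
  mutual
    matrix : {A : RL.Fm k} → RL.Σb1 A → E (suc k)
    matrix (RL.base a)  = χ a ⟪ ↑ idˢ ⟫
    matrix (RL.ex⪯ t d) = split (pairMatrix t d)

    -- The bound on the merged witness does not return the bounds on its parts, so both are tested
    -- here, the second one at the actual value of x.
    pairMatrix : RL.Tm k → {A : RL.Fm (suc k)} → RL.Σb1 A → E (suc (suc k))
    pairMatrix t d = andᴱ (fn subw (oneᴱ v0) (oneᴱ (embed t ⟪ ↑ ↑ idˢ ⟫)))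
      (andᴱ (fn subw (oneᴱ v1) (oneᴱ (embed (bound d) ⟪ v0 ∷ ↑ ↑ idˢ ⟫)))
            (matrix d ⟪ v1 ∷ v0 ∷ ↑ ↑ idˢ ⟫))

  mutual
    matrix-boolean : {A : RL.Fm k} (d : RL.Σb1 A) → BooleanTerm (matrix d)
    matrix-boolean (RL.base a) (_ ∷ ρ) = χ-boolean a ρ
    matrix-boolean (RL.ex⪯ t d)        = boolean-split (pairMatrix t d) (pairMatrix-boolean t d)

    pairMatrix-boolean : (t : RL.Tm k) {A : RL.Fm (suc k)} (d : RL.Σb1 A) →
                         BooleanTerm (pairMatrix t d)
    pairMatrix-boolean t d (x ∷ z ∷ ρ) = boolean-if (Subw-boolean _ _) (boolean-0 (refl= _))
      (boolean-if (Subw-boolean _ _) (boolean-0 (refl= _)) (matrix-boolean d (z ∷ x ∷ ρ)))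

  Normal : {A : RL.Fm k} → RL.Σb1 A → Env (ιs n) k → Fm n
  Normal d = NP (embed (bound d)) (matrix d) 1̂

  boundedBy : RL.Tm k → RL.Fm (suc k)
  boundedBy t = RL.one^ (RL.var zero) RL.⊑ RL.one^ (RL.wkT t)

  boundedBy-inst : (t : RL.Tm k) (x : FTm n) (ρ : Env (ιs n) k) →
                   fm (boundedBy t) (x ∷ ρ) ≡ (one x ⊑ one (⟦ embed t ⟧ ρ))
  boundedBy-inst t x ρ = cong (λ u → one x ⊑ one u) (embed-wk x ρ t)

  Σb1⇒Normal : {A : RL.Fm k} (d : RL.Σb1 A) (ρ : Env (ιs n) k) → Γ ⊢ fm A ρ → Γ ⊢ Normal d ρ
  Σb1⇒Normal (RL.base a) ρ p =
    NP-intro ε̂ (χ a ⟪ ↑ idˢ ⟫) 1̂ ρ `ε one-ε⊑one-ε (χ-complete a ρ p)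
  Σb1⇒Normal {n = n} {Γ = Γ} (RL.ex⪯ t {F} d) ρ p = ∃E p (conv (sym (NP-wk s m 1̂ ρ))
    (NP-elim (embed (bound d)) (matrix d) 1̂ (ext ρ) (Σb1⇒Normal d (ext ρ) (∧E₂ h₀))
      (conv (sym (NP-wk s m 1̂ (map wkT ρ)))
        (NP-intro s m 1̂ (wk² ρ) (x ∘ z)
          (Le⇒⊑ (Le-∘ (⊑⇒Le x-bound) (subst (Le Γ₂ z) (sym (embed-RLinst (bound d) t (wk² ρ)))
            -- The bound on z is stated at x; since x is no longer than t, it is at most the same
            -- bound at t, in which x does not occur.
            (Le-trans (⊑⇒Le (∧E₁ h₀)) (embed-mono (bound d)
              (λ { zero → ⊑⇒Le x-bound ; (suc i) → Le-refl _ }))))))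
          (split-intro (pairMatrix t d) (pairMatrix-boolean t d) (wk² ρ) x z
            (and-intro (⊑⇒Subw x-bound) (and-intro (⊑⇒Subw (∧E₁ h₀)) (∧E₂ h₀))))))))
    where
    s = embed (bound (RL.ex⪯ t d))
    m = matrix (RL.ex⪯ t d)
    z x : FTm (suc (suc n))
    z = var here
    x = var (there here)
    Γ₂ : List (Fm (suc (suc n)))
    Γ₂ = ((one z ⊑ one (⟦ embed (bound d) ⟧ (x ∷ wk² ρ))) ∧' (⟦ matrix d ⟧ (z ∷ x ∷ wk² ρ) ≐ `1))
         ∷ List.map wkF ((fm (boundedBy t) (ext ρ) ∧' fm F (ext ρ)) ∷ List.map wkF Γ)
    x-bound : Γ₂ ⊢ one x ⊑ one (⟦ embed t ⟧ (wk² ρ))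
    x-bound = conv (trans (fm-wk (boundedBy t) (ext ρ)) (boundedBy-inst t x (wk² ρ)))
                   (∧E₁ (hyp (there (here refl))))

  Normal⇒Σb1 : {A : RL.Fm k} (d : RL.Σb1 A) (ρ : Env (ιs n) k) → Γ ⊢ Normal d ρ → Γ ⊢ fm A ρ
  Normal⇒Σb1 {A = A} (RL.base a) ρ p = NP-elim ε̂ (χ a ⟪ ↑ idˢ ⟫) 1̂ ρ p
    (conv (sym (fm-wk A ρ)) (χ-sound a (map wkT ρ) (∧E₂ h₀)))
  Normal⇒Σb1 {A = A} (RL.ex⪯ t {F} d) ρ p =
    NP-elim (embed (bound (RL.ex⪯ t d))) (matrix (RL.ex⪯ t d)) 1̂ ρ p
      (split-elim (pairMatrix t d) (pairMatrix-boolean t d) (map wkT ρ) (var here) (∧E₂ h₀)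
        (conv (sym (fm-wk² A ρ)) (fm-∃I (boundedBy t RL.∧' F) (wk² ρ) _
          (let q = and-elim₂ (Subw-boolean _ _) h₀ in
           ∧I (conv (sym (boundedBy-inst t _ (wk² ρ))) (Subw⇒⊑ (and-elim₁ (Subw-boolean _ _) h₀)))
              (Normal⇒Σb1 d (_ ∷ wk² ρ) (NP-intro (embed (bound d)) (matrix d) 1̂ (_ ∷ wk² ρ) _
                (Subw⇒⊑ (and-elim₁ (Subw-boolean _ _) q)) (and-elim₂ (Subw-boolean _ _) q)))))))

  -- The axioms of IRS

  ⊑-∘bit : (x y : FTm n) (b : Bit) → Γ ⊢ ((x ⊑ y ∘ bit b) ⇔ ((x ⊑ y) ∨' (x ≐ y ∘ bit b)))
  ⊑-∘bit x y b = ∧I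
    (⊃I (Subw-∘bit-elim x y b (⊑⇒Subw h₀) (∨I₁ (Subw⇒⊑ h₀)) (∨I₂ (Eq⇒≐ h₀))))
    (⊃I (∨E h₀ (Subw⇒⊑ (Subw-step x y b (⊑⇒Subw h₀))) (Subw⇒⊑ (≐⇒Subw-∘bit x y b h₀))))

  -- Uses `npRule` instead of `ind∃`, because the induction premise on `B` is a hypothesis that the
  -- step must be able to call.
  Σb1-induction : (B : RL.Fm (suc k)) (d : RL.Σb1 B) (ρ : Env (ιs n) k) →
    Γ ⊢ fm (((B RL.[ RL.ε ]₀) RL.∧' RL.∀' (B RL.⇒ (RL.subF (RL.σb b0) B RL.∧' RL.subF (RL.σb b1) B)))
             RL.⇒ RL.∀' B) ρ
  Σb1-induction {k = k} {n = n} {Γ = Γ} B d ρ = ⊃I (cut (npRule s (matrix d) 1̂ ρ base step)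
    (∀I (Normal⇒Σb1 d (ext ρ) (conv (NP-inst s (matrix d) 1̂ (var here) (map wkT ρ))
      (∀E (conv all-wk h₀) (var here))))))
    where
    s = embed (bound d)

    StepF : RL.Fm (suc k)
    StepF = B RL.⇒ (RL.subF (RL.σb b0) B RL.∧' RL.subF (RL.σb b1) B)

    Premise : RL.Fm k
    Premise = (B RL.[ RL.ε ]₀) RL.∧' RL.∀' StepF

    all-wk : wkF (∀' (Normal d (ext ρ))) ≡ ∀' (Normal d (ext (map wkT ρ)))
    all-wk = cong ∀' (trans (NP-sub (extS (λ x → var (there x))) s (matrix d) 1̂ (ext ρ))
      (cong (λ ρ' → Normal d (var here ∷ ρ'))
        (trans (sub-map-wk (λ x → var (there x)) ρ) (cong (map wkT) (map-wk≡sub ρ)))))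

    base : fm Premise ρ ∷ Γ ⊢ Normal d (`ε ∷ ρ)
    base = Σb1⇒Normal d (`ε ∷ ρ) (conv (fm-RLinst B RL.ε ρ) (∧E₁ h₀))

    select : ∀ {m} {Δ : List (Fm m)} (ρ' : Env (ιs m) (suc k)) b →
             Δ ⊢ fm (RL.subF (RL.σb b0) B RL.∧' RL.subF (RL.σb b1) B) ρ' →
             Δ ⊢ fm (RL.subF (RL.σb b) B) ρ'
    select ρ' b0 p = ∧E₁ p
    select ρ' b1 p = ∧E₂ p

    lookup-σb : ∀ b i → ⟦ embed (RL.σb b i) ⟧ (ext ρ) ≡ lookup (var here ∘ bit b ∷ map wkT ρ) i
    lookup-σb b0 zero    = refl
    lookup-σb b1 zero    = refl
    lookup-σb b0 (suc i) = refl
    lookup-σb b1 (suc i) = refl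

    step : ∀ b → fm Premise ρ ∷ Γ ⊢ ∀' (Normal d (ext ρ) ⊃ Normal d (var here ∘ bit b ∷ map wkT ρ))
    step b = ∀I (⊃I (Σb1⇒Normal d _ (conv (fm-RLsub (RL.σb b) (ext ρ) _ (lookup-σb b) B)
      (select (ext ρ) b (⊃E
        (fm-∀E StepF (map wkT ρ) (∧E₂ (conv (fm-wk Premise ρ) (hyp (there (here refl))))) (var here))
        (Normal⇒Σb1 d (ext ρ) h₀))))))

  axiom-sound : {A : RL.Fm k} → RL.IRSAx A → (ρ : Env (ιs n) k) → Γ ⊢ fm A ρ
  axiom-sound (RL.concε x) ρ      = axm (εr _)
  axiom-sound (RL.concB x y b0) ρ = axm (assoc _ _ b0)
  axiom-sound (RL.concB x y b1) ρ = axm (assoc _ _ b1)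
  axiom-sound (RL.timesε x) ρ     = axm (timesε _)
  axiom-sound (RL.timesB x y b0) ρ = Times-∘bit _ _ b0
  axiom-sound (RL.timesB x y b1) ρ = Times-∘bit _ _ b1
  axiom-sound (RL.subε x) ρ       =
    ∧I (⊃I (Subw-ε⇒≐ε _ (⊑⇒Subw h₀))) (⊃I (Subw⇒⊑ (≐ε⇒Subw-ε _ h₀)))
  axiom-sound (RL.subB x y b0) ρ  = ⊑-∘bit _ _ b0
  axiom-sound (RL.subB x y b1) ρ  = ⊑-∘bit _ _ b1
  axiom-sound (RL.inj x y b0) ρ   = ⊃I (∘bit-inj b0 h₀)
  axiom-sound (RL.inj x y b1) ρ   = ⊃I (∘bit-inj b1 h₀)
  axiom-sound (RL.dist01 x y) ρ   = ⊃I (∘0≢∘1 h₀)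
  axiom-sound (RL.nonε x b0) ρ    = ⊃I (∘bit≢ε b0 h₀)
  axiom-sound (RL.nonε x b1) ρ    = ⊃I (∘bit≢ε b1 h₀)
  axiom-sound (RL.ind B d) ρ      = Σb1-induction B d ρ

  -- Soundness of the rules of inference

  hyps : List (RL.Fm k) → Env (ιs n) k → List (Fm n)
  hyps Δ ρ = List.map (λ A → fm A ρ) Δ

  hyps-wk : (Δ : List (RL.Fm k)) (ρ : Env (ιs n) k) →
            hyps (List.map RL.wkF Δ) (ext ρ) ≡ List.map wkF (hyps Δ ρ)
  hyps-wk []      ρ = refl
  hyps-wk (A ∷ Δ) ρ = cong₂ _∷_
    (trans (fm-RLwk (var here) (map wkT ρ) A) (sym (fm-wk A ρ))) (hyps-wk Δ ρ)

  sound : {Δ : List (RL.Fm k)} {A : RL.Fm k} → Δ RL.⊢ A → (ρ : Env (ιs n) k) → hyps Δ ρ ⊢ fm A ρ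
  sound (RL.ax a) ρ     = axiom-sound a ρ
  sound (RL.hyp h) ρ    = hyp (∈-map⁺ (λ A → fm A ρ) h)
  sound (RL.∧I p q) ρ   = ∧I (sound p ρ) (sound q ρ)
  sound (RL.∧E₁ p) ρ    = ∧E₁ (sound p ρ)
  sound (RL.∧E₂ p) ρ    = ∧E₂ (sound p ρ)
  sound (RL.∨I₁ p) ρ    = ∨I₁ (sound p ρ)
  sound (RL.∨I₂ p) ρ    = ∨I₂ (sound p ρ)
  sound (RL.∨E p q r) ρ = ∨E (sound p ρ) (sound q ρ) (sound r ρ)
  sound (RL.⇒I p) ρ     = ⊃I (sound p ρ)
  sound (RL.⇒E p q) ρ   = ⊃E (sound p ρ) (sound q ρ)
  sound (RL.¬I p q) ρ   = ⊃I (⊃E (sound q ρ) (sound p ρ))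
  sound (RL.¬E p q) ρ   = absurd (⊃E (sound q ρ) (sound p ρ))
  sound {Δ = Δ} (RL.∀I {A = A} p) ρ =
    ∀I (subst (_⊢ fm A (ext ρ)) (hyps-wk Δ ρ) (sound p (ext ρ)))
  sound (RL.∀E {A = A} p t) ρ =
    conv (sym (fm-RLinst A t ρ)) (fm-∀E A ρ (sound p ρ) (⟦ embed t ⟧ ρ))
  sound (RL.∃I {A = A} t p) ρ = fm-∃I A ρ (⟦ embed t ⟧ ρ) (conv (fm-RLinst A t ρ) (sound p ρ))
  sound {Δ = Δ} (RL.∃E {A = A} {C} p q) ρ = ∃E (sound p ρ)
    (conv (trans (fm-RLwk (var here) (map wkT ρ) C) (sym (fm-wk C ρ)))
      (subst (λ Δ' → fm A (ext ρ) ∷ Δ' ⊢ fm (RL.wkF C) (ext ρ)) (hyps-wk Δ ρ) (sound q (ext ρ))))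
  sound (RL.refl= t) ρ  = refl= _
  sound (RL.subst= A {t} {u} p q) ρ =
    conv (trans (fm-inst A (⟦ embed u ⟧ ρ) ρ) (sym (fm-RLinst A u ρ)))
      (subst= (fm A (ext ρ)) (sound p ρ)
        (conv (trans (fm-RLinst A t ρ) (sym (fm-inst A (⟦ embed t ⟧ ρ) ρ))) (sound q ρ)))

  open Translation 𝔇

  -- The identity environment and the given translation

  idEnv : ∀ n → Env (ιs n) n
  idEnv zero    = []
  idEnv (suc n) = ext (idEnv n)

  lookup-idEnv : (i : Fin n) → lookup (idEnv n) i ≡ var (finVar i)
  lookup-idEnv {n = suc n} zero    = refl
  lookup-idEnv {n = suc n} (suc i) =
    trans (lookup-map i wkT (idEnv n)) (cong wkT (lookup-idEnv i))

  embed-id : (t : RL.Tm n) → ⟦ embed t ⟧ (idEnv n) ≡ trT t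
  embed-id (RL.var i) = lookup-idEnv i
  embed-id RL.ε       = refl
  embed-id RL.𝟘       = refl
  embed-id RL.𝟙       = refl
  embed-id (t RL.⌢ u) = cong₂ _∘_ (embed-id t) (embed-id u)
  embed-id (t RL.⊗ u) = cong₂ Times (embed-id t) (embed-id u)

  fm-id : (A : RL.Fm n) → fm A (idEnv n) ≡ trF A
  fm-id (RL.Flip t) = cong Flip (embed-id t)
  fm-id (t RL.≐ u)  = cong₂ _≐_ (embed-id t) (embed-id u)
  fm-id (t RL.⊑ u)  = cong₂ _⊑_ (embed-id t) (embed-id u)
  fm-id (RL.¬' A)   = cong POR.¬' (fm-id A)
  fm-id (A RL.∧' B) = cong₂ _∧'_ (fm-id A) (fm-id B)
  fm-id (A RL.∨' B) = cong₂ _∨'_ (fm-id A) (fm-id B)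
  fm-id (A RL.⇒ B)  = cong₂ _⊃_ (fm-id A) (fm-id B)
  fm-id (RL.∃' A)   = cong ∃' (fm-id A)
  fm-id (RL.∀' A)   = cong ∀' (fm-id A)

mainTheorem10 : (D : POR.Defined) {n : ℕ} (A : RL.Fm n) →
    [] RL.⊢ A → POR.Theory._⊢_ D [] (Translation.trF D A)
mainTheorem10 D {n} A p = conv D (fm-id D A) (sound D p (idEnv D n))
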